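{- Let $r=r(n)$ and $s=s(n)$ be sequences of positive integers with $s<r<n$, such that, as $n\to\infty$, $r\to\infty$, $s\to\infty$, $s=o(r)$ and $r^2=o(n)$. Let $p=p(n)\in[0,1]$ satisfy $$p\ \ge\ \frac{16\,s\,r^2\ln(n/r)}{n}.$$ Then $$\mathsf{P}\Bigl(\alpha\bigl(G_p(n,r,<s)\bigr)=\binom{n-s}{r-s}\Bigr)\to 1,\qquad n\to\infty.$$
   Context: $[n]=\{1,\dots,n\}$. The graph $G(n,r,<s)$ has vertex set $V(n,r)=\{x\subset[n]\colon |x|=r\}$, and two distinct vertices $x,y$ are joined by an edge if and only if $|x\cap y|<s$. For $p\in[0,1]$, the random graph $G_p(n,r,<s)$ is the random spanning subgraph of $G(n,r,<s)$ (same vertex set $V(n,r)$) in which each edge of $G(n,r,<s)$ is kept with probability $p$, independently of all other edges. For a graph $H$, $\alpha(H)$ denotes its independence number, i.e. the maximum cardinality of a set of vertices no two of which are joined by an edge. -}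

module Defs where

open import Data.Fin as Fin using (Fin)
import Data.Fin.Properties as Fin
open import Data.Fin.Subset using (Subset; ∣_∣; _∩_; _∈_; ∁; inside; outside)
open import Data.Fin.Subset.Properties using (∩-comm; _∈?_)
open import Data.Integer as ℤ using (+_; +[1+_])
import Data.Integer.Properties as ℤ
open import Data.List using (List; []; _∷_; _++_; map; filter; foldr; length; lookup; allFin; cartesianProduct)
open import Data.List.Extrema.Nat using (max)
import Data.List.Relation.Unary.All as All
open import Data.List.Relation.Unary.All.Properties using (all-filter)
open import Data.List.Membership.Propositional.Properties using (∈-lookup)
open import Data.Nat as ℕ using (ℕ; zero; suc; NonZero; _⊔_)
import Data.Nat.Properties as ℕ
open import Data.Product using (∃; _×_; _,_; proj₁; proj₂)
open import Data.Product.Properties using (≡-dec)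
open import Data.Rational as ℚ using (ℚ; 0ℚ; 1ℚ; ½; _/_; mkℚ)
import Data.Rational.Properties as ℚ
open import Data.Rational.Solver using (module +-*-Solver)
import Data.Rational.Unnormalised as ℚᵘ
import Data.Rational.Unnormalised.Properties as ℚᵘ
open import Data.Sum using (_⊎_; inj₁; inj₂)
open import Data.Vec using ([]; _∷_)
open import Level using (0ℓ)
open import Relation.Binary using (Rel; Decidable; Symmetric; Irreflexive)
open import Relation.Binary.PropositionalEquality using (_≡_; _≢_; refl; sym; trans; cong; cong₂; subst)
open import Relation.Nullary using (¬_)
open import Relation.Nullary.Decidable using (_×-dec_; _⊎-dec_; _→-dec_; ¬?)
import Relation.Unary as U

Eventually : (ℕ → Set) → Set
Eventually P = ∃ λ N → ∀ n → N ℕ.≤ n → P n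

syntax Eventually (λ n → P) = ∀ᶠ[ n ] P

infix 4 _⟶∞ _=o_

_⟶∞ : (ℕ → ℕ) → Set
f ⟶∞ = ∀ K → ∀ᶠ[ n ] (K ℕ.≤ f n)

_=o_ : (ℕ → ℕ) → (ℕ → ℕ) → Set
f =o g = ∀ (ε : ℚ) → 0ℚ ℚ.< ε → ∀ᶠ[ n ] (+ f n / 1 ℚ.≤ ε ℚ.* (+ g n / 1))

Cauchy : (ℕ → ℚ) → Set
Cauchy x = ∀ ε → 0ℚ ℚ.< ε →
  ∃ λ N → ∀ m n → N ℕ.≤ m → N ℕ.≤ n → ℚ.∣ x m ℚ.- x n ∣ ℚ.≤ ε

record ℝ : Set where
  constructor mkℝ
  field
    seq    : ℕ → ℚ
    cauchy : Cauchy seq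

open ℝ public

private
  half-pos : ∀ {ε} → 0ℚ ℚ.< ε → 0ℚ ℚ.< ε ℚ.* ½
  half-pos {ε} 0<ε = ℚ.positive⁻¹ (ε ℚ.* ½) {{ℚ.pos*pos⇒pos ε {{ℚ.positive 0<ε}} ½}}

  half+half : ∀ ε → ε ℚ.* ½ ℚ.+ ε ℚ.* ½ ≡ ε
  half+half ε = trans (sym (ℚ.*-distribˡ-+ ε ½ ½)) (ℚ.*-identityʳ ε)

  ∣p-q∣≡∣q-p∣ : ∀ p q → ℚ.∣ p ℚ.- q ∣ ≡ ℚ.∣ q ℚ.- p ∣
  ∣p-q∣≡∣q-p∣ p q = trans (sym (ℚ.∣-p∣≡∣p∣ (p ℚ.- q)))
    (cong ℚ.∣_∣ (solve 2 (λ p q → :- (p :- q) := q :- p) refl p q))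
    where open +-*-Solver

  p≤∣p∣ : ∀ p → p ℚ.≤ ℚ.∣ p ∣
  p≤∣p∣ p with ℚ.≤-total 0ℚ p
  ... | inj₁ 0≤p = ℚ.≤-reflexive (sym (ℚ.0≤p⇒∣p∣≡p 0≤p))
  ... | inj₂ p≤0 = ℚ.≤-trans p≤0 (ℚ.0≤∣p∣ p)

  ∣p∣≤ : ∀ {p e} → p ℚ.≤ e → ℚ.- p ℚ.≤ e → ℚ.∣ p ∣ ℚ.≤ e
  ∣p∣≤ {p} p≤e -p≤e with ℚ.∣p∣≡p∨∣p∣≡-p p
  ... | inj₁ eq = ℚ.≤-trans (ℚ.≤-reflexive eq) p≤e
  ... | inj₂ eq = ℚ.≤-trans (ℚ.≤-reflexive eq) -p≤e

  ∣p∣≤∣p-q∣+∣q∣ : ∀ p q → ℚ.∣ p ∣ ℚ.≤ ℚ.∣ p ℚ.- q ∣ ℚ.+ ℚ.∣ q ∣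
  ∣p∣≤∣p-q∣+∣q∣ p q = ℚ.≤-trans
    (ℚ.≤-reflexive (cong ℚ.∣_∣ (solve 2 (λ p q → p := (p :- q) :+ q) refl p q)))
    (ℚ.∣p+q∣≤∣p∣+∣q∣ (p ℚ.- q) q)
    where open +-*-Solver

  ≤+⇒-≤ : ∀ p q r → p ℚ.≤ q ℚ.+ r → p ℚ.- r ℚ.≤ q
  ≤+⇒-≤ p q r h = ℚ.≤-trans (ℚ.+-monoˡ-≤ (ℚ.- r) h)
    (ℚ.≤-reflexive (solve 2 (λ q r → (q :+ r) :- r := q) refl q r))
    where open +-*-Solver

  *-mono-≤ : ∀ {p q r s} → 0ℚ ℚ.≤ q → 0ℚ ℚ.≤ r → p ℚ.≤ q → r ℚ.≤ s → p ℚ.* r ℚ.≤ q ℚ.* s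
  *-mono-≤ {p} {q} {r} {s} 0≤q 0≤r p≤q r≤s = ℚ.≤-trans
    (ℚ.*-monoʳ-≤-nonNeg r {{ℚ.nonNegative 0≤r}} p≤q)
    (ℚ.*-monoˡ-≤-nonNeg q {{ℚ.nonNegative 0≤q}} r≤s)

  bounded : ∀ x → Cauchy x → ∃ λ B → 0ℚ ℚ.< B × (∃ λ N → ∀ n → N ℕ.≤ n → ℚ.∣ x n ∣ ℚ.≤ B)
  bounded x c with c 1ℚ (ℚ.positive⁻¹ 1ℚ)
  ... | N , h = 1ℚ ℚ.+ ℚ.∣ x N ∣
    , ℚ.<-≤-trans (ℚ.positive⁻¹ 1ℚ)
        (ℚ.≤-trans (ℚ.≤-reflexive (sym (ℚ.+-identityʳ 1ℚ))) (ℚ.+-monoʳ-≤ 1ℚ (ℚ.0≤∣p∣ (x N))))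
    , N , λ n N≤n → ℚ.≤-trans (∣p∣≤∣p-q∣+∣q∣ (x n) (x N))
        (ℚ.+-monoˡ-≤ ℚ.∣ x N ∣ (h n N N≤n ℕ.≤-refl))

  const-cauchy : ∀ q → Cauchy (λ _ → q)
  const-cauchy q ε 0<ε = 0 , λ _ _ _ _ →
    ℚ.≤-trans (ℚ.≤-reflexive (cong ℚ.∣_∣ (ℚ.+-inverseʳ q))) (ℚ.<⇒≤ 0<ε)

  +-cauchy : ∀ x y → Cauchy x → Cauchy y → Cauchy (λ n → x n ℚ.+ y n)
  +-cauchy x y cx cy ε 0<ε with cx (ε ℚ.* ½) (half-pos 0<ε) | cy (ε ℚ.* ½) (half-pos 0<ε)
  ... | M , hx | N , hy = M ⊔ N , λ m n lm ln → begin
    ℚ.∣ (x m ℚ.+ y m) ℚ.- (x n ℚ.+ y n) ∣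
      ≡⟨ cong ℚ.∣_∣ (solve 4 (λ a b c d → (a :+ b) :- (c :+ d) := (a :- c) :+ (b :- d)) refl (x m) (y m) (x n) (y n)) ⟩
    ℚ.∣ (x m ℚ.- x n) ℚ.+ (y m ℚ.- y n) ∣
      ≤⟨ ℚ.∣p+q∣≤∣p∣+∣q∣ (x m ℚ.- x n) (y m ℚ.- y n) ⟩
    ℚ.∣ x m ℚ.- x n ∣ ℚ.+ ℚ.∣ y m ℚ.- y n ∣
      ≤⟨ ℚ.+-mono-≤ (hx m n (ℕ.m⊔n≤o⇒m≤o M N lm) (ℕ.m⊔n≤o⇒m≤o M N ln))
                    (hy m n (ℕ.m⊔n≤o⇒n≤o M N lm) (ℕ.m⊔n≤o⇒n≤o M N ln)) ⟩
    ε ℚ.* ½ ℚ.+ ε ℚ.* ½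
      ≡⟨ half+half ε ⟩
    ε ∎
    where open ℚ.≤-Reasoning
          open +-*-Solver

  neg-cauchy : ∀ x → Cauchy x → Cauchy (λ n → ℚ.- x n)
  neg-cauchy x cx ε 0<ε with cx ε 0<ε
  ... | N , h = N , λ m n lm ln → ℚ.≤-trans
    (ℚ.≤-reflexive (cong ℚ.∣_∣ (solve 2 (λ a b → (:- a) :- (:- b) := b :- a) refl (x m) (x n))))
    (h n m ln lm)
    where open +-*-Solver

  split : ∀ ε A B → 0ℚ ℚ.< ε → 0ℚ ℚ.< A → 0ℚ ℚ.< B →
          ∃ λ δ → 0ℚ ℚ.< δ × A ℚ.* δ ℚ.+ δ ℚ.* B ≡ ε
  split ε A B 0<ε 0<A 0<B = go (A ℚ.+ B) refl (ℚ.pos+pos⇒pos A {{ℚ.positive 0<A}} B {{ℚ.positive 0<B}})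
    where
    go : ∀ C → C ≡ A ℚ.+ B → ℚ.Positive C → ∃ λ δ → 0ℚ ℚ.< δ × A ℚ.* δ ℚ.+ δ ℚ.* B ≡ ε
    go C C≡ C-pos = inv (ℚ.1/ C) (ℚ.*-inverseˡ C) (ℚ.1/pos⇒pos C)
      where
      instance
        _ : ℚ.Positive C
        _ = C-pos
        _ : ℚ.NonZero C
        _ = ℚ.pos⇒nonZero C
      inv : ∀ I → I ℚ.* C ≡ 1ℚ → ℚ.Positive I → ∃ λ δ → 0ℚ ℚ.< δ × A ℚ.* δ ℚ.+ δ ℚ.* B ≡ ε
      inv I IC≡1 I-pos = ε ℚ.* I
        , ℚ.positive⁻¹ (ε ℚ.* I) {{ℚ.pos*pos⇒pos ε {{ℚ.positive 0<ε}} I {{I-pos}}}}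
        , trans (solve 4 (λ a b e i → a :* (e :* i) :+ (e :* i) :* b := e :* (i :* (a :+ b))) refl A B ε I)
          (trans (cong (λ z → ε ℚ.* (I ℚ.* z)) (sym C≡))
          (trans (cong (ε ℚ.*_) IC≡1) (ℚ.*-identityʳ ε)))
        where open +-*-Solver

  *-bound : ∀ {A B δ ε} a b c d → 0ℚ ℚ.< A → 0ℚ ℚ.< δ → A ℚ.* δ ℚ.+ δ ℚ.* B ≡ ε →
    ℚ.∣ a ∣ ℚ.≤ A → ℚ.∣ d ∣ ℚ.≤ B → ℚ.∣ b ℚ.- d ∣ ℚ.≤ δ → ℚ.∣ a ℚ.- c ∣ ℚ.≤ δ →
    ℚ.∣ a ℚ.* b ℚ.- c ℚ.* d ∣ ℚ.≤ ε
  *-bound {A} {B} {δ} {ε} a b c d 0<A 0<δ eq ∣a∣≤A ∣d∣≤B b≈d a≈c = begin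
    ℚ.∣ a ℚ.* b ℚ.- c ℚ.* d ∣
      ≡⟨ cong ℚ.∣_∣ (solve 4 (λ a b c d → a :* b :- c :* d := a :* (b :- d) :+ (a :- c) :* d) refl a b c d) ⟩
    ℚ.∣ a ℚ.* (b ℚ.- d) ℚ.+ (a ℚ.- c) ℚ.* d ∣
      ≤⟨ ℚ.∣p+q∣≤∣p∣+∣q∣ (a ℚ.* (b ℚ.- d)) ((a ℚ.- c) ℚ.* d) ⟩
    ℚ.∣ a ℚ.* (b ℚ.- d) ∣ ℚ.+ ℚ.∣ (a ℚ.- c) ℚ.* d ∣
      ≡⟨ cong₂ ℚ._+_ (ℚ.∣p*q∣≡∣p∣*∣q∣ a (b ℚ.- d)) (ℚ.∣p*q∣≡∣p∣*∣q∣ (a ℚ.- c) d) ⟩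
    ℚ.∣ a ∣ ℚ.* ℚ.∣ b ℚ.- d ∣ ℚ.+ ℚ.∣ a ℚ.- c ∣ ℚ.* ℚ.∣ d ∣
      ≤⟨ ℚ.+-mono-≤ (*-mono-≤ (ℚ.<⇒≤ 0<A) (ℚ.0≤∣p∣ (b ℚ.- d)) ∣a∣≤A b≈d)
                    (*-mono-≤ (ℚ.<⇒≤ 0<δ) (ℚ.0≤∣p∣ d) a≈c ∣d∣≤B) ⟩
    A ℚ.* δ ℚ.+ δ ℚ.* B
      ≡⟨ eq ⟩
    ε ∎
    where open ℚ.≤-Reasoning
          open +-*-Solver

  *-cauchy : ∀ x y → Cauchy x → Cauchy y → Cauchy (λ n → x n ℚ.* y n)
  *-cauchy x y cx cy ε 0<ε =
    let A , 0<A , K , hA = bounded x cx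
        B , 0<B , L , hB = bounded y cy
        δ , 0<δ , eq     = split ε A B 0<ε 0<A 0<B
        M , hx           = cx δ 0<δ
        N , hy           = cy δ 0<δ
    in (K ⊔ L) ⊔ (M ⊔ N) , λ m n lm ln →
      let KL≤m = ℕ.m⊔n≤o⇒m≤o (K ⊔ L) (M ⊔ N) lm
          KL≤n = ℕ.m⊔n≤o⇒m≤o (K ⊔ L) (M ⊔ N) ln
          MN≤m = ℕ.m⊔n≤o⇒n≤o (K ⊔ L) (M ⊔ N) lm
          MN≤n = ℕ.m⊔n≤o⇒n≤o (K ⊔ L) (M ⊔ N) ln
      in *-bound (x m) (y m) (x n) (y n) 0<A 0<δ eq
           (hA m (ℕ.m⊔n≤o⇒m≤o K L KL≤m)) (hB n (ℕ.m⊔n≤o⇒n≤o K L KL≤n))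
           (hy m n (ℕ.m⊔n≤o⇒n≤o M N MN≤m) (ℕ.m⊔n≤o⇒n≤o M N MN≤n))
           (hx m n (ℕ.m⊔n≤o⇒m≤o M N MN≤m) (ℕ.m⊔n≤o⇒m≤o M N MN≤n))

  abs-cauchy : ∀ x → Cauchy x → Cauchy (λ n → ℚ.∣ x n ∣)
  abs-cauchy x cx ε 0<ε with cx ε 0<ε
  ... | N , h = N , λ m n lm ln → ∣p∣≤
    (ℚ.≤-trans (≤+⇒-≤ ℚ.∣ x m ∣ _ ℚ.∣ x n ∣ (∣p∣≤∣p-q∣+∣q∣ (x m) (x n))) (h m n lm ln))
    (ℚ.≤-trans (ℚ.≤-reflexive (solve 2 (λ a b → :- (a :- b) := b :- a) refl ℚ.∣ x m ∣ ℚ.∣ x n ∣))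
      (ℚ.≤-trans (≤+⇒-≤ ℚ.∣ x n ∣ _ ℚ.∣ x m ∣ (∣p∣≤∣p-q∣+∣q∣ (x n) (x m))) (h n m ln lm)))
    where open +-*-Solver

infix  4 _≤ℝ_ _⟶_
infixl 6 _+ℝ_ _-ℝ_
infixl 7 _*ℝ_
infix  8 -ℝ_
infixr 8 _^ℝ_

fromℚ : ℚ → ℝ
fromℚ q = mkℝ (λ _ → q) (const-cauchy q)

0ℝ 1ℝ : ℝ
0ℝ = fromℚ 0ℚ
1ℝ = fromℚ 1ℚ

_+ℝ_ : ℝ → ℝ → ℝ
x +ℝ y = mkℝ (λ n → seq x n ℚ.+ seq y n) (+-cauchy (seq x) (seq y) (cauchy x) (cauchy y))

-ℝ_ : ℝ → ℝ
-ℝ x = mkℝ (λ n → ℚ.- seq x n) (neg-cauchy (seq x) (cauchy x))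

_-ℝ_ : ℝ → ℝ → ℝ
x -ℝ y = x +ℝ (-ℝ y)

_*ℝ_ : ℝ → ℝ → ℝ
x *ℝ y = mkℝ (λ n → seq x n ℚ.* seq y n) (*-cauchy (seq x) (seq y) (cauchy x) (cauchy y))

∣_∣ℝ : ℝ → ℝ
∣ x ∣ℝ = mkℝ (λ n → ℚ.∣ seq x n ∣) (abs-cauchy (seq x) (cauchy x))

_^ℝ_ : ℝ → ℕ → ℝ
x ^ℝ zero  = 1ℝ
x ^ℝ suc k = x *ℝ x ^ℝ k

sumℝ : List ℝ → ℝ
sumℝ = foldr _+ℝ_ 0ℝ

_≤ℝ_ : ℝ → ℝ → Set
x ≤ℝ y = ∀ ε → 0ℚ ℚ.< ε → ∀ᶠ[ n ] (seq x n ℚ.≤ seq y n ℚ.+ ε)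

_⟶_ : (ℕ → ℝ) → ℝ → Set
x ⟶ l = ∀ ε → 0ℚ ℚ.< ε → ∀ᶠ[ n ] (∣ x n -ℝ l ∣ℝ ≤ℝ fromℚ ε)

harmonic : ℕ → ℚ
harmonic zero    = 0ℚ
harmonic (suc n) = harmonic n ℚ.+ + 1 / suc n

-- For b ≤ a this is ∑_{bN < j ≤ aN} (1/N) · 1/(j/N), the Riemann sum of
-- mesh 1/N for ∫_b^a dt/t = ln (a/b); for a < b it is minus that for ∫_a^b.
lnSum : ℕ → ℕ → ℕ → ℚ
lnSum a b N = harmonic (a ℕ.* N) ℚ.- harmonic (b ℕ.* N)

private
  frac-≤ : ∀ a b c d .{{_ : NonZero b}} .{{_ : NonZero d}} →
           a ℕ.* d ℕ.≤ c ℕ.* b → + a / b ℚ.≤ + c / d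
  frac-≤ a (suc b) c (suc d) h = ℚ.toℚᵘ-cancel-≤ (begin
    ℚ.toℚᵘ (+ a / suc b)  ≃⟨ ℚ.toℚᵘ-fromℚᵘ (ℚᵘ.mkℚᵘ (+ a) b) ⟩
    ℚᵘ.mkℚᵘ (+ a) b       ≤⟨ ℚᵘ.*≤* (*-pos h) ⟩
    ℚᵘ.mkℚᵘ (+ c) d       ≃⟨ ℚᵘ.≃-sym (ℚ.toℚᵘ-fromℚᵘ (ℚᵘ.mkℚᵘ (+ c) d)) ⟩
    ℚ.toℚᵘ (+ c / suc d)  ∎)
    where
    open ℚᵘ.≤-Reasoning
    *-pos : a ℕ.* suc d ℕ.≤ c ℕ.* suc b → + a ℤ.* + suc d ℤ.≤ + c ℤ.* + suc b
    *-pos h rewrite sym (ℤ.pos-* a (suc d)) | sym (ℤ.pos-* c (suc b)) = ℤ.+≤+ h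

  frac-suc : ∀ k m .{{_ : NonZero m}} → + k / m ℚ.+ + 1 / m ≡ + suc k / m
  frac-suc k (suc m) = ℚ.toℚᵘ-injective (begin-equality
    ℚ.toℚᵘ (+ k / suc m ℚ.+ + 1 / suc m)
      ≃⟨ ℚ.toℚᵘ-homo-+ (+ k / suc m) (+ 1 / suc m) ⟩
    ℚ.toℚᵘ (+ k / suc m) ℚᵘ.+ ℚ.toℚᵘ (+ 1 / suc m)
      ≃⟨ ℚᵘ.+-cong (ℚ.toℚᵘ-fromℚᵘ (ℚᵘ.mkℚᵘ (+ k) m)) (ℚ.toℚᵘ-fromℚᵘ (ℚᵘ.mkℚᵘ (+ 1) m)) ⟩
    ℚᵘ.mkℚᵘ (+ k) m ℚᵘ.+ ℚᵘ.mkℚᵘ (+ 1) m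
      ≃⟨ ℚᵘ.*≡* eq ⟩
    ℚᵘ.mkℚᵘ (+ suc k) m
      ≃⟨ ℚᵘ.≃-sym (ℚ.toℚᵘ-fromℚᵘ (ℚᵘ.mkℚᵘ (+ suc k) m)) ⟩
    ℚ.toℚᵘ (+ suc k / suc m) ∎)
    where
    open ℚᵘ.≤-Reasoning
    M = + suc m
    eq : (+ k ℤ.* M ℤ.+ + 1 ℤ.* M) ℤ.* M ≡ + suc k ℤ.* (M ℤ.* M)
    eq = trans (cong (ℤ._* M) (sym (ℤ.*-distribʳ-+ M (+ k) (+ 1))))
        (trans (ℤ.*-assoc (+ k ℤ.+ + 1) M M)
               (cong (λ z → + z ℤ.* (M ℤ.* M)) (ℕ.+-comm k 1)))

  block-upper : ∀ k m .{{_ : NonZero m}} → harmonic (k ℕ.+ m) ℚ.≤ harmonic m ℚ.+ + k / m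
  block-upper zero m = ℚ.≤-trans (ℚ.≤-reflexive (sym (ℚ.+-identityʳ (harmonic m))))
    (ℚ.+-monoʳ-≤ (harmonic m) (frac-≤ 0 1 0 m ℕ.≤-refl))
  block-upper (suc k) m = begin
    harmonic (k ℕ.+ m) ℚ.+ + 1 / suc (k ℕ.+ m)
      ≤⟨ ℚ.+-mono-≤ (block-upper k m) (frac-≤ 1 (suc (k ℕ.+ m)) 1 m
           (ℕ.*-monoʳ-≤ 1 (ℕ.m≤n⇒m≤1+n (ℕ.m≤n+m m k)))) ⟩
    (harmonic m ℚ.+ + k / m) ℚ.+ + 1 / m
      ≡⟨ ℚ.+-assoc (harmonic m) (+ k / m) (+ 1 / m) ⟩
    harmonic m ℚ.+ (+ k / m ℚ.+ + 1 / m)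
      ≡⟨ cong (harmonic m ℚ.+_) (frac-suc k m) ⟩
    harmonic m ℚ.+ + suc k / m ∎
    where open ℚ.≤-Reasoning

  block-lower : ∀ k m M .{{_ : NonZero M}} → k ℕ.+ m ℕ.≤ M →
                harmonic m ℚ.+ + k / M ℚ.≤ harmonic (k ℕ.+ m)
  block-lower zero m M _ = ℚ.≤-trans
    (ℚ.+-monoʳ-≤ (harmonic m) (frac-≤ 0 M 0 1 ℕ.≤-refl))
    (ℚ.≤-reflexive (ℚ.+-identityʳ (harmonic m)))
  block-lower (suc k) m M le = begin
    harmonic m ℚ.+ + suc k / M
      ≡⟨ cong (harmonic m ℚ.+_) (sym (frac-suc k M)) ⟩
    harmonic m ℚ.+ (+ k / M ℚ.+ + 1 / M)
      ≡⟨ sym (ℚ.+-assoc (harmonic m) (+ k / M) (+ 1 / M)) ⟩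
    (harmonic m ℚ.+ + k / M) ℚ.+ + 1 / M
      ≤⟨ ℚ.+-mono-≤ (block-lower k m M (ℕ.≤-trans (ℕ.n≤1+n _) le))
           (frac-≤ 1 M 1 (suc (k ℕ.+ m)) (ℕ.*-monoʳ-≤ 1 le)) ⟩
    harmonic (k ℕ.+ m) ℚ.+ + 1 / suc (k ℕ.+ m) ∎
    where open ℚ.≤-Reasoning

  lnSum-step : ∀ a b N .{{_ : NonZero a}} .{{_ : NonZero b}} .{{_ : NonZero N}} →
    lnSum a b (suc N) ℚ.≤ lnSum a b N ℚ.+ (+ 1 / N ℚ.- + 1 / suc N)
  lnSum-step a b N = begin
    harmonic (a ℕ.* suc N) ℚ.- harmonic (b ℕ.* suc N)
      ≤⟨ ℚ.+-mono-≤ upper (ℚ.neg-antimono-≤ lower) ⟩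
    (harmonic (a ℕ.* N) ℚ.+ + 1 / N) ℚ.- (harmonic (b ℕ.* N) ℚ.+ + 1 / suc N)
      ≡⟨ solve 4 (λ p q r s → (p :+ q) :- (r :+ s) := (p :- r) :+ (q :- s)) refl
           (harmonic (a ℕ.* N)) (+ 1 / N) (harmonic (b ℕ.* N)) (+ 1 / suc N) ⟩
    lnSum a b N ℚ.+ (+ 1 / N ℚ.- + 1 / suc N) ∎
    where
    open ℚ.≤-Reasoning
    open +-*-Solver
    instance
      aN≢0 : NonZero (a ℕ.* N)
      aN≢0 = ℕ.m*n≢0 a N
      bN≢0 : NonZero (b ℕ.* suc N)
      bN≢0 = ℕ.m*n≢0 b (suc N)
    upper : harmonic (a ℕ.* suc N) ℚ.≤ harmonic (a ℕ.* N) ℚ.+ + 1 / N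
    upper = begin
      harmonic (a ℕ.* suc N)               ≡⟨ cong harmonic (ℕ.*-suc a N) ⟩
      harmonic (a ℕ.+ a ℕ.* N)             ≤⟨ block-upper a (a ℕ.* N) ⟩
      harmonic (a ℕ.* N) ℚ.+ + a / (a ℕ.* N)
        ≤⟨ ℚ.+-monoʳ-≤ (harmonic (a ℕ.* N)) (frac-≤ a (a ℕ.* N) 1 N
             (ℕ.≤-reflexive (sym (ℕ.*-identityˡ (a ℕ.* N))))) ⟩
      harmonic (a ℕ.* N) ℚ.+ + 1 / N ∎
    lower : harmonic (b ℕ.* N) ℚ.+ + 1 / suc N ℚ.≤ harmonic (b ℕ.* suc N)
    lower = begin
      harmonic (b ℕ.* N) ℚ.+ + 1 / suc N
        ≤⟨ ℚ.+-monoʳ-≤ (harmonic (b ℕ.* N)) (frac-≤ 1 (suc N) b (b ℕ.* suc N)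
             (ℕ.≤-reflexive (ℕ.*-identityˡ (b ℕ.* suc N)))) ⟩
      harmonic (b ℕ.* N) ℚ.+ + b / (b ℕ.* suc N)
        ≤⟨ block-lower b (b ℕ.* N) (b ℕ.* suc N) (ℕ.≤-reflexive (sym (ℕ.*-suc b N))) ⟩
      harmonic (b ℕ.+ b ℕ.* N)  ≡⟨ cong harmonic (sym (ℕ.*-suc b N)) ⟩
      harmonic (b ℕ.* suc N) ∎

  lnSum-steps : ∀ a b N k .{{_ : NonZero a}} .{{_ : NonZero b}} →
    lnSum a b (k ℕ.+ suc N) ℚ.- lnSum a b (suc N) ℚ.≤
    + 1 / suc N ℚ.- (+ 1 / (k ℕ.+ suc N)) {{ℕ.>-nonZero (ℕ.≤-trans (ℕ.s≤s ℕ.z≤n) (ℕ.m≤n+m (suc N) k))}}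
  lnSum-steps a b N zero = ℚ.≤-reflexive
    (trans (ℚ.+-inverseʳ (lnSum a b (suc N))) (sym (ℚ.+-inverseʳ (+ 1 / suc N))))
  lnSum-steps a b N (suc k) = begin
    lnSum a b (suc M) ℚ.- lnSum a b (suc N)
      ≤⟨ ℚ.+-monoˡ-≤ (ℚ.- lnSum a b (suc N)) (lnSum-step a b M) ⟩
    lnSum a b M ℚ.+ (+ 1 / M ℚ.- + 1 / suc M) ℚ.- lnSum a b (suc N)
      ≡⟨ solve 3 (λ p q r → p :+ q :- r := (p :- r) :+ q) refl
           (lnSum a b M) (+ 1 / M ℚ.- + 1 / suc M) (lnSum a b (suc N)) ⟩
    (lnSum a b M ℚ.- lnSum a b (suc N)) ℚ.+ (+ 1 / M ℚ.- + 1 / suc M)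
      ≤⟨ ℚ.+-monoˡ-≤ (+ 1 / M ℚ.- + 1 / suc M) (lnSum-steps a b N k) ⟩
    (+ 1 / suc N ℚ.- + 1 / M) ℚ.+ (+ 1 / M ℚ.- + 1 / suc M)
      ≡⟨ solve 3 (λ p q r → (p :- q) :+ (q :- r) := p :- r) refl
           (+ 1 / suc N) (+ 1 / M) (+ 1 / suc M) ⟩
    + 1 / suc N ℚ.- + 1 / suc M ∎
    where
    open ℚ.≤-Reasoning
    open +-*-Solver
    M = k ℕ.+ suc N
    instance
      M≢0 : NonZero M
      M≢0 = ℕ.>-nonZero (ℕ.≤-trans (ℕ.s≤s ℕ.z≤n) (ℕ.m≤n+m (suc N) k))

  lnSum-bound : ∀ a b N M .{{_ : NonZero a}} .{{_ : NonZero b}} → suc N ℕ.≤ M →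
    lnSum a b M ℚ.- lnSum a b (suc N) ℚ.≤ + 1 / suc N
  lnSum-bound a b N M le = begin
    lnSum a b M ℚ.- lnSum a b (suc N)
      ≡⟨ cong (λ z → lnSum a b z ℚ.- lnSum a b (suc N)) (sym (ℕ.m∸n+n≡m le)) ⟩
    lnSum a b (k ℕ.+ suc N) ℚ.- lnSum a b (suc N)
      ≤⟨ lnSum-steps a b N k ⟩
    + 1 / suc N ℚ.- + 1 / (k ℕ.+ suc N)
      ≤⟨ ℚ.+-monoʳ-≤ (+ 1 / suc N) (ℚ.neg-antimono-≤ (frac-≤ 0 1 1 (k ℕ.+ suc N) ℕ.z≤n)) ⟩
    + 1 / suc N ℚ.+ 0ℚ
      ≡⟨ ℚ.+-identityʳ (+ 1 / suc N) ⟩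
    + 1 / suc N ∎
    where
    open ℚ.≤-Reasoning
    k = M ℕ.∸ suc N
    instance
      k≢0 : NonZero (k ℕ.+ suc N)
      k≢0 = ℕ.>-nonZero (ℕ.≤-trans (ℕ.s≤s ℕ.z≤n) (ℕ.m≤n+m (suc N) k))

  lnSum-close : ∀ a b N M .{{_ : NonZero a}} .{{_ : NonZero b}} → suc N ℕ.≤ M →
    ℚ.∣ lnSum a b M ℚ.- lnSum a b (suc N) ∣ ℚ.≤ + 1 / suc N
  lnSum-close a b N M le = ∣p∣≤ (lnSum-bound a b N M le)
    (ℚ.≤-trans (ℚ.≤-reflexive
      (solve 4 (λ p q r s → :- ((p :- q) :- (r :- s)) := (q :- p) :- (s :- r)) refl
        (harmonic (a ℕ.* M)) (harmonic (b ℕ.* M)) (harmonic (a ℕ.* suc N)) (harmonic (b ℕ.* suc N))))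
      (lnSum-bound b a N M le))
    where open +-*-Solver

  archimedean : ∀ ε → 0ℚ ℚ.< ε → ∃ λ N → + 1 / suc N ℚ.≤ ε
  archimedean ε@(mkℚ +[1+ n ] d _) _ = d , ℚ.≤-trans
    (frac-≤ 1 (suc d) (suc n) (suc d) (ℕ.*-monoˡ-≤ (suc d) (ℕ.s≤s (ℕ.z≤n {n}))))
    (ℚ.≤-reflexive (ℚ.↥p/↧p≡p ε))
  archimedean (mkℚ (+ 0) _ _) (ℚ.*<* (ℤ.+<+ ()))
  archimedean (mkℚ ℤ.-[1+ _ ] _ _) (ℚ.*<* ())

  lnSum-cauchy : ∀ a b .{{_ : NonZero a}} .{{_ : NonZero b}} → Cauchy (lnSum a b)
  lnSum-cauchy a b ε 0<ε with archimedean (ε ℚ.* ½) (half-pos 0<ε)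
  ... | K , hK = suc K , λ m n lm ln → begin
    ℚ.∣ f m ℚ.- f n ∣
      ≡⟨ cong ℚ.∣_∣ (solve 3 (λ p q r → p :- r := (p :- q) :+ (q :- r)) refl (f m) (f (suc K)) (f n)) ⟩
    ℚ.∣ (f m ℚ.- f (suc K)) ℚ.+ (f (suc K) ℚ.- f n) ∣
      ≤⟨ ℚ.∣p+q∣≤∣p∣+∣q∣ (f m ℚ.- f (suc K)) (f (suc K) ℚ.- f n) ⟩
    ℚ.∣ f m ℚ.- f (suc K) ∣ ℚ.+ ℚ.∣ f (suc K) ℚ.- f n ∣
      ≡⟨ cong (ℚ.∣ f m ℚ.- f (suc K) ∣ ℚ.+_) (∣p-q∣≡∣q-p∣ (f (suc K)) (f n)) ⟩
    ℚ.∣ f m ℚ.- f (suc K) ∣ ℚ.+ ℚ.∣ f n ℚ.- f (suc K) ∣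
      ≤⟨ ℚ.+-mono-≤ (ℚ.≤-trans (lnSum-close a b K m lm) hK) (ℚ.≤-trans (lnSum-close a b K n ln) hK) ⟩
    ε ℚ.* ½ ℚ.+ ε ℚ.* ½
      ≡⟨ half+half ε ⟩
    ε ∎
    where
    open ℚ.≤-Reasoning
    open +-*-Solver
    f = lnSum a b

ln[_/_] : (a b : ℕ) .{{_ : NonZero a}} .{{_ : NonZero b}} → ℝ
ln[ a / b ] = mkℝ (lnSum a b) (lnSum-cauchy a b)

subsets : ∀ n → List (Subset n)
subsets zero    = [] ∷ []
subsets (suc n) = map (outside ∷_) (subsets n) ++ map (inside ∷_) (subsets n)

record Graph (N : ℕ) : Set₁ where
  field
    _∼_    : Rel (Fin N) 0ℓ
    _∼?_   : Decidable _∼_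
    symm   : Symmetric _∼_
    irrefl : Irreflexive _≡_ _∼_

module _ {N : ℕ} (G : Graph N) where
  open Graph G

  Independent : U.Pred (Subset N) 0ℓ
  Independent S = ∀ i j → i ∈ S → j ∈ S → ¬ (i ∼ j)

  independent? : U.Decidable Independent
  independent? S = Fin.all? λ i → Fin.all? λ j →
    (i ∈? S) →-dec ((j ∈? S) →-dec ¬? (i ∼? j))

  α : ℕ
  α = max 0 (map ∣_∣ (filter independent? (subsets N)))

  edge? : U.Decidable {A = Fin N × Fin N} (λ e → proj₁ e Fin.< proj₂ e × proj₁ e ∼ proj₂ e)
  edge? (i , j) = (i Fin.<? j) ×-dec (i ∼? j)

  -- Each edge is listed once, with its smaller endpoint first.
  edges : List (Fin N × Fin N)
  edges = filter edge? (cartesianProduct (allFin N) (allFin N))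

  spanningSubgraph : Subset (length edges) → Graph N
  spanningSubgraph F = record
    { _∼_    = λ i j → ∃ λ k → k ∈ F × (lookup edges k ≡ (i , j) ⊎ lookup edges k ≡ (j , i))
    ; _∼?_   = λ i j → Fin.any? λ k → (k ∈? F) ×-dec
                 (≡-dec Fin._≟_ Fin._≟_ (lookup edges k) (i , j) ⊎-dec
                  ≡-dec Fin._≟_ Fin._≟_ (lookup edges k) (j , i))
    ; symm   = λ { (k , k∈F , inj₁ e) → k , k∈F , inj₂ e ; (k , k∈F , inj₂ e) → k , k∈F , inj₁ e }
    ; irrefl = λ { refl (k , _ , inj₁ e) → loop k e ; refl (k , _ , inj₂ e) → loop k e }
    }
    where
    loop : ∀ {i} k → ¬ (lookup edges k ≡ (i , i))
    loop k e with All.lookup (all-filter edge? (cartesianProduct (allFin N) (allFin N))) (∈-lookup k)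
    ... | i<j , _ = ℕ.<-irrefl (trans (cong (λ z → Fin.toℕ (proj₁ z)) e)
                                      (sym (cong (λ z → Fin.toℕ (proj₂ z)) e))) i<j

  -- The probability that the random spanning subgraph of G, in which each edge
  -- is kept independently with probability p, satisfies P: the total weight
  -- of the edge sets whose spanning subgraph does.
  Pr : (p : ℝ) {P : U.Pred (Graph N) 0ℓ} → U.Decidable P → ℝ
  Pr p P? = sumℝ (map (λ F → p ^ℝ ∣ F ∣ *ℝ (1ℝ -ℝ p) ^ℝ ∣ ∁ F ∣)
                      (filter (λ F → P? (spanningSubgraph F)) (subsets (length edges))))

V : ∀ n → ℕ → List (Subset n)
V n r = filter (λ x → ∣ x ∣ ℕ.≟ r) (subsets n)

-- V n r has no repeated entries, so each r-subset is exactly one vertex.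
vertex : ∀ n r → Fin (length (V n r)) → Subset n
vertex n r = lookup (V n r)

G⟨_,_,<_⟩ : ∀ n r (s : ℕ) → Graph (length (V n r))
G⟨ n , r ,< s ⟩ = record
  { _∼_    = λ i j → i ≢ j × ∣ vertex n r i ∩ vertex n r j ∣ ℕ.< s
  ; _∼?_   = λ i j → ¬? (i Fin.≟ j) ×-dec (∣ vertex n r i ∩ vertex n r j ∣ ℕ.<? s)
  ; symm   = λ { {i} {j} (i≢j , lt) → (λ j≡i → i≢j (sym j≡i)) ,
                 subst (λ x → ∣ x ∣ ℕ.< s) (∩-comm (vertex n r i) (vertex n r j)) lt }
  ; irrefl = λ i≡j i∼j → proj₁ i∼j i≡j
  }

-- Let M = C(n - s, r - s).  Stars of s-sets are independent, so a failure means that some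
-- family A of M + 1 vertices spans no edge of the random graph; apply a union bound over A.
-- If some star contains at least (9/8)(r²/n)M members of A, each of the t remaining members
-- is joined to at least (1/8)(r²/n)M members of A in the star.  Otherwise every
-- s-intersecting subfamily of A has at most (10/8)(r²/n)M members, because peeling covers an
-- s-intersecting family, up to few r-sets, by a single star; Turán's bound then gives A about
-- (2/5)|A|n/r² edges, which beats the (4N/M)^(M+1) families when N = C(n, r).
-- Logarithms are traded for the integer L with 2^L ≤ n/r ≤ 2^(L+1), using ln (n/r) ≥ L/2.

module Submission where

open import Defs
open import Algebra.Structures using (IsCommutativeSemiring; IsCommutativeRing)
open import Data.Bool using (Bool; true; false; if_then_else_)
import Data.Bool.Properties as Bool
open import Data.Empty using (⊥-elim)
open import Data.Fin as Fin using (Fin; zero; suc; toℕ)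
import Data.Fin.Properties as Fin
open import Data.Fin.Subset using (Subset; ∣_∣; _∩_; _∪_; _∈_; _∉_; _⊆_; ∁; ⁅_⁆; inside; outside) renaming (_-_ to _∖_; ⊥ to ∅)
open import Data.Fin.Subset.Properties
open import Data.List using (List; []; _∷_; _++_; map; filter; length; lookup; allFin; concatMap; cartesianProduct; tabulate)
open import Data.List.Extrema.Nat using (max≤v⁺; v≤max⁺)
import Data.List.Properties as List
open import Data.List.Membership.Propositional using (find; lose) renaming (_∈_ to _∈ˡ_)
open import Data.List.Membership.Propositional.Properties using (∈-filter⁺; ∈-filter⁻; ∈-map⁺; ∈-map⁻; ∈-++⁺ˡ; ∈-++⁺ʳ; ∈-++⁻; ∈-concatMap⁺; ∈-allFin; ∈-lookup)
open import Data.List.Relation.Unary.All as All using (All; []; _∷_)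
open import Data.List.Relation.Unary.All.Properties using (¬All⇒Any¬; all-filter)
open import Data.List.Relation.Unary.Any as Any using (Any; here; there)
open import Data.Nat as ℕ using (ℕ; zero; suc; NonZero; _+_; _*_; _^_; _∸_; _≤_; _<_; _≟_; _≤?_; _<?_; z≤n; s≤s)
open import Data.Nat.Combinatorics using (_C_; nCk+nC[k+1]≡[n+1]C[k+1]; k>n⇒nCk≡0)
import Data.Nat.Induction as ℕ
import Data.Nat.Properties as ℕ
import Data.Nat.DivMod as ℕ
open import Data.Nat.Tactic.RingSolver using (solve-∀)
open import Data.Product using (∃; _×_; _,_; proj₁; proj₂)
open import Data.Rational as ℚ using (ℚ; 0ℚ; 1ℚ; ½; _/_; mkℚ)
import Data.Rational.Properties as ℚ
open import Data.Rational.Solver using (module +-*-Solver)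
import Data.Rational.Unnormalised as ℚᵘ
import Data.Rational.Unnormalised.Properties as ℚᵘ
import Data.Integer as ℤ
import Data.Integer.Properties as ℤ
open import Data.Sum using (_⊎_; inj₁; inj₂; [_,_]′)
import Data.Vec as Vec
open import Data.Vec using ([]; _∷_; here; there)
import Data.Vec.Properties as Vec
open import Function using (_∘_; id; flip)
open import Induction.WellFounded using (Acc; acc)
open import Level using (0ℓ)
open import Relation.Binary using (tri<; tri≈; tri>)
open import Relation.Binary.PropositionalEquality using (_≡_; _≢_; refl; sym; trans; cong; cong₂; subst; module ≡-Reasoning)
open import Relation.Nullary using (¬_; Dec; yes; no; does; contradiction)
open import Relation.Nullary.Decidable using (_×-dec_; ¬?; dec-true; dec-false)
import Relation.Unary as U

-- Families close to a star are the obstacle to a single union bound: with t members outside the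
-- star, a family spans only a number of edges proportional to t, but such families are few. Each
-- family is therefore charged by a power of its distance from a star, besides a charge by its size.
-- Both charges are summed over all vertex sets, so the sums factorise over the vertices and
-- binomial coefficients counting families never occur. The constant 16 is spent as follows. The
-- bound ln (n/r) ≥ L/2 leaves np ≥ 8sr²L up to an error, and one of the eight parts pays for that
-- error. For D = 7sr²L the integer a just above n/D satisfies a ≤ 2n/D, and any a edges are all
-- absent with probability at most 1/2. With 79/200 in place of 2/5, a spread family earns
-- (79/200)(7/2)sL > 1.38sL factors 1/2 per member, while s(L + 2) + 3 are needed; s and L at least
-- 20 close the gap. Since p is a Cauchy sequence of rationals, every estimate is made for a
-- rational parameter in [0, 1] and carried over to p by Lipschitz continuity.

private
  variable
    A B : Set
    n : ℕ

-- Finite sums over lists, for naturals and rationals alike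

module ListSum
  {R : Set} (_⊕_ _⊗_ : R → R → R) (0# 1# : R)
  (isCSR : IsCommutativeSemiring _≡_ _⊕_ _⊗_ 0# 1#)
  (_≼_ : R → R → Set) (≼-refl : ∀ {x} → x ≼ x)
  (⊕-mono : ∀ {w x y z} → w ≼ x → y ≼ z → (w ⊕ y) ≼ (x ⊕ z))
  where

  private module S = IsCommutativeSemiring isCSR

  ∑ : List A → (A → R) → R
  ∑ []       f = 0#
  ∑ (x ∷ xs) f = f x ⊕ ∑ xs f

  ∑-cong : ∀ (xs : List A) {f g : A → R} → (∀ x → f x ≡ g x) → ∑ xs f ≡ ∑ xs g
  ∑-cong []       eq = refl
  ∑-cong (x ∷ xs) eq = cong₂ _⊕_ (eq x) (∑-cong xs eq)

  ∑-mono-∈ : ∀ (xs : List A) {f g : A → R} → (∀ x → x ∈ˡ xs → f x ≼ g x) → ∑ xs f ≼ ∑ xs g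
  ∑-mono-∈ []       le = ≼-refl
  ∑-mono-∈ (x ∷ xs) le = ⊕-mono (le x (here refl)) (∑-mono-∈ xs (λ y y∈ → le y (there y∈)))

  ∑-mono : ∀ (xs : List A) {f g : A → R} → (∀ x → f x ≼ g x) → ∑ xs f ≼ ∑ xs g
  ∑-mono xs le = ∑-mono-∈ xs (λ x _ → le x)

  ∑-zero : ∀ (xs : List A) → ∑ xs (λ _ → 0#) ≡ 0#
  ∑-zero []       = refl
  ∑-zero (x ∷ xs) = trans (S.+-identityˡ _) (∑-zero xs)

  private
    interchange : ∀ a b c d → ((a ⊕ b) ⊕ (c ⊕ d)) ≡ ((a ⊕ c) ⊕ (b ⊕ d))
    interchange a b c d = begin
      (a ⊕ b) ⊕ (c ⊕ d)  ≡⟨ S.+-assoc a b _ ⟩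
      a ⊕ (b ⊕ (c ⊕ d))  ≡⟨ cong (a ⊕_) (S.+-assoc b c d) ⟨
      a ⊕ ((b ⊕ c) ⊕ d)  ≡⟨ cong (λ z → a ⊕ (z ⊕ d)) (S.+-comm b c) ⟩
      a ⊕ ((c ⊕ b) ⊕ d)  ≡⟨ cong (a ⊕_) (S.+-assoc c b d) ⟩
      a ⊕ (c ⊕ (b ⊕ d))  ≡⟨ S.+-assoc a c _ ⟨
      (a ⊕ c) ⊕ (b ⊕ d)  ∎
      where open ≡-Reasoning

  ∑-+ : ∀ (xs : List A) (f g : A → R) → ∑ xs (λ x → f x ⊕ g x) ≡ (∑ xs f ⊕ ∑ xs g)
  ∑-+ []       f g = sym (S.+-identityˡ 0#)
  ∑-+ (x ∷ xs) f g = trans (cong ((f x ⊕ g x) ⊕_) (∑-+ xs f g)) (interchange (f x) (g x) _ _)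

  ∑-*ˡ : ∀ (xs : List A) c (f : A → R) → ∑ xs (λ x → c ⊗ f x) ≡ (c ⊗ ∑ xs f)
  ∑-*ˡ []       c f = sym (S.zeroʳ c)
  ∑-*ˡ (x ∷ xs) c f = trans (cong ((c ⊗ f x) ⊕_) (∑-*ˡ xs c f)) (sym (S.distribˡ c (f x) _))

  ∑-++ : ∀ (xs ys : List A) (f : A → R) → ∑ (xs ++ ys) f ≡ (∑ xs f ⊕ ∑ ys f)
  ∑-++ []       ys f = sym (S.+-identityˡ _)
  ∑-++ (x ∷ xs) ys f = trans (cong (f x ⊕_) (∑-++ xs ys f)) (sym (S.+-assoc (f x) _ _))

  ∑-map : ∀ (h : A → B) (xs : List A) (f : B → R) → ∑ (map h xs) f ≡ ∑ xs (λ x → f (h x))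
  ∑-map h []       f = refl
  ∑-map h (x ∷ xs) f = cong (f (h x) ⊕_) (∑-map h xs f)

  ∑-swap : ∀ (xs : List A) (ys : List B) (f : A → B → R) →
           ∑ xs (λ x → ∑ ys (f x)) ≡ ∑ ys (λ y → ∑ xs (λ x → f x y))
  ∑-swap []       ys f = sym (∑-zero ys)
  ∑-swap (x ∷ xs) ys f = trans (cong (∑ ys (f x) ⊕_) (∑-swap xs ys f))
                               (sym (∑-+ ys (f x) (λ y → ∑ xs (λ x′ → f x′ y))))

  𝟙 : {P : Set} → Dec P → R
  𝟙 d = if does d then 1# else 0#

  𝟙-yes : {P : Set} (d : Dec P) → P → 𝟙 d ≡ 1#
  𝟙-yes d p = cong (if_then 1# else 0#) (dec-true d p)

  𝟙-no : {P : Set} (d : Dec P) → ¬ P → 𝟙 d ≡ 0#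
  𝟙-no d ¬p = cong (if_then 1# else 0#) (dec-false d ¬p)

  𝟙-cong : {P Q : Set} (d : Dec P) (e : Dec Q) → (P → Q) → (Q → P) → 𝟙 d ≡ 𝟙 e
  𝟙-cong (yes p) e P→Q Q→P = sym (𝟙-yes e (P→Q p))
  𝟙-cong (no ¬p) e P→Q Q→P = sym (𝟙-no e (¬p ∘ Q→P))

  ∑-filter : ∀ {P : U.Pred A 0ℓ} (P? : U.Decidable P) (xs : List A) (f : A → R) →
             ∑ (filter P? xs) f ≡ ∑ xs (λ x → 𝟙 (P? x) ⊗ f x)
  ∑-filter P? []       f = refl
  ∑-filter P? (x ∷ xs) f with does (P? x)
  ... | true  = cong₂ _⊕_ (sym (S.*-identityˡ (f x))) (∑-filter P? xs f)
  ... | false = trans (∑-filter P? xs f)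
                      (sym (trans (cong (_⊕ ∑ xs (λ y → 𝟙 (P? y) ⊗ f y)) (S.zeroˡ (f x))) (S.+-identityˡ _)))

  ∑-cartesianProduct : ∀ (xs : List A) (ys : List B) (f : A × B → R) →
                       ∑ (cartesianProduct xs ys) f ≡ ∑ xs (λ x → ∑ ys (λ y → f (x , y)))
  ∑-cartesianProduct []       ys f = refl
  ∑-cartesianProduct (x ∷ xs) ys f =
    trans (∑-++ (map (x ,_) ys) (cartesianProduct xs ys) f)
          (cong₂ _⊕_ (∑-map (x ,_) ys f) (∑-cartesianProduct xs ys f))

  ∑-concatMap : ∀ (h : A → List B) (xs : List A) (f : B → R) →
                ∑ (concatMap h xs) f ≡ ∑ xs (λ x → ∑ (h x) f)
  ∑-concatMap h []       f = refl
  ∑-concatMap h (x ∷ xs) f = trans (∑-++ (h x) (concatMap h xs) f) (cong (∑ (h x) f ⊕_) (∑-concatMap h xs f))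

  ∑-tabulate : ∀ {k} (h : Fin k → A) (f : A → R) → ∑ (tabulate h) f ≡ ∑ (allFin k) (f ∘ h)
  ∑-tabulate {k = zero}  h f = refl
  ∑-tabulate {k = suc k} h f = cong (f (h zero) ⊕_)
    (trans (∑-tabulate (h ∘ suc) f) (sym (∑-tabulate suc (f ∘ h))))

  ∑-lookup : ∀ (xs : List A) (f : A → R) → ∑ (allFin (length xs)) (f ∘ lookup xs) ≡ ∑ xs f
  ∑-lookup xs f = trans (sym (∑-tabulate (lookup xs) f)) (cong (λ ys → ∑ ys f) (List.tabulate-lookup xs))

open ListSum _+_ _*_ 0 1 ℕ.+-*-isCommutativeSemiring _≤_ ℕ.≤-refl ℕ.+-mono-≤

𝟙≤ : {P : Set} (d : Dec P) {k : ℕ} → (P → 1 ≤ k) → 𝟙 d ≤ k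
𝟙≤ (yes p) h = h p
𝟙≤ (no _)  h = z≤n

𝟙-× : {P Q : Set} (d : Dec P) (e : Dec Q) → 𝟙 (d ×-dec e) ≡ 𝟙 d * 𝟙 e
𝟙-× (yes _) (yes _) = refl
𝟙-× (yes _) (no _)  = refl
𝟙-× (no _)  e       = refl

∑-one : ∀ (xs : List A) → ∑ xs (λ _ → 1) ≡ length xs
∑-one []       = refl
∑-one (x ∷ xs) = cong suc (∑-one xs)

∈⇒≤∑ : ∀ {x : A} {xs} (f : A → ℕ) → x ∈ˡ xs → f x ≤ ∑ xs f
∈⇒≤∑ f (here refl)      = ℕ.m≤m+n _ _
∈⇒≤∑ f (there {y} x∈xs) = ℕ.≤-trans (∈⇒≤∑ f x∈xs) (ℕ.m≤n+m _ (f y))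

length-concatMap : ∀ (h : A → List B) xs → length (concatMap h xs) ≡ ∑ xs (length ∘ h)
length-concatMap h xs = begin
  length (concatMap h xs)             ≡⟨ ∑-one (concatMap h xs) ⟨
  ∑ (concatMap h xs) (λ _ → 1)        ≡⟨ ∑-concatMap h xs (λ _ → 1) ⟩
  ∑ xs (λ x → ∑ (h x) (λ _ → 1))      ≡⟨ ∑-cong xs (∑-one ∘ h) ⟩
  ∑ xs (length ∘ h)                   ∎
  where open ≡-Reasoning

∑-const : ∀ (xs : List A) c → ∑ xs (λ _ → c) ≡ length xs * c
∑-const []       c = refl
∑-const (x ∷ xs) c = cong (λ z → c + z) (∑-const xs c)

∣∣≡∑ : (p : Subset n) → ∣ p ∣ ≡ ∑ (allFin n) (λ i → 𝟙 (i ∈? p))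
∣∣≡∑ []            = refl
∣∣≡∑ (true ∷ p)  = cong suc (trans (∣∣≡∑ p) (sym (∑-tabulate suc (λ i → 𝟙 (i ∈? (true ∷ p))))))
∣∣≡∑ (false ∷ p) = trans (∣∣≡∑ p) (sym (∑-tabulate suc (λ i → 𝟙 (i ∈? (false ∷ p)))))

-- Ratios of binomial coefficients

nC0 : ∀ n → n C 0 ≡ 1
nC0 zero    = refl
nC0 (suc n) = refl

absorption : ∀ n k → suc k * (suc n C suc k) ≡ suc n * (n C k)
absorption zero    zero    = refl
absorption zero    (suc k) = trans (cong (suc (suc k) *_) (k>n⇒nCk≡0 (s≤s (s≤s (z≤n {k}))))) (ℕ.*-zeroʳ (suc (suc k)))
absorption (suc n) zero    = begin
  1 * (suc (suc n) C 1)            ≡⟨ cong (1 *_) (nCk+nC[k+1]≡[n+1]C[k+1] (suc n) 0) ⟨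
  1 * (suc n C 0 + suc n C 1)      ≡⟨ cong (λ z → 1 * (suc n C 0 + z)) (trans (sym (ℕ.*-identityˡ _)) (absorption n 0)) ⟩
  1 * (suc n C 0 + suc n * (n C 0)) ≡⟨ cong₂ (λ x y → 1 * (x + suc n * y)) (nC0 (suc n)) (nC0 n) ⟩
  1 * (1 + suc n * 1)              ≡⟨ lem n ⟩
  suc (suc n) * 1                  ≡⟨ cong (suc (suc n) *_) (nC0 (suc n)) ⟨
  suc (suc n) * (suc n C 0)        ∎
  where
  open ≡-Reasoning
  lem : ∀ n → 1 * (1 + suc n * 1) ≡ suc (suc n) * 1
  lem = solve-∀
absorption (suc n) (suc k) = begin
  suc (suc k) * (suc (suc n) C suc (suc k))
    ≡⟨ cong (suc (suc k) *_) (nCk+nC[k+1]≡[n+1]C[k+1] (suc n) (suc k)) ⟨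
  suc (suc k) * (x + (suc n C suc (suc k)))
    ≡⟨ ℕ.*-distribˡ-+ (suc (suc k)) x _ ⟩
  suc (suc k) * x + suc (suc k) * (suc n C suc (suc k))
    ≡⟨ cong₂ _+_ (cong (λ z → x + z) (absorption n k)) (absorption n (suc k)) ⟩
  x + suc n * (n C k) + suc n * (n C suc k)
    ≡⟨ lem x (suc n) (n C k) (n C suc k) ⟩
  x + suc n * ((n C k) + (n C suc k))
    ≡⟨ cong (λ z → x + suc n * z) (nCk+nC[k+1]≡[n+1]C[k+1] n k) ⟩
  suc (suc n) * x ∎
  where
  open ≡-Reasoning
  x = suc n C suc k
  lem : ∀ x n a b → x + n * a + n * b ≡ x + n * (a + b)
  lem = solve-∀

*-cancelˡ-suc : ∀ a {x y} → suc a * x ≤ suc a * y → x ≤ y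
*-cancelˡ-suc a = ℕ.*-cancelˡ-≤ (suc a)

-- By `absorption` the two binomials have ratio (b + 1)/(a + 1) ≤ 1, and adding `c` to numerator and
-- denominator can only raise such a fraction. With `c = u` the ratio (r - u)/(n - u) is replaced by
-- r/n.
C-step-≤ : ∀ a b c → b ≤ a → (c + suc a) * (a C b) ≤ (c + suc b) * (suc a C suc b)
C-step-≤ a b c b≤a = *-cancelˡ-suc a (begin
  suc a * ((c + suc a) * (a C b))          ≡⟨ lem (suc a) (c + suc a) (a C b) ⟩
  (c + suc a) * (suc a * (a C b))          ≡⟨ cong ((c + suc a) *_) (absorption a b) ⟨
  (c + suc a) * (suc b * (suc a C suc b))  ≡⟨ lem′ (c + suc a) (suc b) _ ⟩
  ((c + suc a) * suc b) * (suc a C suc b)  ≤⟨ ℕ.*-monoˡ-≤ (suc a C suc b) le ⟩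
  (suc a * (c + suc b)) * (suc a C suc b)  ≡⟨ lem′ (suc a) (c + suc b) _ ⟨
  suc a * ((c + suc b) * (suc a C suc b))  ∎)
  where
  open ℕ.≤-Reasoning
  lem : ∀ a b c → a * (b * c) ≡ b * (a * c)
  lem = solve-∀
  lem′ : ∀ a b c → a * (b * c) ≡ (a * b) * c
  lem′ = solve-∀
  lem₁ : ∀ a b c → (c + a) * b ≡ c * b + a * b
  lem₁ = solve-∀
  lem₂ : ∀ a b c → c * a + a * b ≡ a * (c + b)
  lem₂ = solve-∀
  le : (c + suc a) * suc b ≤ suc a * (c + suc b)
  le = begin
    (c + suc a) * suc b        ≡⟨ lem₁ (suc a) (suc b) c ⟩
    c * suc b + suc a * suc b  ≤⟨ ℕ.+-monoˡ-≤ (suc a * suc b) (ℕ.*-monoʳ-≤ c (s≤s b≤a)) ⟩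
    c * suc a + suc a * suc b  ≡⟨ lem₂ (suc a) (suc b) c ⟩
    suc a * (c + suc b) ∎

-- Each further point required of an r-set shrinks a star at least by the factor r/n, because (r -
-- u)/(n - u) ≤ r/n.
C-shift-≤ : ∀ {n r} t j → t + j ≤ r → r ≤ n →
            n ^ j * ((n ∸ (t + j)) C (r ∸ (t + j))) ≤ r ^ j * ((n ∸ t) C (r ∸ t))
C-shift-≤ {n} {r} t zero    t+j≤r r≤n = ℕ.≤-reflexive (cong (λ z → 1 * ((n ∸ z) C (r ∸ z))) (ℕ.+-identityʳ t))
C-shift-≤ {n} {r} t (suc j) t+j≤r r≤n = begin
  n ^ suc j * ((n ∸ (t + suc j)) C (r ∸ (t + suc j)))   ≡⟨ cong (λ z → n ^ suc j * ((n ∸ z) C (r ∸ z))) (ℕ.+-suc t j) ⟩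
  n ^ suc j * ((n ∸ suc u) C (r ∸ suc u))               ≡⟨ lem n (n ^ j) _ ⟩
  n ^ j * (n * ((n ∸ suc u) C (r ∸ suc u)))             ≤⟨ ℕ.*-monoʳ-≤ (n ^ j) step ⟩
  n ^ j * (r * ((n ∸ u) C (r ∸ u)))                     ≡⟨ lem′ (n ^ j) r _ ⟩
  r * (n ^ j * ((n ∸ u) C (r ∸ u)))                     ≤⟨ ℕ.*-monoʳ-≤ r (C-shift-≤ t j (ℕ.<⇒≤ u<r) r≤n) ⟩
  r * (r ^ j * ((n ∸ t) C (r ∸ t)))                     ≡⟨ ℕ.*-assoc r (r ^ j) _ ⟨
  r ^ suc j * ((n ∸ t) C (r ∸ t))                       ∎
  where
  open ℕ.≤-Reasoning
  u = t + j
  u<r : u < r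
  u<r = subst (_≤ r) (ℕ.+-suc t j) t+j≤r
  lem : ∀ n x y → n * x * y ≡ x * (n * y)
  lem = solve-∀
  lem′ : ∀ n x y → n * (x * y) ≡ x * (n * y)
  lem′ = solve-∀
  step : n * ((n ∸ suc u) C (r ∸ suc u)) ≤ r * ((n ∸ u) C (r ∸ u))
  step = begin
    n * ((n ∸ suc u) C (r ∸ suc u))
      ≡⟨ cong (_* ((n ∸ suc u) C (r ∸ suc u))) (split n (ℕ.≤-trans u<r r≤n)) ⟩
    (u + suc (n ∸ suc u)) * ((n ∸ suc u) C (r ∸ suc u))
      ≤⟨ C-step-≤ (n ∸ suc u) (r ∸ suc u) u (ℕ.∸-monoˡ-≤ (suc u) r≤n) ⟩
    (u + suc (r ∸ suc u)) * (suc (n ∸ suc u) C suc (r ∸ suc u))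
      ≡⟨ cong₂ _*_ (sym (split r u<r)) (cong₂ _C_ (pred n (ℕ.≤-trans u<r r≤n)) (pred r u<r)) ⟩
    r * ((n ∸ u) C (r ∸ u)) ∎
    where
    pred : ∀ x → u < x → suc (x ∸ suc u) ≡ x ∸ u
    pred x u<x = sym (ℕ.+-∸-assoc 1 u<x)
    split : ∀ x → u < x → x ≡ u + suc (x ∸ suc u)
    split x u<x = trans (sym (ℕ.m+[n∸m]≡n u<x)) (sym (ℕ.+-suc u (x ∸ suc u)))

-- The opposite estimate: as long as t < s, requiring one more point shrinks a star at most by (r -
-- t)/(n - t) ≥ (r - s)/n. A separate `s` keeps the base of the powers constant during the induction
-- on `t`.
C-drop-≤ : ∀ {n r} s t → t ≤ s → s ≤ r → r ≤ n → (r ∸ s) ^ t * (n C r) ≤ n ^ t * ((n ∸ t) C (r ∸ t))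
C-drop-≤         s zero    t≤s s≤r r≤n = ℕ.≤-refl
C-drop-≤ {n} {r} s (suc t) t<s s≤r r≤n = begin
  (r ∸ s) ^ suc t * (n C r)               ≡⟨ ℕ.*-assoc (r ∸ s) _ _ ⟩
  (r ∸ s) * ((r ∸ s) ^ t * (n C r))       ≤⟨ ℕ.*-monoʳ-≤ (r ∸ s) (C-drop-≤ s t (ℕ.<⇒≤ t<s) s≤r r≤n) ⟩
  (r ∸ s) * (n ^ t * ((n ∸ t) C (r ∸ t))) ≡⟨ lem (r ∸ s) (n ^ t) _ ⟩
  n ^ t * ((r ∸ s) * ((n ∸ t) C (r ∸ t))) ≤⟨ ℕ.*-monoʳ-≤ (n ^ t) step ⟩
  n ^ t * (n * ((n ∸ suc t) C (r ∸ suc t))) ≡⟨ lem′ (n ^ t) n _ ⟩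
  n ^ suc t * ((n ∸ suc t) C (r ∸ suc t)) ∎
  where
  open ℕ.≤-Reasoning
  t<r = ℕ.≤-trans t<s s≤r
  lem : ∀ n x y → n * (x * y) ≡ x * (n * y)
  lem = solve-∀
  lem′ : ∀ x n y → x * (n * y) ≡ n * x * y
  lem′ = solve-∀
  pred : ∀ x → t < x → x ∸ t ≡ suc (x ∸ suc t)
  pred x t<x = ℕ.+-∸-assoc 1 t<x
  step : (r ∸ s) * ((n ∸ t) C (r ∸ t)) ≤ n * ((n ∸ suc t) C (r ∸ suc t))
  step = begin
    (r ∸ s) * ((n ∸ t) C (r ∸ t))   ≤⟨ ℕ.*-monoˡ-≤ _ (ℕ.∸-monoʳ-≤ r (ℕ.<⇒≤ t<s)) ⟩
    (r ∸ t) * ((n ∸ t) C (r ∸ t))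
      ≡⟨ cong₂ (λ x y → x * (y C x)) (pred r t<r) (pred n (ℕ.≤-trans t<r r≤n)) ⟩
    suc (r ∸ suc t) * (suc (n ∸ suc t) C suc (r ∸ suc t))
      ≡⟨ absorption (n ∸ suc t) (r ∸ suc t) ⟩
    suc (n ∸ suc t) * ((n ∸ suc t) C (r ∸ suc t))
      ≡⟨ cong (_* ((n ∸ suc t) C (r ∸ suc t))) (sym (pred n (ℕ.≤-trans t<r r≤n))) ⟩
    (n ∸ t) * ((n ∸ suc t) C (r ∸ suc t))  ≤⟨ ℕ.*-monoˡ-≤ _ (ℕ.m∸n≤m n t) ⟩
    n * ((n ∸ suc t) C (r ∸ suc t)) ∎

-- The number of r-sets that contain a given set

∑-subsets : ∀ {n} (f : Subset (suc n) → ℕ) →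
            ∑ (subsets (suc n)) f ≡ ∑ (subsets n) (f ∘ (outside ∷_)) + ∑ (subsets n) (f ∘ (inside ∷_))
∑-subsets {n} f = trans (∑-++ (map (outside ∷_) (subsets n)) _ f)
  (cong₂ _+_ (∑-map (outside ∷_) (subsets n) f) (∑-map (inside ∷_) (subsets n) f))

superset? : (r : ℕ) (T x : Subset n) → ℕ
superset? r T x = 𝟙 (∣ x ∣ ≟ r) * 𝟙 (T ⊆? x)

-- Induction on the ground set: a point of `T` is forced, any other point gives Pascal's rule.
-- Writing the size as `∣ T ∣ + ρ` keeps truncated subtraction out of the recursion on `ρ`.
supersets-count : (T : Subset n) (ρ : ℕ) →
                  ∑ (subsets n) (superset? (∣ T ∣ + ρ) T) ≡ (n ∸ ∣ T ∣) C ρ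
supersets-count []      zero    = refl
supersets-count []      (suc ρ) = refl
supersets-count {n = suc n} (outside ∷ T) ρ = begin
  ∑ (subsets (suc n)) (superset? (∣ T ∣ + ρ) (outside ∷ T))
    ≡⟨ ∑-subsets (superset? (∣ T ∣ + ρ) (outside ∷ T)) ⟩
  ∑ (subsets n) (λ x → 𝟙 (∣ x ∣ ≟ ∣ T ∣ + ρ) * 𝟙 (outside ∷ T ⊆? outside ∷ x)) +
  ∑ (subsets n) (λ x → 𝟙 (suc ∣ x ∣ ≟ ∣ T ∣ + ρ) * 𝟙 (outside ∷ T ⊆? inside ∷ x))
    ≡⟨ cong₂ _+_ (trans (∑-cong (subsets n) (λ x → cong (𝟙 (∣ x ∣ ≟ ∣ T ∣ + ρ) *_) (out x outside))) (supersets-count T ρ))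
                 (∑-cong (subsets n) (λ x → cong (𝟙 (suc ∣ x ∣ ≟ ∣ T ∣ + ρ) *_) (out x inside))) ⟩
  ((n ∸ ∣ T ∣) C ρ) + ∑ (subsets n) (λ x → 𝟙 (suc ∣ x ∣ ≟ ∣ T ∣ + ρ) * 𝟙 (T ⊆? x))
    ≡⟨ go ρ ⟩
  suc (n ∸ ∣ T ∣) C ρ
    ≡⟨ cong (_C ρ) (ℕ.+-∸-assoc 1 (∣p∣≤n T)) ⟨
  (suc n ∸ ∣ T ∣) C ρ ∎
  where
  open ≡-Reasoning
  out : ∀ x b → 𝟙 (outside ∷ T ⊆? b ∷ x) ≡ 𝟙 (T ⊆? x)
  out x b = 𝟙-cong (outside ∷ T ⊆? b ∷ x) (T ⊆? x) (λ h → drop-∷-⊆ h) (λ h → out⊆ h)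
  -- For `ρ = 0` no point outside `T` may be taken: the rest `x` would have one point too few to
  -- contain `T`.
  vanish : ∀ x → 𝟙 (suc ∣ x ∣ ≟ ∣ T ∣ + 0) * 𝟙 (T ⊆? x) ≡ 0
  vanish x with T ⊆? x
  ... | no _     = ℕ.*-zeroʳ (𝟙 (suc ∣ x ∣ ≟ ∣ T ∣ + 0))
  ... | yes T⊆x = trans (ℕ.*-identityʳ _) (𝟙-no (suc ∣ x ∣ ≟ ∣ T ∣ + 0)
    (λ eq → ℕ.<-irrefl (trans (sym (ℕ.+-identityʳ _)) (sym eq)) (s≤s (p⊆q⇒∣p∣≤∣q∣ T⊆x))))
  go : ∀ ρ → ((n ∸ ∣ T ∣) C ρ) + ∑ (subsets n) (λ x → 𝟙 (suc ∣ x ∣ ≟ ∣ T ∣ + ρ) * 𝟙 (T ⊆? x))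
           ≡ suc (n ∸ ∣ T ∣) C ρ
  go zero    = trans (cong₂ _+_ (nC0 (n ∸ ∣ T ∣)) (trans (∑-cong (subsets n) vanish) (∑-zero (subsets n))))
                     (sym (nC0 (suc (n ∸ ∣ T ∣))))
  go (suc ρ) rewrite ℕ.+-suc ∣ T ∣ ρ =
    trans (cong (λ z → ((n ∸ ∣ T ∣) C suc ρ) + z) (supersets-count T ρ))
    (trans (ℕ.+-comm _ ((n ∸ ∣ T ∣) C ρ)) (nCk+nC[k+1]≡[n+1]C[k+1] (n ∸ ∣ T ∣) ρ))
supersets-count {n = suc n} (inside ∷ T) ρ = begin
  ∑ (subsets (suc n)) (superset? (suc ∣ T ∣ + ρ) (inside ∷ T))
    ≡⟨ ∑-subsets (superset? (suc ∣ T ∣ + ρ) (inside ∷ T)) ⟩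
  ∑ (subsets n) (λ x → 𝟙 (∣ x ∣ ≟ suc ∣ T ∣ + ρ) * 𝟙 (inside ∷ T ⊆? outside ∷ x)) +
  ∑ (subsets n) (λ x → 𝟙 (∣ x ∣ ≟ ∣ T ∣ + ρ) * 𝟙 (inside ∷ T ⊆? inside ∷ x))
    ≡⟨ cong₂ _+_
         (trans (∑-cong (subsets n) (λ x → trans (cong (𝟙 (∣ x ∣ ≟ suc ∣ T ∣ + ρ) *_)
                  (𝟙-no (inside ∷ T ⊆? outside ∷ x) λ h → zero∉ x (h here))) (ℕ.*-zeroʳ (𝟙 (∣ x ∣ ≟ suc ∣ T ∣ + ρ)))))
                (∑-zero (subsets n)))
         (trans (∑-cong (subsets n) (λ x → cong (𝟙 (∣ x ∣ ≟ ∣ T ∣ + ρ) *_)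
                  (𝟙-cong (inside ∷ T ⊆? inside ∷ x) (T ⊆? x) (λ h → drop-∷-⊆ h) (λ h → s⊆s h))))
                (supersets-count T ρ)) ⟩
  (n ∸ ∣ T ∣) C ρ ∎
  where
  open ≡-Reasoning
  zero∉ : ∀ x → zero ∉ outside ∷ x
  zero∉ x ()

supersets-count′ : (T : Subset n) {r : ℕ} → ∣ T ∣ ≤ r →
                   ∑ (subsets n) (superset? r T) ≡ (n ∸ ∣ T ∣) C (r ∸ ∣ T ∣)
supersets-count′ {n = n} T {r} T≤r = subst
  (λ z → ∑ (subsets n) (superset? z T) ≡ (n ∸ ∣ T ∣) C (r ∸ ∣ T ∣))
  (ℕ.m+[n∸m]≡n T≤r) (supersets-count T (r ∸ ∣ T ∣))

-- Peeling intersecting families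

∃-outside : (X T : Subset n) → ∣ X ∣ < ∣ T ∣ → ∃ λ t → t ∈ T × t ∉ X
∃-outside X T X<T with Fin.any? (λ t → (t ∈? T) ×-dec ¬? (t ∈? X))
... | yes found = found
... | no none   = contradiction (p⊆q⇒∣p∣≤∣q∣ T⊆X) (ℕ.<⇒≱ X<T)
  where
  T⊆X : T ⊆ X
  T⊆X {t} t∈T with t ∈? X
  ... | yes t∈X = t∈X
  ... | no  t∉X = contradiction (t , t∈T , t∉X) none

⊆∧≤⇒≡ : {X T : Subset n} → X ⊆ T → ∣ T ∣ ≤ ∣ X ∣ → X ≡ T
⊆∧≤⇒≡ {X = X} {T} X⊆T T≤X = ⊆-antisym X⊆T T⊆X
  where
  T⊆X : T ⊆ X
  T⊆X {t} t∈T with t ∈? X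
  ... | yes t∈X = t∈X
  ... | no  t∉X = contradiction (p⊂q⇒∣p∣<∣q∣ (X⊆T , t , t∈T , t∉X)) (ℕ.≤⇒≯ T≤X)

∣∪⁅⁆∣ : (X : Subset n) (y : Fin n) → y ∉ X → ∣ X ∪ ⁅ y ⁆ ∣ ≡ suc ∣ X ∣
∣∪⁅⁆∣ (true  ∷ X) zero    y∉X = contradiction here y∉X
∣∪⁅⁆∣ (false ∷ X) zero    y∉X = cong (suc ∘ ∣_∣) (∪-identityʳ X)
∣∪⁅⁆∣ (true  ∷ X) (suc y) y∉X = cong suc (∣∪⁅⁆∣ X y (y∉X ∘ there))
∣∪⁅⁆∣ (false ∷ X) (suc y) y∉X = ∣∪⁅⁆∣ X y (y∉X ∘ there)

∩-monoˡ-∣∣ : {X Y : Subset n} (Z : Subset n) → X ⊆ Y → ∣ X ∩ Z ∣ ≤ ∣ Y ∩ Z ∣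
∩-monoˡ-∣∣ {X = X} Z X⊆Y = p⊆q⇒∣p∣≤∣q∣ (λ h → let a , b = x∈p∩q⁻ X Z h in x∈p∩q⁺ (X⊆Y a , b))

Intersecting : ℕ → List (Subset n) → Set
Intersecting s Bs = ∀ {X Y} → X ∈ˡ Bs → Y ∈ˡ Bs → s ≤ ∣ X ∩ Y ∣

-- Only sets of the top size `q` are constrained, since one round of peeling disposes of exactly
-- that size.
Irreducible : ℕ → ℕ → List (Subset n) → Set
Irreducible s q Bs = ∀ {T t} → T ∈ˡ Bs → ∣ T ∣ ≡ q → t ∈ T → ∃ λ X → X ∈ˡ Bs × ∣ (T ∖ t) ∩ X ∣ < s

_≟ˢ_ : (X Y : Subset n) → Dec (X ≡ Y)
_≟ˢ_ = Vec.≡-dec Bool._≟_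

∑-filter-≤ : ∀ {P : U.Pred A 0ℓ} (P? : U.Decidable P) (xs : List A) (f : A → ℕ) → ∑ (filter P? xs) f ≤ ∑ xs f
∑-filter-≤ P? []       f = z≤n
∑-filter-≤ P? (x ∷ xs) f with does (P? x)
... | true  = ℕ.+-monoʳ-≤ (f x) (∑-filter-≤ P? xs f)
... | false = ℕ.m≤n⇒m≤o+n (f x) (∑-filter-≤ P? xs f)

∑-remove : ∀ {P : U.Pred A 0ℓ} (P? : U.Decidable P) {x : A} {xs} (f : A → ℕ) → x ∈ˡ xs → ¬ P x →
           f x + ∑ (filter P? xs) f ≤ ∑ xs f
∑-remove P? {x} {_ ∷ xs} f (here refl) ¬p with P? x
... | yes p = contradiction p ¬p
... | no _  = ℕ.+-monoʳ-≤ (f x) (∑-filter-≤ P? xs f)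
∑-remove P? {x} {y ∷ xs} f (there x∈) ¬p with does (P? y)
... | false = ℕ.m≤n⇒m≤o+n (f y) (∑-remove P? f x∈ ¬p)
... | true  = begin
  f x + (f y + ∑ (filter P? xs) f) ≡⟨ lem (f x) (f y) _ ⟩
  f y + (f x + ∑ (filter P? xs) f) ≤⟨ ℕ.+-monoʳ-≤ (f y) (∑-remove P? f x∈ ¬p) ⟩
  f y + ∑ xs f ∎
  where
  open ℕ.≤-Reasoning
  lem : ∀ a b c → a + (b + c) ≡ b + (a + c)
  lem = solve-∀

_Refines_ : List (Subset n) → List (Subset n) → Set
Bs′ Refines Bs = ∀ {X} → X ∈ˡ Bs → ∃ λ Y → Y ∈ˡ Bs′ × Y ⊆ X

-- While some q-set can lose a point without spoiling the s-intersection property, it is replaced by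
-- the smaller set. The total size drops, so this stops. Every original set still contains a member
-- of the result, hence a cover of the result covers the original family.
reduce : ∀ s q (Bs : List (Subset n)) → Intersecting s Bs → (∀ {X} → X ∈ˡ Bs → ∣ X ∣ ≤ q) →
         ∃ λ Bs′ → Intersecting s Bs′ × (∀ {X} → X ∈ˡ Bs′ → ∣ X ∣ ≤ q) × (Bs′ Refines Bs) × Irreducible s q Bs′
reduce {n} s q Bs = go Bs (ℕ.<-wellFounded _)
  where
  Reducible : List (Subset n) → Subset n → Set
  Reducible Bs T = ∣ T ∣ ≡ q × ∃ λ t → t ∈ T × All (λ X → s ≤ ∣ (T ∖ t) ∩ X ∣) Bs

  reducible? : ∀ Bs → U.Decidable (Reducible Bs)
  reducible? Bs T = (∣ T ∣ ≟ q) ×-dec Fin.any? λ t → (t ∈? T) ×-dec All.all? (λ X → s ≤? ∣ (T ∖ t) ∩ X ∣) Bs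

  go : ∀ Bs → Acc _<_ (∑ Bs ∣_∣) → Intersecting s Bs → (∀ {X} → X ∈ˡ Bs → ∣ X ∣ ≤ q) →
       ∃ λ Bs′ → Intersecting s Bs′ × (∀ {X} → X ∈ˡ Bs′ → ∣ X ∣ ≤ q) × (Bs′ Refines Bs) × Irreducible s q Bs′
  go Bs (acc rec) int bd with Any.any? (reducible? Bs) Bs
  ... | no none = Bs , int , bd , (λ X∈ → _ , X∈ , λ z → z) , irr
    where
    irr : Irreducible s q Bs
    irr {T} {t} T∈ T≡q t∈T with All.all? (λ X → s ≤? ∣ (T ∖ t) ∩ X ∣) Bs
    ... | yes all = contradiction (lose T∈ (T≡q , t , t∈T , all)) none
    ... | no ¬all = let X , X∈ , ≰ = find (¬All⇒Any¬ (λ X → s ≤? ∣ (T ∖ t) ∩ X ∣) Bs ¬all)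
                    in X , X∈ , ℕ.≰⇒> ≰
  ... | yes some with find some
  ... | T , T∈ , T≡q , t , t∈T , all =
    let Bs″ , int″ , bd″ , ref″ , irr″ = go Bs′ (rec less) int′ bd′
    in Bs″ , int″ , bd″ , (λ X∈ → let Y , Y∈ , Y⊆X = ref X∈ ; Z , Z∈ , Z⊆Y = ref″ Y∈ in Z , Z∈ , λ h → Y⊆X (Z⊆Y h)) , irr″
    where
    old = filter (λ X → ¬? (X ≟ˢ T)) Bs
    Bs′ = (T ∖ t) ∷ old
    old⊆ : ∀ {X} → X ∈ˡ old → X ∈ˡ Bs
    old⊆ X∈ = proj₁ (∈-filter⁻ (λ X → ¬? (X ≟ˢ T)) {xs = Bs} X∈)
    less : ∑ Bs′ ∣_∣ < ∑ Bs ∣_∣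
    less = ℕ.<-≤-trans (ℕ.+-monoˡ-< _ (x∈p⇒∣p-x∣<∣p∣ t∈T)) (∑-remove (λ X → ¬? (X ≟ˢ T)) ∣_∣ T∈ (λ T≢T → T≢T refl))
    -- The condition tested against all members includes `T` itself, which guarantees that the
    -- shrunken set keeps at least `s` points.
    self : s ≤ ∣ (T ∖ t) ∩ (T ∖ t) ∣
    self = ℕ.≤-trans (All.lookup all T∈)
      (p⊆q⇒∣p∣≤∣q∣ (λ h → let a , b = x∈p∩q⁻ (T ∖ t) T h in x∈p∩q⁺ (a , a)))
    int′ : Intersecting s Bs′
    int′ (here refl) (here refl) = self
    int′ (here refl) (there Y∈)  = All.lookup all (old⊆ Y∈)
    int′ (there {X} X∈)  (here refl) = subst (λ z → s ≤ ∣ z ∣) (∩-comm (T ∖ t) _) (All.lookup all (old⊆ X∈))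
    int′ (there X∈)  (there Y∈)  = int (old⊆ X∈) (old⊆ Y∈)
    bd′ : ∀ {X} → X ∈ˡ Bs′ → ∣ X ∣ ≤ q
    bd′ (here refl) = ℕ.≤-trans (ℕ.<⇒≤ (x∈p⇒∣p-x∣<∣p∣ t∈T)) (bd T∈)
    bd′ (there X∈)  = bd (old⊆ X∈)
    ref : Bs′ Refines Bs
    ref {X} X∈ with X ≟ˢ T
    ... | yes refl = T ∖ t , here refl , λ h → p─q⊆p T ⁅ t ⁆ h
    ... | no X≢T   = X , there (∈-filter⁺ (λ X → ¬? (X ≟ˢ T)) X∈ X≢T) , λ z → z

elements : Subset n → List (Fin n)
elements {n} Y = filter (_∈? Y) (allFin n)

length-elements : (Y : Subset n) → length (elements Y) ≡ ∣ Y ∣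
length-elements {n} Y = begin
  length (elements Y)                     ≡⟨ ∑-one (elements Y) ⟨
  ∑ (elements Y) (λ _ → 1)                ≡⟨ ∑-filter (_∈? Y) (allFin n) (λ _ → 1) ⟩
  ∑ (allFin n) (λ i → 𝟙 (i ∈? Y) * 1)     ≡⟨ ∑-cong (allFin n) (λ i → ℕ.*-identityʳ (𝟙 (i ∈? Y))) ⟩
  ∑ (allFin n) (λ i → 𝟙 (i ∈? Y))         ≡⟨ ∣∣≡∑ Y ⟨
  ∣ Y ∣                                   ∎
  where open ≡-Reasoning

module Extend (s : ℕ) (Bs : List (Subset n)) where

  small? : ∀ X → Dec (Any (λ Y → ∣ X ∩ Y ∣ < s) Bs)
  small? X = Any.any? (λ Y → ∣ X ∩ Y ∣ <? s) Bs

  -- A branching search for the q-sets of `Bs` above `X`. If `Y` meets `X` in fewer than `s` points,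
  -- every member of `Bs` that contains `X` has a further point of `Y`, so it suffices to branch
  -- over the points of `Y`. The witness is the first one found, and a node without witness is
  -- dropped.
  extend : Subset n → ℕ → List (Subset n)
  extend X zero    = X ∷ []
  extend X (suc k) with small? X
  ... | yes p = concatMap (λ y → extend (X ∪ ⁅ y ⁆) k) (elements (proj₁ (find p)))
  ... | no _  = []

  length-extend : ∀ {q} → (∀ {Y} → Y ∈ˡ Bs → ∣ Y ∣ ≤ q) → ∀ X k → length (extend X k) ≤ q ^ k
  length-extend bd X zero = ℕ.≤-refl
  length-extend {q} bd X (suc k) with small? X
  ... | no _  = z≤n
  ... | yes p = begin
    length (concatMap (λ y → extend (X ∪ ⁅ y ⁆) k) (elements Y))
      ≡⟨ length-concatMap (λ y → extend (X ∪ ⁅ y ⁆) k) (elements Y) ⟩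
    ∑ (elements Y) (λ y → length (extend (X ∪ ⁅ y ⁆) k))
      ≤⟨ ∑-mono (elements Y) (λ y → length-extend bd (X ∪ ⁅ y ⁆) k) ⟩
    ∑ (elements Y) (λ _ → q ^ k)
      ≡⟨ ∑-const (elements Y) (q ^ k) ⟩
    length (elements Y) * q ^ k
      ≤⟨ ℕ.*-monoˡ-≤ (q ^ k) (ℕ.≤-trans (ℕ.≤-reflexive (length-elements Y)) (bd (proj₁ (proj₂ (find p))))) ⟩
    q * q ^ k ∎
    where
    open ℕ.≤-Reasoning
    Y = proj₁ (find p)

  -- A node on the way to `T` is never dropped: if `X` misses a point t of `T`, irreducibility
  -- supplies a `Y` meeting `T` minus t, hence `X`, in fewer than `s` points. The branching itself
  -- keeps `T`, as `T` meets `Y` in at least `s` points.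
  ∈-extend : ∀ {q} → Intersecting s Bs → Irreducible s q Bs → ∀ {T} → T ∈ˡ Bs → ∣ T ∣ ≡ q →
             ∀ X k → X ⊆ T → ∣ X ∣ + k ≡ q → T ∈ˡ extend X k
  ∈-extend int irr T∈ T≡q X zero X⊆T eq =
    here (sym (⊆∧≤⇒≡ X⊆T (ℕ.≤-reflexive (trans T≡q (trans (sym eq) (ℕ.+-identityʳ _))))))
  ∈-extend int irr {T} T∈ T≡q X (suc k) X⊆T eq with small? X
  ... | no none = contradiction (lose Y∈ X∩Y<s) none
    where
    outsider = ∃-outside X T (subst (∣ X ∣ <_) (trans eq (sym T≡q)) (ℕ.m<m+n ∣ X ∣ (s≤s z≤n)))
    t   = proj₁ outsider
    t∈T = proj₁ (proj₂ outsider)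
    t∉X = proj₂ (proj₂ outsider)
    blocker = irr T∈ T≡q t∈T
    Y = proj₁ blocker
    Y∈ = proj₁ (proj₂ blocker)
    X⊆T∖t : X ⊆ T ∖ t
    X⊆T∖t {x} x∈X = x∈p∧x≢y⇒x∈p-y (X⊆T x∈X) (λ x≡t → t∉X (subst (_∈ X) x≡t x∈X))
    X∩Y<s : ∣ X ∩ Y ∣ < s
    X∩Y<s = ℕ.≤-<-trans (∩-monoˡ-∣∣ Y X⊆T∖t) (proj₂ (proj₂ blocker))
  ... | yes p = ∈-concatMap⁺ (λ y → extend (X ∪ ⁅ y ⁆) k) {xs = elements Y} (lose y∈elements (∈-extend int irr T∈ T≡q (X ∪ ⁅ y ⁆) k X∪y⊆T eq′))
    where
    Y = proj₁ (find p)
    Y∈ = proj₁ (proj₂ (find p))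
    outsider = ∃-outside (X ∩ Y) (T ∩ Y) (ℕ.<-≤-trans (proj₂ (proj₂ (find p))) (int T∈ Y∈))
    y = proj₁ outsider
    y∈ = x∈p∩q⁻ T Y (proj₁ (proj₂ outsider))
    y∉X : y ∉ X
    y∉X y∈X = proj₂ (proj₂ outsider) (x∈p∩q⁺ (y∈X , proj₂ y∈))
    y∈elements : y ∈ˡ elements Y
    y∈elements = ∈-filter⁺ (_∈? Y) (∈-allFin y) (proj₂ y∈)
    X∪y⊆T : X ∪ ⁅ y ⁆ ⊆ T
    X∪y⊆T h with x∈p∪q⁻ X ⁅ y ⁆ h
    ... | inj₁ x∈X = X⊆T x∈X
    ... | inj₂ x∈y = subst (_∈ T) (sym (x∈⁅y⁆⇒x≡y y x∈y)) (proj₁ y∈)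
    eq′ : ∣ X ∪ ⁅ y ⁆ ∣ + k ≡ _
    eq′ = trans (cong (_+ k) (∣∪⁅⁆∣ X y y∉X)) (trans (sym (ℕ.+-suc ∣ X ∣ k)) eq)

traces : Subset n → Subset n → List (Subset n)
traces []          []          = [] ∷ []
traces (false ∷ T) (false ∷ U) = map (outside ∷_) (traces T U)
traces (false ∷ T) (true ∷ U)  = map (outside ∷_) (traces T U) ++ map (inside ∷_) (traces T U)
traces (true ∷ T)  (b ∷ U)     = map (outside ∷_) (traces T U) ++ map (inside ∷_) (traces T U)

∈-traces : (T U X : Subset n) → X ∩ (T ∪ U) ∈ˡ traces T U
∈-traces []          []          []      = here refl
∈-traces (false ∷ T) (false ∷ U) (false ∷ X) = ∈-map⁺ (outside ∷_) (∈-traces T U X)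
∈-traces (false ∷ T) (false ∷ U) (true ∷ X) = ∈-map⁺ (outside ∷_) (∈-traces T U X)
∈-traces (false ∷ T) (true ∷ U)  (false ∷ X) = ∈-++⁺ˡ (∈-map⁺ (outside ∷_) (∈-traces T U X))
∈-traces (false ∷ T) (true ∷ U)  (true ∷ X)  = ∈-++⁺ʳ _ (∈-map⁺ (inside ∷_) (∈-traces T U X))
∈-traces (true ∷ T)  (b ∷ U)     (false ∷ X) = ∈-++⁺ˡ (∈-map⁺ (outside ∷_) (∈-traces T U X))
∈-traces (true ∷ T)  (b ∷ U)     (true ∷ X)  = ∈-++⁺ʳ _ (∈-map⁺ (inside ∷_) (∈-traces T U X))

-- The sum runs over the subsets of `T ∪ U`: a point of `T ∩ U` contributes the factor 1 + q, a
-- point of the symmetric difference the factor 2. Multiplying by 4 for each common point turns the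
-- size of the symmetric difference into `∣ T ∣ + ∣ U ∣` without subtraction.
∑-traces : ∀ q (T U : Subset n) →
           4 ^ ∣ T ∩ U ∣ * ∑ (traces T U) (λ X → q ^ ∣ X ∩ (T ∩ U) ∣) ≡ (1 + q) ^ ∣ T ∩ U ∣ * 2 ^ (∣ T ∣ + ∣ U ∣)
∑-traces q []          []          = refl
∑-traces q (false ∷ T) (false ∷ U) = trans
  (cong (4 ^ ∣ T ∩ U ∣ *_) (∑-map (outside ∷_) (traces T U) _)) (∑-traces q T U)
∑-traces q (false ∷ T) (true ∷ U)  = begin
  F * ∑ (map (outside ∷_) (traces T U) ++ map (inside ∷_) (traces T U)) (λ X → q ^ ∣ X ∩ (outside ∷ (T ∩ U)) ∣)
    ≡⟨ cong (F *_) (trans (∑-++ (map (outside ∷_) (traces T U)) _ _) (cong₂ _+_ (∑-map (outside ∷_) (traces T U) _) (∑-map (inside ∷_) (traces T U) _))) ⟩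
  F * (E + ∑ (traces T U) (λ X → q ^ ∣ (inside ∷ X) ∩ (outside ∷ (T ∩ U)) ∣))
    ≡⟨⟩
  F * (E + E)  ≡⟨ lem F E ⟩
  2 * (F * E)  ≡⟨ cong (2 *_) (∑-traces q T U) ⟩
  2 * (Q * 2 ^ (∣ T ∣ + ∣ U ∣))  ≡⟨ lem₂ Q _ ⟩
  Q * 2 ^ suc (∣ T ∣ + ∣ U ∣)    ≡⟨ cong (λ z → Q * 2 ^ z) (ℕ.+-suc ∣ T ∣ ∣ U ∣) ⟨
  Q * 2 ^ (∣ T ∣ + suc ∣ U ∣)    ∎
  where
  open ≡-Reasoning
  F = 4 ^ ∣ T ∩ U ∣
  E = ∑ (traces T U) (λ X → q ^ ∣ X ∩ (T ∩ U) ∣)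
  Q = (1 + q) ^ ∣ T ∩ U ∣
  lem : ∀ f e → f * (e + e) ≡ 2 * (f * e)
  lem = solve-∀
  lem₂ : ∀ a b → 2 * (a * b) ≡ a * (2 * b)
  lem₂ = solve-∀
∑-traces q (true ∷ T)  (false ∷ U) = begin
  F * ∑ (map (outside ∷_) (traces T U) ++ map (inside ∷_) (traces T U)) (λ X → q ^ ∣ X ∩ (outside ∷ (T ∩ U)) ∣)
    ≡⟨ cong (F *_) (trans (∑-++ (map (outside ∷_) (traces T U)) _ _) (cong₂ _+_ (∑-map (outside ∷_) (traces T U) _) (∑-map (inside ∷_) (traces T U) _))) ⟩
  F * (E + E)  ≡⟨ lem F E ⟩
  2 * (F * E)  ≡⟨ cong (2 *_) (∑-traces q T U) ⟩
  2 * (Q * 2 ^ (∣ T ∣ + ∣ U ∣))  ≡⟨ lem₂ Q _ ⟩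
  Q * 2 ^ suc (∣ T ∣ + ∣ U ∣)    ∎
  where
  open ≡-Reasoning
  F = 4 ^ ∣ T ∩ U ∣
  E = ∑ (traces T U) (λ X → q ^ ∣ X ∩ (T ∩ U) ∣)
  Q = (1 + q) ^ ∣ T ∩ U ∣
  lem : ∀ f e → f * (e + e) ≡ 2 * (f * e)
  lem = solve-∀
  lem₂ : ∀ a b → 2 * (a * b) ≡ a * (2 * b)
  lem₂ = solve-∀
∑-traces q (true ∷ T)  (true ∷ U)  = begin
  4 * F * ∑ (map (outside ∷_) (traces T U) ++ map (inside ∷_) (traces T U)) (λ X → q ^ ∣ X ∩ (inside ∷ (T ∩ U)) ∣)
    ≡⟨ cong (4 * F *_) (trans (∑-++ (map (outside ∷_) (traces T U)) _ _) (cong₂ _+_ (∑-map (outside ∷_) (traces T U) _)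
         (trans (∑-map (inside ∷_) (traces T U) _) (∑-*ˡ (traces T U) q (λ X → q ^ ∣ X ∩ (T ∩ U) ∣))))) ⟩
  4 * F * (E + q * E)                ≡⟨ lem F E q ⟩
  4 * ((1 + q) * (F * E))            ≡⟨ cong (λ z → 4 * ((1 + q) * z)) (∑-traces q T U) ⟩
  4 * ((1 + q) * (Q * 2 ^ (∣ T ∣ + ∣ U ∣)))  ≡⟨ lem₂ (1 + q) Q _ ⟩
  (1 + q) * Q * 2 ^ suc (suc (∣ T ∣ + ∣ U ∣))  ≡⟨ cong (λ z → (1 + q) * Q * 2 ^ suc z) (ℕ.+-suc ∣ T ∣ ∣ U ∣) ⟨
  (1 + q) * Q * 2 ^ (suc ∣ T ∣ + suc ∣ U ∣)    ∎
  where
  open ≡-Reasoning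
  F = 4 ^ ∣ T ∩ U ∣
  E = ∑ (traces T U) (λ X → q ^ ∣ X ∩ (T ∩ U) ∣)
  Q = (1 + q) ^ ∣ T ∩ U ∣
  lem : ∀ f e q → 4 * f * (e + q * e) ≡ 4 * ((1 + q) * (f * e))
  lem = solve-∀
  lem₂ : ∀ q a b → 4 * (q * (a * b)) ≡ q * a * (2 * (2 * b))
  lem₂ = solve-∀

∣∣-∩∪ : (X T U : Subset n) → ∣ X ∩ T ∣ + ∣ X ∩ U ∣ ≡ ∣ X ∩ (T ∪ U) ∣ + ∣ (X ∩ (T ∪ U)) ∩ (T ∩ U) ∣
∣∣-∩∪ []          []          []          = refl
∣∣-∩∪ (false ∷ X) (_ ∷ T)     (_ ∷ U)     = ∣∣-∩∪ X T U
∣∣-∩∪ (true ∷ X)  (false ∷ T) (false ∷ U) = ∣∣-∩∪ X T U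
∣∣-∩∪ (true ∷ X)  (false ∷ T) (true ∷ U)  = trans (ℕ.+-suc ∣ X ∩ T ∣ ∣ X ∩ U ∣) (cong suc (∣∣-∩∪ X T U))
∣∣-∩∪ (true ∷ X)  (true ∷ T)  (false ∷ U) = cong suc (∣∣-∩∪ X T U)
∣∣-∩∪ (true ∷ X)  (true ∷ T)  (true ∷ U)  = cong suc (trans (ℕ.+-suc ∣ X ∩ T ∣ ∣ X ∩ U ∣)
  (trans (cong suc (∣∣-∩∪ X T U)) (sym (ℕ.+-suc ∣ X ∩ (T ∪ U) ∣ _))))

^-distribʳ-* : ∀ k a b → (a * b) ^ k ≡ a ^ k * b ^ k
^-distribʳ-* zero    a b = refl
^-distribʳ-* (suc k) a b = trans (cong (a * b *_) (^-distribʳ-* k a b)) (lem a b (a ^ k) (b ^ k))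
  where
  lem : ∀ a b x y → a * b * (x * y) ≡ a * x * (b * y)
  lem = solve-∀

-- This is (1 + 1/q)^k ≤ 1 + 2k/q ≤ 2 with denominators cleared. In the induction the product term
-- 2k/q² is at most 1/q.
^-half-≤ : ∀ q k → 1 ≤ q → 2 * k ≤ q → (1 + q) ^ k ≤ 2 * q ^ k
^-half-≤ q k 1≤q 2k≤q = ℕ.*-cancelˡ-≤ q {{ℕ.>-nonZero 1≤q}} (begin
  q * (1 + q) ^ k    ≤⟨ go k 2k≤q ⟩
  (q + 2 * k) * q ^ k ≤⟨ ℕ.*-monoˡ-≤ (q ^ k) (ℕ.+-monoʳ-≤ q 2k≤q) ⟩
  (q + q) * q ^ k    ≡⟨ lem q (q ^ k) ⟩
  q * (2 * q ^ k)    ∎)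
  where
  open ℕ.≤-Reasoning
  lem : ∀ q x → (q + q) * x ≡ q * (2 * x)
  lem = solve-∀
  lem₁ : ∀ q x → q * ((1 + q) * x) ≡ (1 + q) * (q * x)
  lem₁ = solve-∀
  lem₂ : ∀ q k x → (1 + q) * ((q + 2 * k) * x) ≡ (q * (q + 2 * k + 1) + 2 * k) * x
  lem₂ = solve-∀
  lem₃ : ∀ q k x → (q * (q + 2 * k + 1) + q) * x ≡ (q + 2 * (1 + k)) * (q * x)
  lem₃ = solve-∀
  go : ∀ k → 2 * k ≤ q → q * (1 + q) ^ k ≤ (q + 2 * k) * q ^ k
  go zero    _  = ℕ.≤-reflexive (cong (_* 1) (sym (ℕ.+-identityʳ q)))
  go (suc k) le = begin
    q * ((1 + q) * (1 + q) ^ k)           ≡⟨ lem₁ q ((1 + q) ^ k) ⟩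
    (1 + q) * (q * (1 + q) ^ k)           ≤⟨ ℕ.*-monoʳ-≤ (1 + q) (go k 2k≤) ⟩
    (1 + q) * ((q + 2 * k) * q ^ k)       ≡⟨ lem₂ q k (q ^ k) ⟩
    (q * (q + 2 * k + 1) + 2 * k) * q ^ k ≤⟨ ℕ.*-monoˡ-≤ (q ^ k) (ℕ.+-monoʳ-≤ (q * (q + 2 * k + 1)) 2k≤) ⟩
    (q * (q + 2 * k + 1) + q) * q ^ k     ≡⟨ lem₃ q k (q ^ k) ⟩
    (q + 2 * suc k) * (q * q ^ k) ∎
    where
    2k≤ : 2 * k ≤ q
    2k≤ = ℕ.≤-trans (ℕ.*-monoʳ-≤ 2 (ℕ.n≤1+n k)) le

-- A substitute for (1 + 1/q)^s ≤ e: both halves of `s` meet the condition of `^-half-≤`, the larger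
-- one because twice it is at most s + 1 ≤ q.
^-suc-≤ : ∀ q s → s < q → (1 + q) ^ s ≤ 4 * q ^ s
^-suc-≤ q s s<q = begin
  (1 + q) ^ s                        ≡⟨ cong ((1 + q) ^_) (sym (ℕ.⌊n/2⌋+⌈n/2⌉≡n s)) ⟩
  (1 + q) ^ (a + b)                  ≡⟨ ℕ.^-distribˡ-+-* (1 + q) a b ⟩
  (1 + q) ^ a * (1 + q) ^ b          ≤⟨ ℕ.*-mono-≤ (^-half-≤ q a 1≤q 2a≤) (^-half-≤ q b 1≤q 2b≤) ⟩
  2 * q ^ a * (2 * q ^ b)            ≡⟨ lem (q ^ a) (q ^ b) ⟩
  4 * (q ^ a * q ^ b)                ≡⟨ cong (4 *_) (sym (ℕ.^-distribˡ-+-* q a b)) ⟩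
  4 * q ^ (a + b)                    ≡⟨ cong (λ z → 4 * q ^ z) (ℕ.⌊n/2⌋+⌈n/2⌉≡n s) ⟩
  4 * q ^ s                          ∎
  where
  open ℕ.≤-Reasoning
  a = ℕ.⌊ s /2⌋
  b = ℕ.⌈ s /2⌉
  1≤q = ℕ.≤-trans (s≤s z≤n) s<q
  lem : ∀ x y → 2 * x * (2 * y) ≡ 4 * (x * y)
  lem = solve-∀
  2b≤ : 2 * b ≤ q
  2b≤ = begin
    2 * b        ≡⟨ cong (b +_) (ℕ.+-identityʳ b) ⟩
    b + b        ≤⟨ ℕ.+-monoˡ-≤ b (ℕ.⌊n/2⌋-mono (ℕ.n≤1+n (suc s))) ⟩
    suc a + b    ≡⟨ cong suc (ℕ.⌊n/2⌋+⌈n/2⌉≡n s) ⟩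
    suc s        ≤⟨ s<q ⟩
    q            ∎
  2a≤ : 2 * a ≤ q
  2a≤ = ℕ.≤-trans (ℕ.*-monoʳ-≤ 2 (ℕ.⌊n/2⌋≤⌈n/2⌉ s)) 2b≤

-- A trace X is extended to q-sets in at most q^(q - |X|) ways, and |X| + |X ∩ K| ≥ 2s makes q^s
-- times this at most q^(j+1) q^|X ∩ K|. Summed over all traces the last factor gives at most (1 +
-- q)^s 4^(j+1), and (1 + q)^s ≤ 4 q^s cancels the q^s.
irreducible-level : ∀ s j (Bs : List (Subset n)) → Intersecting s Bs →
            (∀ {X} → X ∈ˡ Bs → ∣ X ∣ ≤ s + suc j) → Irreducible s (s + suc j) Bs →
            ∃ λ Ws → (∀ {T} → T ∈ˡ Bs → ∣ T ∣ ≡ s + suc j → T ∈ˡ Ws)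
                   × (∀ {W} → W ∈ˡ Ws → ∣ W ∣ ≡ s + suc j)
                   × length Ws ≤ 4 * (4 * (s + suc j)) ^ suc j
irreducible-level {n} s j Bs int bd irr with Any.any? (λ T → ∣ T ∣ ≟ s + suc j) Bs
... | no none = [] , (λ T∈ T≡q → contradiction (lose T∈ T≡q) none) , (λ ()) , z≤n
... | yes some = Ws , ∈Ws , (λ W∈ → proj₂ (∈-filter⁻ q? {xs = L} W∈)) ,
                 ℕ.≤-trans (List.length-filter q? L) L≤
  where
  open Extend s Bs
  q = s + suc j
  q? : U.Decidable (λ (T : Subset n) → ∣ T ∣ ≡ q)
  q? T = ∣ T ∣ ≟ q
  s<q : s < q
  s<q = ℕ.m<m+n s (s≤s z≤n)
  1≤q : 1 ≤ q
  1≤q = ℕ.≤-trans (s≤s z≤n) s<q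
  T₀ = proj₁ (find some)
  T₀∈ = proj₁ (proj₂ (find some))
  T₀≡q = proj₂ (proj₂ (find some))
  point = ∃-outside ∅ T₀ (subst (_< ∣ T₀ ∣) (sym (∣⊥∣≡0 n)) (subst (0 <_) (sym T₀≡q) 1≤q))
  blocker = irr T₀∈ T₀≡q (proj₁ (proj₂ point))
  T₁ = proj₁ blocker
  T₁∈ = proj₁ (proj₂ blocker)
  t = proj₁ point
  -- Deleting one point of T₀ makes T₀ ∩ T₁ too small, so it has exactly s points.
  K≡s : ∣ T₀ ∩ T₁ ∣ ≡ s
  K≡s = ℕ.≤-antisym (ℕ.≤-trans (ℕ.≤-trans (p⊆q⇒∣p∣≤∣q∣ sub) (size-∪ ((T₀ ∖ t) ∩ T₁))) (proj₂ (proj₂ blocker))) (int T₀∈ T₁∈)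
    where
    sub : T₀ ∩ T₁ ⊆ ((T₀ ∖ t) ∩ T₁) ∪ ⁅ t ⁆
    sub {x} h with x Fin.≟ t
    ... | yes refl = x∈p∪q⁺ (inj₂ (x∈⁅x⁆ x))
    ... | no x≢t   = let a , b = x∈p∩q⁻ T₀ T₁ h in x∈p∪q⁺ (inj₁ (x∈p∩q⁺ (x∈p∧x≢y⇒x∈p-y a x≢t , b)))
    size-∪ : ∀ X → ∣ X ∪ ⁅ t ⁆ ∣ ≤ suc ∣ X ∣
    size-∪ X with t ∈? X
    ... | no t∉X  = ℕ.≤-reflexive (∣∪⁅⁆∣ X t t∉X)
    ... | yes t∈X = ℕ.m≤n⇒m≤1+n (p⊆q⇒∣p∣≤∣q∣ λ h → [ id , (λ x∈ → subst (_∈ X) (sym (x∈⁅y⁆⇒x≡y t x∈)) t∈X) ]′ (x∈p∪q⁻ X ⁅ t ⁆ h))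
  K = T₀ ∩ T₁
  -- Each q-set T of Bs meets T₀ and T₁ in at least s points, so its trace X = T ∩ (T₀ ∪ T₁)
  -- satisfies |X| + |X ∩ K| ≥ 2s.  Extending from X, and not from an s-subset of T₀, avoids a
  -- factor C(q, s).
  Good : U.Pred (Subset n) 0ℓ
  Good X = s + s ≤ ∣ X ∣ + ∣ X ∩ K ∣ × ∣ X ∣ ≤ q
  good? : U.Decidable Good
  good? X = (s + s ≤? ∣ X ∣ + ∣ X ∩ K ∣) ×-dec (∣ X ∣ ≤? q)
  starts = filter good? (traces T₀ T₁)
  L = concatMap (λ X → extend X (q ∸ ∣ X ∣)) starts
  Ws = filter q? L
  ∈Ws : ∀ {T} → T ∈ˡ Bs → ∣ T ∣ ≡ q → T ∈ˡ Ws
  ∈Ws {T} T∈ T≡q = ∈-filter⁺ q? (∈-concatMap⁺ (λ X → extend X (q ∸ ∣ X ∣)) {xs = starts} (lose X∈ T∈extend)) T≡q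
    where
    X = T ∩ (T₀ ∪ T₁)
    X≤q : ∣ X ∣ ≤ q
    X≤q = ℕ.≤-trans (∣p∩q∣≤∣p∣ T (T₀ ∪ T₁)) (ℕ.≤-reflexive T≡q)
    X∈ : X ∈ˡ starts
    X∈ = ∈-filter⁺ good? (∈-traces T₀ T₁ T)
      (ℕ.≤-trans (ℕ.+-mono-≤ (int T∈ T₀∈) (int T∈ T₁∈)) (ℕ.≤-reflexive (∣∣-∩∪ T T₀ T₁)) , X≤q)
    T∈extend : T ∈ˡ extend X (q ∸ ∣ X ∣)
    T∈extend = ∈-extend int irr T∈ T≡q X (q ∸ ∣ X ∣) (λ h → proj₁ (x∈p∩q⁻ T (T₀ ∪ T₁) h)) (ℕ.m+[n∸m]≡n X≤q)
  E = ∑ (traces T₀ T₁) (λ X → q ^ ∣ X ∩ K ∣)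
  E≤ : E ≤ (1 + q) ^ s * 4 ^ suc j
  E≤ = ℕ.*-cancelˡ-≤ (4 ^ s) {{ℕ.m^n≢0 4 s}} (begin
    4 ^ s * E                                   ≡⟨ cong (λ z → 4 ^ z * E) K≡s ⟨
    4 ^ ∣ K ∣ * E                               ≡⟨ ∑-traces q T₀ T₁ ⟩
    (1 + q) ^ ∣ K ∣ * 2 ^ (∣ T₀ ∣ + ∣ T₁ ∣)     ≤⟨ ℕ.*-mono-≤ (ℕ.≤-reflexive (cong ((1 + q) ^_) K≡s))
                                                    (ℕ.^-monoʳ-≤ 2 (ℕ.+-mono-≤ (bd T₀∈) (bd T₁∈))) ⟩
    (1 + q) ^ s * 2 ^ (q + q)                   ≡⟨ cong ((1 + q) ^ s *_) (trans (cong (λ z → 2 ^ (q + z)) (sym (ℕ.+-identityʳ q))) (sym (ℕ.^-*-assoc 2 2 q))) ⟩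
    (1 + q) ^ s * 4 ^ q                         ≡⟨ cong ((1 + q) ^ s *_) (ℕ.^-distribˡ-+-* 4 s (suc j)) ⟩
    (1 + q) ^ s * (4 ^ s * 4 ^ suc j)           ≡⟨ lem ((1 + q) ^ s) (4 ^ s) (4 ^ suc j) ⟩
    4 ^ s * ((1 + q) ^ s * 4 ^ suc j)           ∎)
    where
    open ℕ.≤-Reasoning
    lem : ∀ a b c → a * (b * c) ≡ b * (a * c)
    lem = solve-∀
  weigh : ∀ X → X ∈ˡ starts → q ^ s * length (extend X (q ∸ ∣ X ∣)) ≤ q ^ suc j * q ^ ∣ X ∩ K ∣
  weigh X X∈ = begin
    q ^ s * length (extend X (q ∸ ∣ X ∣)) ≤⟨ ℕ.*-monoʳ-≤ (q ^ s) (length-extend bd X (q ∸ ∣ X ∣)) ⟩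
    q ^ s * q ^ (q ∸ ∣ X ∣)               ≡⟨ ℕ.^-distribˡ-+-* q s (q ∸ ∣ X ∣) ⟨
    q ^ (s + (q ∸ ∣ X ∣))                 ≤⟨ ℕ.^-monoʳ-≤ q {{ℕ.>-nonZero 1≤q}} expo ⟩
    q ^ (suc j + ∣ X ∩ K ∣)               ≡⟨ ℕ.^-distribˡ-+-* q (suc j) ∣ X ∩ K ∣ ⟩
    q ^ suc j * q ^ ∣ X ∩ K ∣             ∎
    where
    open ℕ.≤-Reasoning
    good = proj₂ (∈-filter⁻ good? {xs = traces T₀ T₁} X∈)
    lem : ∀ s y j → s + (s + j) + y ≡ s + s + (j + y)
    lem = solve-∀
    lem₂ : ∀ x k j → (x + k) + j ≡ (j + k) + x
    lem₂ = solve-∀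
    expo : s + (q ∸ ∣ X ∣) ≤ suc j + ∣ X ∩ K ∣
    expo = ℕ.+-cancelʳ-≤ ∣ X ∣ _ _ (begin
      s + (q ∸ ∣ X ∣) + ∣ X ∣      ≡⟨ ℕ.+-assoc s _ _ ⟩
      s + (q ∸ ∣ X ∣ + ∣ X ∣)      ≡⟨ cong (s +_) (ℕ.m∸n+n≡m (proj₂ good)) ⟩
      s + (s + suc j)              ≡⟨ ℕ.+-assoc s s (suc j) ⟨
      s + s + suc j                ≤⟨ ℕ.+-monoˡ-≤ (suc j) (proj₁ good) ⟩
      ∣ X ∣ + ∣ X ∩ K ∣ + suc j    ≡⟨ lem₂ ∣ X ∣ ∣ X ∩ K ∣ (suc j) ⟩
      suc j + ∣ X ∩ K ∣ + ∣ X ∣    ∎)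
  L≤ : length L ≤ 4 * (4 * q) ^ suc j
  L≤ = ℕ.*-cancelˡ-≤ (q ^ s) {{ℕ.m^n≢0 q s {{ℕ.>-nonZero 1≤q}}}} (begin
    q ^ s * length L                  ≡⟨ cong (q ^ s *_) (length-concatMap (λ X → extend X (q ∸ ∣ X ∣)) starts) ⟩
    q ^ s * ∑ starts (λ X → length (extend X (q ∸ ∣ X ∣)))  ≡⟨ ∑-*ˡ starts (q ^ s) (λ X → length (extend X (q ∸ ∣ X ∣))) ⟨
    ∑ starts (λ X → q ^ s * length (extend X (q ∸ ∣ X ∣)))  ≤⟨ ∑-mono-∈ starts weigh ⟩
    ∑ starts (λ X → q ^ suc j * q ^ ∣ X ∩ K ∣)              ≤⟨ ∑-filter-≤ good? (traces T₀ T₁) (λ X → q ^ suc j * q ^ ∣ X ∩ K ∣) ⟩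
    ∑ (traces T₀ T₁) (λ X → q ^ suc j * q ^ ∣ X ∩ K ∣)      ≡⟨ ∑-*ˡ (traces T₀ T₁) (q ^ suc j) (λ X → q ^ ∣ X ∩ K ∣) ⟩
    q ^ suc j * E                     ≤⟨ ℕ.*-monoʳ-≤ (q ^ suc j) E≤ ⟩
    q ^ suc j * ((1 + q) ^ s * 4 ^ suc j)   ≤⟨ ℕ.*-monoʳ-≤ (q ^ suc j) (ℕ.*-monoˡ-≤ (4 ^ suc j) (^-suc-≤ q s s<q)) ⟩
    q ^ suc j * (4 * q ^ s * 4 ^ suc j)     ≡⟨ lem (q ^ suc j) (q ^ s) (4 ^ suc j) ⟩
    q ^ s * (4 * (4 ^ suc j * q ^ suc j))   ≡⟨ cong (λ z → q ^ s * (4 * z)) (^-distribʳ-* (suc j) 4 q) ⟨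
    q ^ s * (4 * (4 * q) ^ suc j)     ∎)
    where
    open ℕ.≤-Reasoning
    lem : ∀ a b c → a * (4 * b * c) ≡ b * (4 * (c * a))
    lem = solve-∀

-- The total weight of the sets removed on the levels s + 1 to s + j, at the count given by
-- `irreducible-level`. Level s is absent: what survives there is the single set `Z`.
peelBound : (w : ℕ → ℕ) (s j : ℕ) → ℕ
peelBound w s zero    = 0
peelBound w s (suc j) = 4 * (4 * (s + suc j)) ^ suc j * w (s + suc j) + peelBound w s j

-- Each round reduces the family, moves its sets of top size into `Ws` and continues with the
-- smaller ones. Once all sizes are at most `s`, an s-intersecting family has only one distinct
-- member, and this is `Z`.
peel : ∀ (w : ℕ → ℕ) s j (Z₀ : Subset n) → ∣ Z₀ ∣ ≡ s → (Bs : List (Subset n)) → Intersecting s Bs →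
       (∀ {X} → X ∈ˡ Bs → ∣ X ∣ ≤ s + j) →
       ∃ λ Z → ∣ Z ∣ ≡ s × ∃ λ Ws → (∀ {X} → X ∈ˡ Bs → Z ⊆ X ⊎ Any (_⊆ X) Ws)
         × (∀ {W} → W ∈ˡ Ws → ∣ W ∣ ≤ s + j) × ∑ Ws (w ∘ ∣_∣) ≤ peelBound w s j
-- If nothing is left, any s-set may serve as `Z`; `Z₀` is carried along for this case only.
peel w s zero Z₀ Z₀≡s [] int bd = Z₀ , Z₀≡s , [] , (λ ()) , (λ ()) , z≤n
peel {n} w s zero Z₀ Z₀≡s (Z ∷ Bs) int bd = Z , Z≡s , [] , inj₁ ∘ Z⊆ , (λ ()) , z≤n
  where
  Z≤s : ∣ Z ∣ ≤ s
  Z≤s = subst (∣ Z ∣ ≤_) (ℕ.+-identityʳ s) (bd (here refl))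
  Z≡s : ∣ Z ∣ ≡ s
  Z≡s = ℕ.≤-antisym Z≤s (ℕ.≤-trans (int (here refl) (here refl)) (∣p∩q∣≤∣p∣ Z Z))
  Z⊆ : ∀ {X} → X ∈ˡ (Z ∷ Bs) → Z ⊆ X
  Z⊆ {X} X∈ h = proj₂ (x∈p∩q⁻ Z X (subst (_ ∈_) (sym eq) h))
    where
    eq : Z ∩ X ≡ Z
    eq = ⊆∧≤⇒≡ (λ h → p∩q⊆p Z X h) (ℕ.≤-trans Z≤s (int (here refl) X∈))
peel {n} w s (suc j) Z₀ Z₀≡s Bs int bd =
  let Bs₁ , int₁ , bd₁ , ref₁ , irr₁ = reduce s q Bs int bd
      Ws , ∈Ws , sizeWs , lenWs      = irreducible-level s j Bs₁ int₁ bd₁ irr₁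
      Bs₂ = filter small? Bs₁
      old : ∀ {X} → X ∈ˡ Bs₂ → X ∈ˡ Bs₁
      old X∈ = proj₁ (∈-filter⁻ small? {xs = Bs₁} X∈)
      Z , Z≡s , Ws′ , cover , bdWs′ , sumWs′ = peel w s j Z₀ Z₀≡s Bs₂ (λ X∈ Y∈ → int₁ (old X∈) (old Y∈))
        (λ {X} X∈ → ℕ.≤-pred (subst (∣ X ∣ <_) (ℕ.+-suc s j) (proj₂ (∈-filter⁻ small? {xs = Bs₁} X∈))))
  in Z , Z≡s , Ws ++ Ws′ , (λ X∈ → combine Bs₁ bd₁ ref₁ Z Ws Ws′ ∈Ws cover X∈) ,
     (λ W∈ → [ (λ h → ℕ.≤-reflexive (sizeWs h)) , (λ h → ℕ.≤-trans (bdWs′ h) (ℕ.+-monoʳ-≤ s (ℕ.n≤1+n j))) ]′ (∈-++⁻ Ws W∈)) ,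
     weight Ws Ws′ sizeWs lenWs sumWs′
  where
  q = s + suc j
  small? : U.Decidable (λ (T : Subset n) → ∣ T ∣ < q)
  small? T = ∣ T ∣ <? q
  combine : ∀ Bs₁ → (∀ {X} → X ∈ˡ Bs₁ → ∣ X ∣ ≤ q) → Bs₁ Refines Bs → ∀ Z Ws Ws′ →
            (∀ {T} → T ∈ˡ Bs₁ → ∣ T ∣ ≡ q → T ∈ˡ Ws) →
            (∀ {X} → X ∈ˡ filter small? Bs₁ → Z ⊆ X ⊎ Any (_⊆ X) Ws′) →
            ∀ {X} → X ∈ˡ Bs → Z ⊆ X ⊎ Any (_⊆ X) (Ws ++ Ws′)
  combine Bs₁ bd₁ ref₁ Z Ws Ws′ ∈Ws cover {X} X∈ with ref₁ X∈
  ... | Y , Y∈ , Y⊆X with small? Y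
  ... | no ≮q  = inj₂ (lose (∈-++⁺ˡ (∈Ws Y∈ (ℕ.≤-antisym (bd₁ Y∈) (ℕ.≮⇒≥ ≮q)))) Y⊆X)
  ... | yes <q with cover (∈-filter⁺ small? Y∈ <q)
  ... | inj₁ Z⊆Y = inj₁ (λ h → Y⊆X (Z⊆Y h))
  ... | inj₂ any = let W , W∈ , W⊆Y = find any in inj₂ (lose (∈-++⁺ʳ Ws W∈) (λ h → Y⊆X (W⊆Y h)))
  weight : ∀ Ws Ws′ → (∀ {W} → W ∈ˡ Ws → ∣ W ∣ ≡ q) → length Ws ≤ 4 * (4 * q) ^ suc j →
           ∑ Ws′ (w ∘ ∣_∣) ≤ peelBound w s j → ∑ (Ws ++ Ws′) (w ∘ ∣_∣) ≤ peelBound w s (suc j)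
  weight Ws Ws′ size len sum′ = begin
    ∑ (Ws ++ Ws′) (w ∘ ∣_∣)            ≡⟨ ∑-++ Ws Ws′ (w ∘ ∣_∣) ⟩
    ∑ Ws (w ∘ ∣_∣) + ∑ Ws′ (w ∘ ∣_∣)   ≤⟨ ℕ.+-mono-≤ (∑-mono-∈ Ws (λ W W∈ → ℕ.≤-reflexive (cong w (size W∈)))) sum′ ⟩
    ∑ Ws (λ _ → w q) + peelBound w s j ≡⟨ cong (_+ peelBound w s j) (∑-const Ws (w q)) ⟩
    length Ws * w q + peelBound w s j  ≤⟨ ℕ.+-monoˡ-≤ (peelBound w s j) (ℕ.*-monoˡ-≤ (w q) len) ⟩
    4 * (4 * q) ^ suc j * w q + peelBound w s j ∎
    where open ℕ.≤-Reasoning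

-- Supersaturation

-- Multiset inclusion in the form in which it is used, tested against every weight. It follows at
-- once from the partition identity of `greedy`, for any type of vertices.
_≼_ : List A → List A → Set
xs ≼ ys = ∀ f → ∑ xs f ≤ ∑ ys f

module Turan (_∼_ : A → A → Set) (_∼?_ : ∀ x y → Dec (x ∼ y))
             (∼-sym : ∀ {x y} → x ∼ y → y ∼ x) (∼-irrefl : ∀ {x} → ¬ (x ∼ x)) where

  Indep : List A → Set
  Indep I = ∀ {x y} → x ∈ˡ I → y ∈ˡ I → ¬ (x ∼ y)

  adjacencies : List A → ℕ
  adjacencies xs = ∑ xs (λ x → ∑ xs (λ y → 𝟙 (x ∼? y)))

  -- A vertex joins `I` unless it has a neighbour there, so `I` is a maximal independent set and
  -- everything in `R` has a neighbour in `I`. The partition is recorded as an identity between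
  -- sums.
  greedy : ∀ xs → ∃ λ I → ∃ λ R → (∀ f → ∑ xs f ≡ ∑ I f + ∑ R f) × Indep I
                        × (∀ {y} → y ∈ˡ R → ∃ λ x → x ∈ˡ I × y ∼ x) × (1 ≤ length xs → 1 ≤ length I)
  greedy []       = [] , [] , (λ f → refl) , (λ ()) , (λ ()) , λ ()
  greedy (v ∷ xs) with greedy xs
  ... | I , R , split , indep , dom , nonempty with Any.any? (v ∼?_) I
  ... | yes v∼I = I , v ∷ R , split′ , indep , dom′ , λ _ → nonempty′ v∼I
    where
    split′ : ∀ f → ∑ (v ∷ xs) f ≡ ∑ I f + ∑ (v ∷ R) f
    split′ f = trans (cong (f v +_) (split f)) (lem (f v) (∑ I f) (∑ R f))
      where
      lem : ∀ a b c → a + (b + c) ≡ b + (a + c)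
      lem = solve-∀
    dom′ : ∀ {y} → y ∈ˡ (v ∷ R) → ∃ λ x → x ∈ˡ I × y ∼ x
    dom′ (here refl) = find v∼I
    dom′ (there y∈)  = dom y∈
    nonempty′ : ∀ {I} → Any (v ∼_) I → 1 ≤ length I
    nonempty′ (here _)  = s≤s z≤n
    nonempty′ (there _) = s≤s z≤n
  ... | no v≁I = v ∷ I , R , (λ f → trans (cong (f v +_) (split f)) (sym (ℕ.+-assoc (f v) _ _))) , indep′ ,
                 (λ y∈ → let x , x∈ , y∼x = dom y∈ in x , there x∈ , y∼x) , λ _ → s≤s z≤n
    where
    indep′ : Indep (v ∷ I)
    indep′ (here refl) (here refl) = ∼-irrefl
    indep′ (here refl) (there y∈)  = λ v∼y → v≁I (lose y∈ v∼y)
    indep′ (there x∈)  (here refl) = λ x∼v → v≁I (lose x∈ (∼-sym x∼v))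
    indep′ (there x∈)  (there y∈)  = indep x∈ y∈

  -- Independent sets have at most P/Q vertices. Removing a maximal one, with i vertices, loses at
  -- least 2ρ ordered adjacencies to the ρ others, while (i + ρ)²Q exceeds ρ²Q by (2ρ + i)iQ ≤ (2ρ +
  -- i)P. The induction continues on the others.
  turan : ∀ P Q xs → (∀ I → I ≼ xs → Indep I → length I * Q ≤ P) →
          length xs * length xs * Q ≤ adjacencies xs * P + length xs * P
  turan P Q xs = go xs (ℕ.<-wellFounded (length xs))
    where
    go : ∀ xs → Acc _<_ (length xs) → (∀ I → I ≼ xs → Indep I → length I * Q ≤ P) →
         length xs * length xs * Q ≤ adjacencies xs * P + length xs * P
    go []           _         h = z≤n
    go xs@(_ ∷ _) (acc rec) h with greedy xs
    ... | I , R , split , indep , dom , nonempty = begin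
      length xs * length xs * Q            ≡⟨ cong (λ z → z * z * Q) len ⟩
      (i + ρ) * (i + ρ) * Q                ≡⟨ lem₁ i ρ Q ⟩
      ρ * ρ * Q + 2 * ρ * (i * Q) + i * (i * Q)
        ≤⟨ ℕ.+-mono-≤ (ℕ.+-mono-≤ ih (ℕ.*-monoʳ-≤ (2 * ρ) iQ≤P)) (ℕ.*-monoʳ-≤ i iQ≤P) ⟩
      adjacencies R * P + ρ * P + 2 * ρ * P + i * P  ≡⟨ lem₂ (adjacencies R) P ρ i ⟩
      (ρ + (ρ + adjacencies R)) * P + (i + ρ) * P
        ≤⟨ ℕ.+-monoˡ-≤ ((i + ρ) * P) (ℕ.*-monoˡ-≤ P edges≥) ⟩
      adjacencies xs * P + (i + ρ) * P     ≡⟨ cong (λ z → adjacencies xs * P + z * P) len ⟨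
      adjacencies xs * P + length xs * P   ∎
      where
      open ℕ.≤-Reasoning
      i = length I
      ρ = length R
      len : length xs ≡ i + ρ
      len = trans (sym (∑-one xs)) (trans (split (λ _ → 1)) (cong₂ _+_ (∑-one I) (∑-one R)))
      ρ< : ρ < length xs
      ρ< = ℕ.≤-trans (ℕ.+-monoˡ-≤ ρ (nonempty (s≤s z≤n))) (ℕ.≤-reflexive (sym len))
      iQ≤P : i * Q ≤ P
      iQ≤P = h I (λ f → ℕ.≤-trans (ℕ.m≤m+n _ _) (ℕ.≤-reflexive (sym (split f)))) indep
      ih : ρ * ρ * Q ≤ adjacencies R * P + ρ * P
      ih = go R (rec ρ<) (λ J J≼R → h J (λ f → ℕ.≤-trans (J≼R f)
             (ℕ.≤-trans (ℕ.m≤n+m _ _) (ℕ.≤-reflexive (sym (split f))))))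
      edge : A → A → ℕ
      edge x y = 𝟙 (x ∼? y)
      R→I : ρ ≤ ∑ R (λ y → ∑ I (edge y))
      R→I = ℕ.≤-trans (ℕ.≤-reflexive (sym (∑-one R))) (∑-mono-∈ R λ y y∈ → let x , x∈ , y∼x = dom y∈ in
        ℕ.≤-trans (ℕ.≤-reflexive (sym (𝟙-yes (y ∼? x) y∼x))) (∈⇒≤∑ (edge y) x∈))
      I→R : ρ ≤ ∑ I (λ x → ∑ R (edge x))
      I→R = ℕ.≤-trans (ℕ.≤-reflexive (sym (∑-one R))) (ℕ.≤-trans (∑-mono-∈ R λ y y∈ → let x , x∈ , y∼x = dom y∈ in
        ℕ.≤-trans (ℕ.≤-reflexive (sym (𝟙-yes (x ∼? y) (∼-sym y∼x)))) (∈⇒≤∑ (λ x → edge x y) x∈))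
        (ℕ.≤-reflexive (∑-swap R I (flip edge))))
      edges≥ : ρ + (ρ + adjacencies R) ≤ adjacencies xs
      edges≥ = begin
        ρ + (ρ + adjacencies R)
          ≤⟨ ℕ.+-mono-≤ I→R (ℕ.+-monoˡ-≤ (adjacencies R) R→I) ⟩
        ∑ I (λ x → ∑ R (edge x)) + (∑ R (λ x → ∑ I (edge x)) + adjacencies R)
          ≤⟨ ℕ.+-monoˡ-≤ _ (∑-mono I (λ x → ℕ.≤-trans (ℕ.m≤n+m _ _) (ℕ.≤-reflexive (sym (split (edge x)))))) ⟩
        ∑ I (λ x → ∑ xs (edge x)) + (∑ R (λ x → ∑ I (edge x)) + adjacencies R)
          ≡⟨ cong (∑ I (λ x → ∑ xs (edge x)) +_) (sym (∑-+ R (λ x → ∑ I (edge x)) (λ x → ∑ R (edge x)))) ⟩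
        ∑ I (λ x → ∑ xs (edge x)) + ∑ R (λ x → ∑ I (edge x) + ∑ R (edge x))
          ≡⟨ cong (∑ I (λ x → ∑ xs (edge x)) +_) (∑-cong R (λ x → sym (split (edge x)))) ⟩
        ∑ I (λ x → ∑ xs (edge x)) + ∑ R (λ x → ∑ xs (edge x))
          ≡⟨ split (λ x → ∑ xs (edge x)) ⟨
        adjacencies xs ∎
      lem₁ : ∀ i ρ Q → (i + ρ) * (i + ρ) * Q ≡ ρ * ρ * Q + 2 * ρ * (i * Q) + i * (i * Q)
      lem₁ = solve-∀
      lem₂ : ∀ o P ρ i → o * P + ρ * P + 2 * ρ * P + i * P ≡ (ρ + (ρ + o)) * P + (i + ρ) * P
      lem₂ = solve-∀

elements-≤ : (A : Subset n) (f : Fin n → ℕ) → ∑ (elements A) f ≤ ∑ (allFin n) f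
elements-≤ {n} A f = ∑-filter-≤ (_∈? A) (allFin n) f

-- Edges spanned by a family of r-sets

module Johnson (n r s : ℕ) (s<r : s < r) (r<n : r < n) where

  N : ℕ
  N = length (V n r)

  v : Fin N → Subset n
  v = vertex n r

  open Graph G⟨ n , r ,< s ⟩ public
  open Turan _∼_ _∼?_ symm (λ x∼x → irrefl refl x∼x) public

  ∣v∣ : ∀ i → ∣ v i ∣ ≡ r
  ∣v∣ i = All.lookup (all-filter (λ x → ∣ x ∣ ≟ r) (subsets n)) (∈-lookup i)

  w : ℕ → ℕ
  w t = (n ∸ t) C (r ∸ t)

  M : ℕ
  M = w s

  star-size : (T : Subset n) → ∣ T ∣ ≤ r → ∑ (allFin N) (λ i → 𝟙 (T ⊆? v i)) ≡ w ∣ T ∣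
  star-size T T≤r = begin
    ∑ (allFin N) (λ i → 𝟙 (T ⊆? v i))    ≡⟨ ∑-lookup (V n r) (λ x → 𝟙 (T ⊆? x)) ⟩
    ∑ (V n r) (λ x → 𝟙 (T ⊆? x))         ≡⟨ ∑-filter (λ x → ∣ x ∣ ≟ r) (subsets n) (λ x → 𝟙 (T ⊆? x)) ⟩
    ∑ (subsets n) (superset? r T)        ≡⟨ supersets-count′ T T≤r ⟩
    w ∣ T ∣                              ∎
    where open ≡-Reasoning

  -- The degree of the core `Z` in the hypergraph `A`, not a degree in the graph.
  degree : Subset n → Subset N → ℕ
  degree Z A = ∑ (elements A) (λ i → 𝟙 (Z ⊆? v i))

  outliers : Subset n → Subset N → ℕ
  outliers Z A = ∑ (elements A) (λ i → 𝟙 (¬? (Z ⊆? v i)))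

  degree+outliers : ∀ Z A → degree Z A + outliers Z A ≡ ∣ A ∣
  degree+outliers Z A = begin
    degree Z A + outliers Z A  ≡⟨ ∑-+ (elements A) (λ i → 𝟙 (Z ⊆? v i)) (λ i → 𝟙 (¬? (Z ⊆? v i))) ⟨
    ∑ (elements A) (λ i → 𝟙 (Z ⊆? v i) + 𝟙 (¬? (Z ⊆? v i)))  ≡⟨ ∑-cong (elements A) (λ i → one (Z ⊆? v i)) ⟩
    ∑ (elements A) (λ _ → 1)   ≡⟨ ∑-one (elements A) ⟩
    length (elements A)        ≡⟨ length-elements A ⟩
    ∣ A ∣ ∎
    where
    open ≡-Reasoning
    one : {P : Set} (d : Dec P) → 𝟙 d + 𝟙 (¬? d) ≡ 1
    one (yes _) = refl
    one (no _)  = refl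

  core : ∃ λ (Z : Subset n) → ∣ Z ∣ ≡ s
  core = go n s (ℕ.<⇒≤ (ℕ.<-trans s<r r<n))
    where
    go : ∀ n s → s ≤ n → ∃ λ (Z : Subset n) → ∣ Z ∣ ≡ s
    go n       zero    _         = ∅ , ∣⊥∣≡0 n
    go (suc n) (suc s) (s≤s s≤n) = let Z , Z≡s = go n s s≤n in inside ∷ Z , cong suc Z≡s

  peelWeight : ℕ
  peelWeight = peelBound w s (r ∸ s)

  -- An independent family is s-intersecting, so peeling covers it by the star of `Z` and the stars
  -- of the sets in `Ws`. Only the first can be large and is counted inside `A`; the others are
  -- counted among all r-sets, where their sizes are known.
  indep-size : ∀ A I → I ≼ elements A → Indep I →
               ∃ λ Z → ∣ Z ∣ ≡ s × length I ≤ degree Z A + peelWeight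
  indep-size A I I≼A indep =
    let Z₀ , Z₀≡s = core
        Z , Z≡s , Ws , cover , sizes , weight = peel w s (r ∸ s) Z₀ Z₀≡s (map v I) int bd
    in Z , Z≡s , bound Z Ws cover sizes weight
    where
    s+[r∸s]≡r = ℕ.m+[n∸m]≡n (ℕ.<⇒≤ s<r)
    bd : ∀ {X} → X ∈ˡ map v I → ∣ X ∣ ≤ s + (r ∸ s)
    bd X∈ with ∈-map⁻ v X∈
    ... | i , i∈ , refl = ℕ.≤-reflexive (trans (∣v∣ i) (sym s+[r∸s]≡r))
    int : Intersecting s (map v I)
    int X∈ Y∈ with ∈-map⁻ v X∈ | ∈-map⁻ v Y∈
    ... | i , i∈ , refl | j , j∈ , refl with i Fin.≟ j
    ... | yes refl = ℕ.≤-trans (ℕ.<⇒≤ s<r) (ℕ.≤-reflexive (sym (trans (cong ∣_∣ (∩-idem (v i))) (∣v∣ i))))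
    ... | no i≢j   = ℕ.≮⇒≥ (λ lt → indep i∈ j∈ (i≢j , lt))
    bound : ∀ Z Ws → (∀ {X} → X ∈ˡ map v I → Z ⊆ X ⊎ Any (_⊆ X) Ws) →
            (∀ {W} → W ∈ˡ Ws → ∣ W ∣ ≤ s + (r ∸ s)) → ∑ Ws (w ∘ ∣_∣) ≤ peelWeight →
            length I ≤ degree Z A + peelWeight
    bound Z Ws cover sizes weight = begin
      length I                        ≡⟨ ∑-one I ⟨
      ∑ I (λ _ → 1)                   ≤⟨ ∑-mono-∈ I covered ⟩
      ∑ I (λ i → f i + g i)           ≡⟨ ∑-+ I f g ⟩
      ∑ I f + ∑ I g                   ≤⟨ ℕ.+-mono-≤ (I≼A f) (ℕ.≤-trans (I≼A g) (elements-≤ A g)) ⟩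
      degree Z A + ∑ (allFin N) g     ≡⟨ cong (degree Z A +_) (∑-swap (allFin N) Ws (λ i W → 𝟙 (W ⊆? v i))) ⟩
      degree Z A + ∑ Ws (λ W → ∑ (allFin N) (λ i → 𝟙 (W ⊆? v i)))
        ≤⟨ ℕ.+-monoʳ-≤ (degree Z A) (∑-mono-∈ Ws λ W W∈ → ℕ.≤-reflexive
             (star-size W (ℕ.≤-trans (sizes W∈) (ℕ.≤-reflexive s+[r∸s]≡r)))) ⟩
      degree Z A + ∑ Ws (w ∘ ∣_∣)     ≤⟨ ℕ.+-monoʳ-≤ (degree Z A) weight ⟩
      degree Z A + peelWeight         ∎
      where
      open ℕ.≤-Reasoning
      f g : Fin N → ℕ
      f i = 𝟙 (Z ⊆? v i)
      g i = ∑ Ws (λ W → 𝟙 (W ⊆? v i))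
      covered : ∀ i → i ∈ˡ I → 1 ≤ f i + g i
      covered i i∈ with cover (∈-map⁺ v i∈)
      ... | inj₁ Z⊆ = ℕ.≤-trans (ℕ.≤-reflexive (sym (𝟙-yes (Z ⊆? v i) Z⊆))) (ℕ.m≤m+n (f i) (g i))
      ... | inj₂ any = let W , W∈ , W⊆ = find any in
        ℕ.≤-trans (ℕ.≤-reflexive (sym (𝟙-yes (W ⊆? v i) W⊆)))
        (ℕ.≤-trans (∈⇒≤∑ (λ W → 𝟙 (W ⊆? v i)) W∈) (ℕ.m≤n+m (g i) (f i)))

  -- Of the 10 parts bounding an independent set, 9 come from the star and 1 from the peeled sets.
  spread-adjacencies : ∀ A → (∀ Z → ∣ Z ∣ ≡ s → 8 * n * degree Z A ≤ 9 * (r * r * M)) →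
                       8 * n * peelWeight ≤ r * r * M →
                       ∣ A ∣ * ∣ A ∣ * (8 * n) ≤ adjacencies (elements A) * (10 * (r * r * M)) + ∣ A ∣ * (10 * (r * r * M))
  spread-adjacencies A spread light =
    subst (λ a → a * a * (8 * n) ≤ adjacencies (elements A) * P + a * P) (length-elements A)
      (turan P (8 * n) (elements A) small)
    where
    open ℕ.≤-Reasoning
    P = 10 * (r * r * M)
    lem : ∀ a b n → (a + b) * (8 * n) ≡ 8 * n * a + 8 * n * b
    lem = solve-∀
    lem₂ : ∀ x → 9 * x + x ≡ 10 * x
    lem₂ = solve-∀
    small : ∀ I → I ≼ elements A → Indep I → length I * (8 * n) ≤ P
    small I I≼A indep = let Z , Z≡s , le = indep-size A I I≼A indep in begin
      length I * (8 * n)                        ≤⟨ ℕ.*-monoˡ-≤ (8 * n) le ⟩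
      (degree Z A + peelWeight) * (8 * n)       ≡⟨ lem (degree Z A) peelWeight n ⟩
      8 * n * degree Z A + 8 * n * peelWeight   ≤⟨ ℕ.+-mono-≤ (spread Z Z≡s) light ⟩
      9 * (r * r * M) + r * r * M               ≡⟨ lem₂ (r * r * M) ⟩
      P                                         ∎

  -- A member of the star of `Z` not adjacent to `i` shares at least `s` points with `v i`. Since
  -- `Z` itself has fewer than `s` points there, it contains a point e of `v i` outside `Z` and lies
  -- in the star of `Z ∪ ⁅ e ⁆`; there are at most `r` choices of e.
  outlier-adjacencies : ∀ Z A i → ∣ Z ∣ ≡ s → ¬ (Z ⊆ v i) →
                        degree Z A ≤ ∑ (elements A) (λ j → 𝟙 (i ∼? j)) + r * w (suc s)
  outlier-adjacencies Z A i Z≡s Z⊈ = begin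
    degree Z A                                       ≤⟨ ∑-mono (elements A) hit ⟩
    ∑ (elements A) (λ j → 𝟙 (i ∼? j) + h j)          ≡⟨ ∑-+ (elements A) (λ j → 𝟙 (i ∼? j)) h ⟩
    ∑ (elements A) (λ j → 𝟙 (i ∼? j)) + ∑ (elements A) h  ≤⟨ ℕ.+-monoʳ-≤ _ (ℕ.≤-trans (elements-≤ A h) total) ⟩
    ∑ (elements A) (λ j → 𝟙 (i ∼? j)) + r * w (suc s) ∎
    where
    open ℕ.≤-Reasoning
    -- The first factor discards the points of `Z`: for them `Z ∪ ⁅ e ⁆` is `Z`, whose star is too
    -- large for the estimate.
    term : Fin N → Fin n → ℕ
    term j e = 𝟙 (¬? (e ∈? Z)) * 𝟙 (Z ∪ ⁅ e ⁆ ⊆? v j)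
    h : Fin N → ℕ
    h j = ∑ (elements (v i)) (term j)
    Z∩<s : ∣ Z ∩ v i ∣ < s
    Z∩<s = ℕ.≰⇒> λ s≤ → Z⊈ (λ {x} x∈Z → proj₂ (x∈p∩q⁻ Z (v i) (subst (x ∈_)
      (sym (⊆∧≤⇒≡ (λ h → p∩q⊆p Z (v i) h) (ℕ.≤-trans (ℕ.≤-reflexive Z≡s) s≤))) x∈Z)))
    hit : ∀ j → 𝟙 (Z ⊆? v j) ≤ 𝟙 (i ∼? j) + h j
    hit j = 𝟙≤ (Z ⊆? v j) λ Z⊆vj → go Z⊆vj
      where
      go : Z ⊆ v j → 1 ≤ 𝟙 (i ∼? j) + h j
      go Z⊆vj with ∣ v i ∩ v j ∣ <? s
      ... | yes lt = ℕ.≤-trans (ℕ.≤-reflexive (sym (𝟙-yes (i ∼? j)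
                       ((λ i≡j → Z⊈ (λ x → subst (λ k → _ ∈ v k) (sym i≡j) (Z⊆vj x))) , lt)))) (ℕ.m≤m+n _ _)
      ... | no ≮s =
        let e , e∈ , e∉ = ∃-outside (Z ∩ v i) (v i ∩ v j) (ℕ.<-≤-trans Z∩<s (ℕ.≮⇒≥ ≮s))
            e∈vi , e∈vj = x∈p∩q⁻ (v i) (v j) e∈
            e∉Z : e ∉ Z
            e∉Z e∈Z = e∉ (x∈p∩q⁺ (e∈Z , e∈vi))
            sub : Z ∪ ⁅ e ⁆ ⊆ v j
            sub x∈ = [ (λ h → Z⊆vj h) , (λ h → subst (_∈ v j) (sym (x∈⁅y⁆⇒x≡y e h)) e∈vj) ]′ (x∈p∪q⁻ Z ⁅ e ⁆ x∈)
        in ℕ.≤-trans (ℕ.≤-reflexive (sym (cong₂ _*_ (𝟙-yes (¬? (e ∈? Z)) e∉Z) (𝟙-yes (Z ∪ ⁅ e ⁆ ⊆? v j) sub))))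
           (ℕ.≤-trans (∈⇒≤∑ (term j) (∈-filter⁺ (_∈? v i) (∈-allFin e) e∈vi)) (ℕ.m≤n+m _ _))
    each : ∀ e → ∑ (allFin N) (λ j → term j e) ≤ w (suc s)
    each e with e ∈? Z
    ... | yes _   = ℕ.≤-trans (ℕ.≤-reflexive (∑-zero (allFin N))) z≤n
    ... | no  e∉Z = ℕ.≤-reflexive (trans (∑-cong (allFin N) (λ j → ℕ.*-identityˡ (𝟙 (Z ∪ ⁅ e ⁆ ⊆? v j))))
                      (trans (star-size (Z ∪ ⁅ e ⁆) (subst (_≤ r) (sym size) s<r)) (cong w size)))
      where
      size : ∣ Z ∪ ⁅ e ⁆ ∣ ≡ suc s
      size = trans (∣∪⁅⁆∣ Z e e∉Z) (cong suc Z≡s)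
    total : ∑ (allFin N) h ≤ r * w (suc s)
    total = begin
      ∑ (allFin N) h      ≡⟨ ∑-swap (allFin N) (elements (v i)) term ⟩
      ∑ (elements (v i)) (λ e → ∑ (allFin N) (λ j → term j e))  ≤⟨ ∑-mono (elements (v i)) each ⟩
      ∑ (elements (v i)) (λ _ → w (suc s))  ≡⟨ ∑-const (elements (v i)) (w (suc s)) ⟩
      length (elements (v i)) * w (suc s)   ≡⟨ cong (_* w (suc s)) (trans (length-elements (v i)) (∣v∣ i)) ⟩
      r * w (suc s) ∎

  outliers-adjacencies : ∀ Z A → ∣ Z ∣ ≡ s →
    outliers Z A * degree Z A ≤ adjacencies (elements A) + outliers Z A * (r * w (suc s))
  outliers-adjacencies Z A Z≡s = begin
    outliers Z A * degree Z A                     ≡⟨ ∑-*ʳ (degree Z A) ⟨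
    ∑ (elements A) (λ i → out i * degree Z A)     ≤⟨ ∑-mono (elements A) each ⟩
    ∑ (elements A) (λ i → nb i + out i * nn)      ≡⟨ ∑-+ (elements A) nb (λ i → out i * nn) ⟩
    adjacencies (elements A) + ∑ (elements A) (λ i → out i * nn) ≡⟨ cong (adjacencies (elements A) +_) (∑-*ʳ nn) ⟩
    adjacencies (elements A) + outliers Z A * nn  ∎
    where
    open ℕ.≤-Reasoning
    nn = r * w (suc s)
    out nb : Fin N → ℕ
    out i = 𝟙 (¬? (Z ⊆? v i))
    nb i = ∑ (elements A) (λ j → 𝟙 (i ∼? j))
    ∑-*ʳ : ∀ c → ∑ (elements A) (λ i → out i * c) ≡ outliers Z A * c
    ∑-*ʳ c = trans (∑-cong (elements A) (λ i → ℕ.*-comm (out i) c))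
      (trans (∑-*ˡ (elements A) c out) (ℕ.*-comm c (outliers Z A)))
    each : ∀ i → out i * degree Z A ≤ nb i + out i * nn
    each i with Z ⊆? v i
    ... | yes _ = z≤n
    ... | no Z⊈ = begin
      1 * degree Z A  ≡⟨ ℕ.*-identityˡ (degree Z A) ⟩
      degree Z A      ≤⟨ outlier-adjacencies Z A i Z≡s Z⊈ ⟩
      nb i + nn       ≡⟨ cong (nb i +_) (ℕ.*-identityˡ nn) ⟨
      nb i + 1 * nn   ∎

  -- This is where 9/8 comes from: an outlier misses at most `r * w (suc s)` ≤ (r²/n)M members of
  -- the star, so 1/8 of (r²/n)M remain as neighbours.
  clustered-adjacencies : ∀ Z A → ∣ Z ∣ ≡ s → 9 * (r * r * M) ≤ 8 * n * degree Z A →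
                          outliers Z A * (r * r * M) ≤ 8 * n * adjacencies (elements A)
  clustered-adjacencies Z A Z≡s heavy = ℕ.+-cancelʳ-≤ (8 * (t * X)) _ _ (begin
    t * X + 8 * (t * X)                        ≡⟨ lem₁ t X ⟩
    t * (9 * X)                                ≤⟨ ℕ.*-monoʳ-≤ t heavy ⟩
    t * (8 * n * degree Z A)                   ≡⟨ lem₂ t n (degree Z A) ⟩
    8 * n * (t * degree Z A)                   ≤⟨ ℕ.*-monoʳ-≤ (8 * n) (outliers-adjacencies Z A Z≡s) ⟩
    8 * n * (o + t * (r * w (suc s)))          ≡⟨ lem₃ n o t r (w (suc s)) ⟩
    8 * n * o + 8 * (t * (r * (n * w (suc s)))) ≤⟨ ℕ.+-monoʳ-≤ (8 * n * o) (ℕ.*-monoʳ-≤ 8 (ℕ.*-monoʳ-≤ t (ℕ.*-monoʳ-≤ r shift))) ⟩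
    8 * n * o + 8 * (t * (r * (r * M)))        ≡⟨ cong (λ z → 8 * n * o + 8 * (t * z)) (ℕ.*-assoc r r M) ⟨
    8 * n * o + 8 * (t * X)                    ∎)
    where
    open ℕ.≤-Reasoning
    t = outliers Z A
    X = r * r * M
    o = adjacencies (elements A)
    lem₁ : ∀ t x → t * x + 8 * (t * x) ≡ t * (9 * x)
    lem₁ = solve-∀
    lem₂ : ∀ t n d → t * (8 * n * d) ≡ 8 * n * (t * d)
    lem₂ = solve-∀
    lem₃ : ∀ n o t r w → 8 * n * (o + t * (r * w)) ≡ 8 * n * o + 8 * (t * (r * (n * w)))
    lem₃ = solve-∀
    shift : n * w (suc s) ≤ r * M
    shift = begin
      n * w (suc s)        ≡⟨ cong₂ (λ x y → x * w y) (sym (ℕ.*-identityʳ n)) (sym (ℕ.+-comm s 1)) ⟩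
      n ^ 1 * w (s + 1)    ≤⟨ C-shift-≤ s 1 (subst (_≤ r) (ℕ.+-comm 1 s) s<r) (ℕ.<⇒≤ r<n) ⟩
      r ^ 1 * w s          ≡⟨ cong (_* w s) (ℕ.*-identityʳ r) ⟩
      r * M                ∎

-- Spanning subgraphs: edges inside a vertex set, independence, distance to stars

𝟙*≤ : {P : Set} (d : Dec P) {a b : ℕ} → (P → a ≤ b) → 𝟙 d * a ≤ b
𝟙*≤ (yes p) {a} h = subst (_≤ _) (sym (ℕ.*-identityˡ a)) (h p)
𝟙*≤ (no _)      h = z≤n

∣tabulate∣ : ∀ {k} {P : Fin k → Set} (P? : ∀ i → Dec (P i)) →
             ∣ Vec.tabulate (λ i → does (P? i)) ∣ ≡ ∑ (allFin k) (λ i → 𝟙 (P? i))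
∣tabulate∣ {zero}  P? = refl
∣tabulate∣ {suc k} P? with P? zero
... | yes _ = cong suc (trans (∣tabulate∣ (P? ∘ suc)) (sym (∑-tabulate suc (λ i → 𝟙 (P? i)))))
... | no _  = trans (∣tabulate∣ (P? ∘ suc)) (sym (∑-tabulate suc (λ i → 𝟙 (P? i))))

∈-tabulate⁻ : ∀ {k} {P : Fin k → Set} (P? : ∀ i → Dec (P i)) {i} → i ∈ Vec.tabulate (λ i → does (P? i)) → P i
∈-tabulate⁻ P? {i} i∈ with P? i | trans (sym (Vec.lookup∘tabulate (λ i → does (P? i)) i)) (Vec.[]=⇒lookup i∈)
... | yes p | _  = p
... | no _  | ()

∈-tabulate⁺ : ∀ {k} {P : Fin k → Set} (P? : ∀ i → Dec (P i)) {i} → P i → i ∈ Vec.tabulate (λ i → does (P? i))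
∈-tabulate⁺ P? {i} p = Vec.lookup⇒[]= i _ (trans (Vec.lookup∘tabulate (λ i → does (P? i)) i) (dec-true (P? i) p))

∈-subsets : (S : Subset n) → S ∈ˡ subsets n
∈-subsets []          = here refl
∈-subsets (false ∷ S) = ∈-++⁺ˡ (∈-map⁺ (outside ∷_) (∈-subsets S))
∈-subsets (true ∷ S)  = ∈-++⁺ʳ _ (∈-map⁺ (inside ∷_) (∈-subsets S))

∃-subset : (S : Subset n) (k : ℕ) → k ≤ ∣ S ∣ → ∃ λ A → A ⊆ S × ∣ A ∣ ≡ k
∃-subset {n} S zero _ = ∅ , ⊆-min S , ∣⊥∣≡0 n
∃-subset (false ∷ S) (suc k) le = let A , A⊆S , eq = ∃-subset S (suc k) le in outside ∷ A , out⊆ A⊆S , eq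
∃-subset (true ∷ S)  (suc k) (s≤s le) = let A , A⊆S , eq = ∃-subset S k le in inside ∷ A , s⊆s A⊆S , cong suc eq

hamming : Subset n → Subset n → ℕ
hamming []          []          = 0
hamming (false ∷ A) (false ∷ B) = hamming A B
hamming (false ∷ A) (true ∷ B)  = suc (hamming A B)
hamming (true ∷ A)  (false ∷ B) = suc (hamming A B)
hamming (true ∷ A)  (true ∷ B)  = hamming A B

hamming-∩ : (A B : Subset n) → hamming A B + 2 * ∣ A ∩ B ∣ ≡ ∣ A ∣ + ∣ B ∣
hamming-∩ []          []          = refl
hamming-∩ (false ∷ A) (false ∷ B) = hamming-∩ A B
hamming-∩ (false ∷ A) (true ∷ B)  = trans (cong suc (hamming-∩ A B)) (sym (ℕ.+-suc ∣ A ∣ ∣ B ∣))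
hamming-∩ (true ∷ A)  (false ∷ B) = cong suc (hamming-∩ A B)
hamming-∩ (true ∷ A)  (true ∷ B)  = begin
  hamming A B + 2 * suc ∣ A ∩ B ∣         ≡⟨ lem (hamming A B) ∣ A ∩ B ∣ ⟩
  suc (suc (hamming A B + 2 * ∣ A ∩ B ∣)) ≡⟨ cong (λ z → suc (suc z)) (hamming-∩ A B) ⟩
  suc (suc (∣ A ∣ + ∣ B ∣))               ≡⟨ cong suc (ℕ.+-suc ∣ A ∣ ∣ B ∣) ⟨
  suc (∣ A ∣ + suc ∣ B ∣)                 ∎
  where
  open ≡-Reasoning
  lem : ∀ h a → h + 2 * suc a ≡ suc (suc (h + 2 * a))
  lem = solve-∀

module _ {N : ℕ} (G : Graph N) where
  open Graph G

  both? : (A : Subset N) (e : Fin N × Fin N) → Dec (proj₁ e ∈ A × proj₂ e ∈ A)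
  both? A (i , j) = (i ∈? A) ×-dec (j ∈? A)

  within : Subset N → Subset (length (edges G))
  within A = Vec.tabulate (λ k → does (both? A (lookup (edges G) k)))

  edge-∼ : ∀ k {i j} → lookup (edges G) k ≡ (i , j) → i ∼ j
  edge-∼ k eq = subst (λ e → proj₁ e ∼ proj₂ e) eq
    (proj₂ (All.lookup (all-filter (edge? G) (cartesianProduct (allFin N) (allFin N))) (∈-lookup k)))

  independent⇒disjoint : ∀ {A F} → Independent (spanningSubgraph G F) A → ∀ k → k ∈ F → k ∉ within A
  independent⇒disjoint {A} ind k k∈F k∈A =
    let i∈ , j∈ = ∈-tabulate⁻ (λ k → both? A (lookup (edges G) k)) k∈A
    in ind _ _ i∈ j∈ (k , k∈F , inj₁ refl)

  independent-spanning : ∀ {A} F → Independent G A → Independent (spanningSubgraph G F) A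
  independent-spanning F ind i j i∈ j∈ (k , _ , inj₁ eq) = ind i j i∈ j∈ (edge-∼ k eq)
  independent-spanning F ind i j i∈ j∈ (k , _ , inj₂ eq) = ind i j i∈ j∈ (symm (edge-∼ k eq))

  ∣within∣ : ∀ A → ∣ within A ∣ ≡ ∑ (allFin N) (λ i → ∑ (allFin N) (λ j → 𝟙 (edge? G (i , j)) * 𝟙 (both? A (i , j))))
  ∣within∣ A = begin
    ∣ within A ∣                                                     ≡⟨ ∣tabulate∣ (λ k → both? A (lookup (edges G) k)) ⟩
    ∑ (allFin (length (edges G))) (λ k → 𝟙 (both? A (lookup (edges G) k)))  ≡⟨ ∑-lookup (edges G) (λ e → 𝟙 (both? A e)) ⟩
    ∑ (edges G) (λ e → 𝟙 (both? A e))                                ≡⟨ ∑-filter (edge? G) (cartesianProduct (allFin N) (allFin N)) (λ e → 𝟙 (both? A e)) ⟩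
    ∑ (cartesianProduct (allFin N) (allFin N)) (λ e → 𝟙 (edge? G e) * 𝟙 (both? A e))
      ≡⟨ ∑-cartesianProduct (allFin N) (allFin N) (λ e → 𝟙 (edge? G e) * 𝟙 (both? A e)) ⟩
    ∑ (allFin N) (λ i → ∑ (allFin N) (λ j → 𝟙 (edge? G (i , j)) * 𝟙 (both? A (i , j)))) ∎
    where open ≡-Reasoning

  -- An ordered pair of adjacent vertices is listed among the edges in exactly one of its two
  -- orders, which accounts for the factor 2.
  adjacencies-≤ : ∀ A → ∑ (elements A) (λ i → ∑ (elements A) (λ j → 𝟙 (i ∼? j))) ≤ 2 * ∣ within A ∣
  adjacencies-≤ A = begin
    ∑ (elements A) (λ i → ∑ (elements A) (λ j → 𝟙 (i ∼? j)))
      ≡⟨ ∑-filter (_∈? A) (allFin N) (λ i → ∑ (elements A) (λ j → 𝟙 (i ∼? j))) ⟩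
    ∑ (allFin N) (λ i → 𝟙 (i ∈? A) * ∑ (elements A) (λ j → 𝟙 (i ∼? j)))
      ≤⟨ ∑-mono (allFin N) row ⟩
    ∑ (allFin N) (λ i → ∑ (allFin N) (λ j → f i j) + ∑ (allFin N) (λ j → f j i))
      ≡⟨ ∑-+ (allFin N) (λ i → ∑ (allFin N) (f i)) (λ i → ∑ (allFin N) (λ j → f j i)) ⟩
    ∑ (allFin N) (λ i → ∑ (allFin N) (f i)) + ∑ (allFin N) (λ i → ∑ (allFin N) (λ j → f j i))
      ≡⟨ cong (∑ (allFin N) (λ i → ∑ (allFin N) (f i)) +_) (∑-swap (allFin N) (allFin N) (λ i j → f j i)) ⟩
    ∑ (allFin N) (λ i → ∑ (allFin N) (f i)) + ∑ (allFin N) (λ i → ∑ (allFin N) (f i))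
      ≡⟨ cong₂ _+_ (∣within∣ A) (trans (ℕ.+-identityʳ _) (∣within∣ A)) ⟨
    2 * ∣ within A ∣ ∎
    where
    open ℕ.≤-Reasoning
    f : Fin N → Fin N → ℕ
    f i j = 𝟙 (edge? G (i , j)) * 𝟙 (both? A (i , j))
    f-one : ∀ {i j} → i Fin.< j → i ∼ j → i ∈ A → j ∈ A → 1 ≤ f i j
    f-one {i} {j} i<j i∼j i∈ j∈ = ℕ.≤-reflexive (sym (cong₂ _*_ (𝟙-yes (edge? G (i , j)) (i<j , i∼j)) (𝟙-yes (both? A (i , j)) (i∈ , j∈))))
    cell : ∀ i j → i ∈ A → 𝟙 (j ∈? A) * 𝟙 (i ∼? j) ≤ f i j + f j i
    cell i j i∈ = subst (_≤ f i j + f j i) (𝟙-× (j ∈? A) (i ∼? j)) (𝟙≤ ((j ∈? A) ×-dec (i ∼? j)) λ (j∈ , i∼j) → go j∈ i∼j)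
      where
      go : j ∈ A → i ∼ j → 1 ≤ f i j + f j i
      go j∈ i∼j with ℕ.<-cmp (toℕ i) (toℕ j)
      ... | tri< i<j _ _ = ℕ.≤-trans (f-one i<j i∼j i∈ j∈) (ℕ.m≤m+n _ _)
      ... | tri≈ _ i≡j _ = contradiction i∼j (irrefl (Fin.toℕ-injective i≡j))
      ... | tri> _ _ j<i = ℕ.≤-trans (f-one j<i (symm i∼j) j∈ i∈) (ℕ.m≤n+m _ _)
    row : ∀ i → 𝟙 (i ∈? A) * ∑ (elements A) (λ j → 𝟙 (i ∼? j)) ≤ ∑ (allFin N) (λ j → f i j) + ∑ (allFin N) (λ j → f j i)
    row i = 𝟙*≤ (i ∈? A) λ i∈ → begin
      ∑ (elements A) (λ j → 𝟙 (i ∼? j))                   ≡⟨ ∑-filter (_∈? A) (allFin N) (λ j → 𝟙 (i ∼? j)) ⟩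
      ∑ (allFin N) (λ j → 𝟙 (j ∈? A) * 𝟙 (i ∼? j))       ≤⟨ ∑-mono (allFin N) (λ j → cell i j i∈) ⟩
      ∑ (allFin N) (λ j → f i j + f j i)                  ≡⟨ ∑-+ (allFin N) (f i) (λ j → f j i) ⟩
      ∑ (allFin N) (f i) + ∑ (allFin N) (λ j → f j i)     ∎

module _ {N : ℕ} (H : Graph N) where

  α-upper : ∀ {S} → Independent H S → ∣ S ∣ ≤ α H
  α-upper {S} ind = v≤max⁺ 0 (map ∣_∣ (filter (independent? H) (subsets N)))
    (inj₂ (lose (∈-map⁺ ∣_∣ (∈-filter⁺ (independent? H) (∈-subsets S) ind)) ℕ.≤-refl))

  α-attained : ∀ {k} → k < α H → ∃ λ S → Independent H S × k < ∣ S ∣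
  α-attained {k} k<α with Any.any? (λ S → k <? ∣ S ∣) (filter (independent? H) (subsets N))
  ... | yes some = let S , S∈ , lt = find some in S , proj₂ (∈-filter⁻ (independent? H) {xs = subsets N} S∈) , lt
  ... | no none  = contradiction (max≤v⁺ z≤n (All.tabulate small)) (ℕ.<⇒≱ k<α)
    where
    small : ∀ {m} → m ∈ˡ map ∣_∣ (filter (independent? H) (subsets N)) → m ≤ k
    small m∈ with ∈-map⁻ ∣_∣ m∈
    ... | S , S∈ , refl = ℕ.≮⇒≥ (λ lt → none (lose S∈ lt))

module JohnsonSpanning (n r s : ℕ) (s<r : s < r) (r<n : r < n) where

  open Johnson n r s s<r r<n public

  J : Graph N
  J = G⟨ n , r ,< s ⟩

  star : Subset n → Subset N
  star Z = Vec.tabulate (λ i → does (Z ⊆? v i))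

  ∣star∣ : ∀ Z → ∣ Z ∣ ≡ s → ∣ star Z ∣ ≡ M
  ∣star∣ Z refl = trans (∣tabulate∣ (λ i → Z ⊆? v i)) (star-size Z (ℕ.<⇒≤ s<r))

  star-independent : ∀ Z → ∣ Z ∣ ≡ s → Independent J (star Z)
  star-independent Z Z≡s i j i∈ j∈ (_ , lt) = ℕ.<⇒≱ lt (subst (_≤ ∣ v i ∩ v j ∣) Z≡s
    (p⊆q⇒∣p∣≤∣q∣ λ x∈ → x∈p∩q⁺ (∈-tabulate⁻ (λ i → Z ⊆? v i) i∈ x∈ , ∈-tabulate⁻ (λ i → Z ⊆? v i) j∈ x∈)))

  α-spanning-≥ : ∀ F → M ≤ α (spanningSubgraph J F)
  α-spanning-≥ F = let Z , Z≡s = core in subst (_≤ α (spanningSubgraph J F)) (∣star∣ Z Z≡s)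
    (α-upper (spanningSubgraph J F) (independent-spanning J F (star-independent Z Z≡s)))

  -- Stars stay independent after edges are deleted, so the independence number can only fail by
  -- being too large. Cutting the independent set down to M + 1 vertices gives all bad families the
  -- same size.
  large-independent : ∀ F → α (spanningSubgraph J F) ≢ M →
                      ∃ λ A → ∣ A ∣ ≡ suc M × (∀ k → k ∈ F → k ∉ within J A)
  large-independent F α≢M =
    let S , ind , M<S = α-attained (spanningSubgraph J F) (ℕ.≤∧≢⇒< (α-spanning-≥ F) (α≢M ∘ sym))
        A , A⊆S , A≡  = ∃-subset S (suc M) M<S
    in A , A≡ , independent⇒disjoint J {A} (λ i j i∈ j∈ → ind i j (A⊆S i∈) (A⊆S j∈))

  ∩-star : ∀ Z A → ∣ A ∩ star Z ∣ ≡ degree Z A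
  ∩-star Z A = begin
    ∣ A ∩ star Z ∣                                        ≡⟨ ∣∣≡∑ (A ∩ star Z) ⟩
    ∑ (allFin N) (λ i → 𝟙 (i ∈? (A ∩ star Z)))            ≡⟨ ∑-cong (allFin N) (λ i → trans
        (𝟙-cong (i ∈? (A ∩ star Z)) ((i ∈? A) ×-dec (Z ⊆? v i)) (to i) (from i)) (𝟙-× (i ∈? A) (Z ⊆? v i))) ⟩
    ∑ (allFin N) (λ i → 𝟙 (i ∈? A) * 𝟙 (Z ⊆? v i))       ≡⟨ ∑-filter (_∈? A) (allFin N) (λ i → 𝟙 (Z ⊆? v i)) ⟨
    degree Z A                                            ∎
    where
    open ≡-Reasoning
    to : ∀ i → i ∈ A ∩ star Z → i ∈ A × Z ⊆ v i
    to i h = let a , b = x∈p∩q⁻ A (star Z) h in a , ∈-tabulate⁻ (λ i → Z ⊆? v i) b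
    from : ∀ i → i ∈ A × Z ⊆ v i → i ∈ A ∩ star Z
    from i (a , b) = x∈p∩q⁺ (a , ∈-tabulate⁺ (λ i → Z ⊆? v i) {i} b)

  -- `A` has one member more than the star, so t outliers leave t - 1 members of the star uncovered
  -- and the distance is 2t - 1.
  hamming-star : ∀ Z A → ∣ Z ∣ ≡ s → ∣ A ∣ ≡ suc M → suc (hamming A (star Z)) ≡ 2 * outliers Z A
  hamming-star Z A Z≡s A≡ = ℕ.+-cancelʳ-≡ (2 * d) _ _ (begin
    suc (hamming A (star Z)) + 2 * d                 ≡⟨ cong (λ z → suc (hamming A (star Z) + 2 * z)) (∩-star Z A) ⟨
    suc (hamming A (star Z) + 2 * ∣ A ∩ star Z ∣)    ≡⟨ cong suc (hamming-∩ A (star Z)) ⟩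
    suc (∣ A ∣ + ∣ star Z ∣)                         ≡⟨ cong₂ (λ x y → suc (x + y)) A≡ (∣star∣ Z Z≡s) ⟩
    suc (suc M + M)                                  ≡⟨ lem M ⟩
    2 * suc M                                        ≡⟨ cong (2 *_) (trans (degree+outliers Z A) A≡) ⟨
    2 * (d + t)                                      ≡⟨ lem₂ d t ⟩
    2 * t + 2 * d                                    ∎)
    where
    open ≡-Reasoning
    d = degree Z A
    t = outliers Z A
    lem : ∀ m → suc (suc m + m) ≡ 2 * suc m
    lem = solve-∀
    lem₂ : ∀ d t → 2 * (d + t) ≡ 2 * t + 2 * d
    lem₂ = solve-∀

-- Random subsets

module ∑ℚ = ListSum ℚ._+_ ℚ._*_ 0ℚ 1ℚ (IsCommutativeRing.isCommutativeSemiring ℚ.+-*-isCommutativeRing) ℚ._≤_ ℚ.≤-refl ℚ.+-mono-≤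

infixr 8 _^ℚ_

_^ℚ_ : ℚ → ℕ → ℚ
x ^ℚ zero  = 1ℚ
x ^ℚ suc k = x ℚ.* x ^ℚ k

0≤1ℚ : 0ℚ ℚ.≤ 1ℚ
0≤1ℚ = ℚ.nonNegative⁻¹ 1ℚ

*-monoˡ : ∀ {x y} z → 0ℚ ℚ.≤ z → x ℚ.≤ y → z ℚ.* x ℚ.≤ z ℚ.* y
*-monoˡ z 0≤z = ℚ.*-monoˡ-≤-nonNeg z {{ℚ.nonNegative 0≤z}}

*-monoʳ : ∀ {x y} z → 0ℚ ℚ.≤ z → x ℚ.≤ y → x ℚ.* z ℚ.≤ y ℚ.* z
*-monoʳ z 0≤z = ℚ.*-monoʳ-≤-nonNeg z {{ℚ.nonNegative 0≤z}}

*-mono : ∀ {w x y z} → 0ℚ ℚ.≤ w → 0ℚ ℚ.≤ z → w ℚ.≤ x → y ℚ.≤ z → w ℚ.* y ℚ.≤ x ℚ.* z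
*-mono {w} {x} {y} {z} 0≤w 0≤z w≤x y≤z = ℚ.≤-trans (*-monoˡ w 0≤w y≤z) (*-monoʳ z 0≤z w≤x)

0≤* : ∀ {x y} → 0ℚ ℚ.≤ x → 0ℚ ℚ.≤ y → 0ℚ ℚ.≤ x ℚ.* y
0≤* {x} {y} 0≤x 0≤y = subst (ℚ._≤ x ℚ.* y) (ℚ.*-zeroʳ x) (*-monoˡ x 0≤x 0≤y)

0≤^ : ∀ {x} k → 0ℚ ℚ.≤ x → 0ℚ ℚ.≤ x ^ℚ k
0≤^ zero    0≤x = 0≤1ℚ
0≤^ (suc k) 0≤x = 0≤* 0≤x (0≤^ k 0≤x)

≤-+ˡ : ∀ {x} y → 0ℚ ℚ.≤ y → x ℚ.≤ y ℚ.+ x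
≤-+ˡ {x} y 0≤y = subst (ℚ._≤ y ℚ.+ x) (ℚ.+-identityˡ x) (ℚ.+-monoˡ-≤ x 0≤y)

≤-+ʳ : ∀ {x} y → 0ℚ ℚ.≤ y → x ℚ.≤ x ℚ.+ y
≤-+ʳ {x} y 0≤y = subst (ℚ._≤ x ℚ.+ y) (ℚ.+-identityʳ x) (ℚ.+-monoʳ-≤ x 0≤y)

0≤+ : ∀ {x y} → 0ℚ ℚ.≤ x → 0ℚ ℚ.≤ y → 0ℚ ℚ.≤ x ℚ.+ y
0≤+ {y = y} 0≤x 0≤y = ℚ.≤-trans 0≤x (≤-+ʳ y 0≤y)

≤⇒0≤- : ∀ {x y} → x ℚ.≤ y → 0ℚ ℚ.≤ y ℚ.- x
≤⇒0≤- {x} {y} x≤y = subst (ℚ._≤ y ℚ.- x) (ℚ.+-inverseʳ x) (ℚ.+-monoˡ-≤ (ℚ.- x) x≤y)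

0≤∑ : ∀ (xs : List A) {f : A → ℚ} → (∀ x → 0ℚ ℚ.≤ f x) → 0ℚ ℚ.≤ ∑ℚ.∑ xs f
0≤∑ []       h = ℚ.≤-refl
0≤∑ (x ∷ xs) h = 0≤+ (h x) (0≤∑ xs h)

∈⇒≤∑ℚ : ∀ {x : A} {xs} {f : A → ℚ} → (∀ x → 0ℚ ℚ.≤ f x) → x ∈ˡ xs → f x ℚ.≤ ∑ℚ.∑ xs f
∈⇒≤∑ℚ {xs = _ ∷ xs} h (here refl)  = ≤-+ʳ _ (0≤∑ xs h)
∈⇒≤∑ℚ {xs = y ∷ xs} h (there x∈) = ℚ.≤-trans (∈⇒≤∑ℚ h x∈) (≤-+ˡ _ (h y))

0≤𝟙 : {P : Set} (d : Dec P) → 0ℚ ℚ.≤ ∑ℚ.𝟙 d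
0≤𝟙 (yes _) = 0≤1ℚ
0≤𝟙 (no _)  = ℚ.≤-refl

∑ℚ-subsets : ∀ {n} (f : Subset (suc n) → ℚ) →
            ∑ℚ.∑ (subsets (suc n)) f ≡ ∑ℚ.∑ (subsets n) (f ∘ (outside ∷_)) ℚ.+ ∑ℚ.∑ (subsets n) (f ∘ (inside ∷_))
∑ℚ-subsets {n} f = trans (∑ℚ.∑-++ (map (outside ∷_) (subsets n)) _ f)
  (cong₂ ℚ._+_ (∑ℚ.∑-map (outside ∷_) (subsets n) f) (∑ℚ.∑-map (inside ∷_) (subsets n) f))

weight : ℚ → Subset n → ℚ
weight q F = q ^ℚ ∣ F ∣ ℚ.* (1ℚ ℚ.- q) ^ℚ ∣ ∁ F ∣

0≤weight : ∀ {q} → 0ℚ ℚ.≤ q → q ℚ.≤ 1ℚ → (F : Subset n) → 0ℚ ℚ.≤ weight q F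
0≤weight 0≤q q≤1 F = 0≤* (0≤^ ∣ F ∣ 0≤q) (0≤^ ∣ ∁ F ∣ (≤⇒0≤- q≤1))

-- The indicator of disjointness, defined by recursion so that the sum over `F` splits off one
-- coordinate at a time.
avoid : Subset n → Subset n → ℚ
avoid []          []          = 1ℚ
avoid (false ∷ U) (_ ∷ F)     = avoid U F
avoid (true ∷ U)  (false ∷ F) = avoid U F
avoid (true ∷ U)  (true ∷ F)  = 0ℚ

0≤avoid : (U F : Subset n) → 0ℚ ℚ.≤ avoid U F
0≤avoid []          []          = 0≤1ℚ
0≤avoid (false ∷ U) (_ ∷ F)     = 0≤avoid U F
0≤avoid (true ∷ U)  (false ∷ F) = 0≤avoid U F
0≤avoid (true ∷ U)  (true ∷ F)  = ℚ.≤-refl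

disjoint⇒avoid : (U F : Subset n) → (∀ k → k ∈ F → k ∉ U) → avoid U F ≡ 1ℚ
disjoint⇒avoid []          []          h = refl
disjoint⇒avoid (false ∷ U) (_ ∷ F)     h = disjoint⇒avoid U F (λ k k∈F k∈U → h (suc k) (there k∈F) (there k∈U))
disjoint⇒avoid (true ∷ U)  (false ∷ F) h = disjoint⇒avoid U F (λ k k∈F k∈U → h (suc k) (there k∈F) (there k∈U))
disjoint⇒avoid (true ∷ U)  (true ∷ F)  h = contradiction here (h zero here)

-- The coordinates are independent: one in `U` contributes only the weight 1 - q of being absent,
-- any other contributes (1 - q) + q = 1.
∑-avoid : ∀ q (U : Subset n) → ∑ℚ.∑ (subsets n) (λ F → avoid U F ℚ.* weight q F) ≡ (1ℚ ℚ.- q) ^ℚ ∣ U ∣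
∑-avoid q [] = refl
∑-avoid {suc n} q (false ∷ U) = begin
  ∑ℚ.∑ (subsets (suc n)) (λ F → avoid (false ∷ U) F ℚ.* weight q F)
    ≡⟨ ∑ℚ-subsets (λ F → avoid (false ∷ U) F ℚ.* weight q F) ⟩
  ∑ℚ.∑ (subsets n) (λ F → avoid U F ℚ.* (q ^ℚ ∣ F ∣ ℚ.* (x ℚ.* x ^ℚ ∣ ∁ F ∣))) ℚ.+
  ∑ℚ.∑ (subsets n) (λ F → avoid U F ℚ.* ((q ℚ.* q ^ℚ ∣ F ∣) ℚ.* x ^ℚ ∣ ∁ F ∣))
    ≡⟨ cong₂ ℚ._+_ (∑ℚ.∑-cong (subsets n) (λ F → out (avoid U F) (q ^ℚ ∣ F ∣) (x ^ℚ ∣ ∁ F ∣) x))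
                   (∑ℚ.∑-cong (subsets n) (λ F → inn (avoid U F) (q ^ℚ ∣ F ∣) (x ^ℚ ∣ ∁ F ∣) q)) ⟩
  ∑ℚ.∑ (subsets n) (λ F → x ℚ.* f F) ℚ.+ ∑ℚ.∑ (subsets n) (λ F → q ℚ.* f F)
    ≡⟨ cong₂ ℚ._+_ (∑ℚ.∑-*ˡ (subsets n) x f) (∑ℚ.∑-*ˡ (subsets n) q f) ⟩
  x ℚ.* ∑ℚ.∑ (subsets n) f ℚ.+ q ℚ.* ∑ℚ.∑ (subsets n) f
    ≡⟨ join q (∑ℚ.∑ (subsets n) f) ⟩
  ∑ℚ.∑ (subsets n) f
    ≡⟨ ∑-avoid q U ⟩
  x ^ℚ ∣ U ∣ ∎
  where
  open ≡-Reasoning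
  x = 1ℚ ℚ.- q
  f : Subset n → ℚ
  f F = avoid U F ℚ.* weight q F
  open +-*-Solver
  out : ∀ a b c x → a ℚ.* (b ℚ.* (x ℚ.* c)) ≡ x ℚ.* (a ℚ.* (b ℚ.* c))
  out = solve 4 (λ a b c x → a :* (b :* (x :* c)) := x :* (a :* (b :* c))) refl
  inn : ∀ a b c q → a ℚ.* ((q ℚ.* b) ℚ.* c) ≡ q ℚ.* (a ℚ.* (b ℚ.* c))
  inn = solve 4 (λ a b c q → a :* ((q :* b) :* c) := q :* (a :* (b :* c))) refl
  join : ∀ q y → (1ℚ ℚ.- q) ℚ.* y ℚ.+ q ℚ.* y ≡ y
  join = solve 2 (λ q y → (con 1ℚ :- q) :* y :+ q :* y := y) refl
∑-avoid {suc n} q (true ∷ U) = begin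
  ∑ℚ.∑ (subsets (suc n)) (λ F → avoid (true ∷ U) F ℚ.* weight q F)
    ≡⟨ ∑ℚ-subsets (λ F → avoid (true ∷ U) F ℚ.* weight q F) ⟩
  ∑ℚ.∑ (subsets n) (λ F → avoid U F ℚ.* (q ^ℚ ∣ F ∣ ℚ.* (x ℚ.* x ^ℚ ∣ ∁ F ∣))) ℚ.+
  ∑ℚ.∑ (subsets n) (λ F → 0ℚ ℚ.* ((q ℚ.* q ^ℚ ∣ F ∣) ℚ.* x ^ℚ ∣ ∁ F ∣))
    ≡⟨ cong₂ ℚ._+_ (∑ℚ.∑-cong (subsets n) (λ F → out (avoid U F) (q ^ℚ ∣ F ∣) (x ^ℚ ∣ ∁ F ∣) x))
                   (trans (∑ℚ.∑-cong (subsets n) (λ F → ℚ.*-zeroˡ ((q ℚ.* q ^ℚ ∣ F ∣) ℚ.* x ^ℚ ∣ ∁ F ∣))) (∑ℚ.∑-zero (subsets n))) ⟩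
  ∑ℚ.∑ (subsets n) (λ F → x ℚ.* f F) ℚ.+ 0ℚ
    ≡⟨ trans (ℚ.+-identityʳ _) (∑ℚ.∑-*ˡ (subsets n) x f) ⟩
  x ℚ.* ∑ℚ.∑ (subsets n) f
    ≡⟨ cong (x ℚ.*_) (∑-avoid q U) ⟩
  x ℚ.* x ^ℚ ∣ U ∣ ∎
  where
  open ≡-Reasoning
  x = 1ℚ ℚ.- q
  f : Subset n → ℚ
  f F = avoid U F ℚ.* weight q F
  open +-*-Solver
  out : ∀ a b c x → a ℚ.* (b ℚ.* (x ℚ.* c)) ≡ x ℚ.* (a ℚ.* (b ℚ.* c))
  out = solve 4 (λ a b c x → a :* (b :* (x :* c)) := x :* (a :* (b :* c))) refl

∑-weight : ∀ q n → ∑ℚ.∑ (subsets n) (weight q) ≡ 1ℚ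
∑-weight q n = begin
  ∑ℚ.∑ (subsets n) (weight q)  ≡⟨ ∑ℚ.∑-cong (subsets n) (λ F → sym (trans
      (cong (ℚ._* weight q F) (disjoint⇒avoid ∅ F (λ k _ → ∉⊥))) (ℚ.*-identityˡ (weight q F)))) ⟩
  ∑ℚ.∑ (subsets n) (λ F → avoid ∅ F ℚ.* weight q F)  ≡⟨ ∑-avoid q (∅ {n}) ⟩
  (1ℚ ℚ.- q) ^ℚ ∣ ∅ {n} ∣  ≡⟨ cong ((1ℚ ℚ.- q) ^ℚ_) (∣⊥∣≡0 n) ⟩
  1ℚ ∎
  where open ≡-Reasoning

-- The generating function of the distance factorises: every coordinate either agrees with `σ`,
-- giving 1, or differs, giving `z`.
∑-^hamming : ∀ z (σ : Subset n) → ∑ℚ.∑ (subsets n) (λ A → z ^ℚ hamming A σ) ≡ (1ℚ ℚ.+ z) ^ℚ n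
∑-^hamming z [] = refl
∑-^hamming {suc n} z (false ∷ σ) = begin
  ∑ℚ.∑ (subsets (suc n)) (λ A → z ^ℚ hamming A (false ∷ σ))  ≡⟨ ∑ℚ-subsets (λ A → z ^ℚ hamming A (false ∷ σ)) ⟩
  S ℚ.+ ∑ℚ.∑ (subsets n) (λ A → z ℚ.* z ^ℚ hamming A σ)      ≡⟨ cong (S ℚ.+_) (∑ℚ.∑-*ˡ (subsets n) z (λ A → z ^ℚ hamming A σ)) ⟩
  S ℚ.+ z ℚ.* S               ≡⟨ solve 2 (λ s z → s :+ z :* s := (con 1ℚ :+ z) :* s) refl S z ⟩
  (1ℚ ℚ.+ z) ℚ.* S            ≡⟨ cong ((1ℚ ℚ.+ z) ℚ.*_) (∑-^hamming z σ) ⟩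
  (1ℚ ℚ.+ z) ^ℚ suc n         ∎
  where
  open ≡-Reasoning
  open +-*-Solver
  S = ∑ℚ.∑ (subsets n) (λ A → z ^ℚ hamming A σ)
∑-^hamming {suc n} z (true ∷ σ) = begin
  ∑ℚ.∑ (subsets (suc n)) (λ A → z ^ℚ hamming A (true ∷ σ))  ≡⟨ ∑ℚ-subsets (λ A → z ^ℚ hamming A (true ∷ σ)) ⟩
  ∑ℚ.∑ (subsets n) (λ A → z ℚ.* z ^ℚ hamming A σ) ℚ.+ S      ≡⟨ cong (ℚ._+ S) (∑ℚ.∑-*ˡ (subsets n) z (λ A → z ^ℚ hamming A σ)) ⟩
  z ℚ.* S ℚ.+ S               ≡⟨ solve 2 (λ s z → z :* s :+ s := (con 1ℚ :+ z) :* s) refl S z ⟩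
  (1ℚ ℚ.+ z) ℚ.* S            ≡⟨ cong ((1ℚ ℚ.+ z) ℚ.*_) (∑-^hamming z σ) ⟩
  (1ℚ ℚ.+ z) ^ℚ suc n         ∎
  where
  open ≡-Reasoning
  open +-*-Solver
  S = ∑ℚ.∑ (subsets n) (λ A → z ^ℚ hamming A σ)

hamming-∅ : (A : Subset n) → hamming A ∅ ≡ ∣ A ∣
hamming-∅ []          = refl
hamming-∅ (false ∷ A) = hamming-∅ A
hamming-∅ (true ∷ A)  = cong suc (hamming-∅ A)

probability : ℚ → {P : U.Pred (Subset n) 0ℓ} → U.Decidable P → ℚ
probability {n} q P? = ∑ℚ.∑ (filter P? (subsets n)) (weight q)

probability-≤1 : ∀ {q} → 0ℚ ℚ.≤ q → q ℚ.≤ 1ℚ → {P : U.Pred (Subset n) 0ℓ} (P? : U.Decidable P) →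
                 probability q P? ℚ.≤ 1ℚ
probability-≤1 {n} {q} 0≤q q≤1 P? = ℚ.≤-trans (go (subsets n)) (ℚ.≤-reflexive (∑-weight q n))
  where
  go : ∀ xs → ∑ℚ.∑ (filter P? xs) (weight q) ℚ.≤ ∑ℚ.∑ xs (weight q)
  go []       = ℚ.≤-refl
  go (x ∷ xs) with does (P? x)
  ... | true  = ℚ.+-monoʳ-≤ (weight q x) (go xs)
  ... | false = ℚ.≤-trans (go xs) (≤-+ˡ (weight q x) (0≤weight 0≤q q≤1 x))

-- The weight of an edge set violating `P` is dominated by the term of its witness `A`.
-- Interchanging the sums leaves, for each `A`, the probability that no edge of `U A` is kept.
union-bound : ∀ {n N q} → 0ℚ ℚ.≤ q → q ℚ.≤ 1ℚ → {P : U.Pred (Subset n) 0ℓ} (P? : U.Decidable P)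
  {C : U.Pred (Subset N) 0ℓ} (C? : U.Decidable C) (U : Subset N → Subset n) →
  (∀ F → ¬ P F → ∃ λ A → C A × (∀ k → k ∈ F → k ∉ U A)) →
  1ℚ ℚ.≤ probability q P? ℚ.+ ∑ℚ.∑ (subsets N) (λ A → ∑ℚ.𝟙 (C? A) ℚ.* (1ℚ ℚ.- q) ^ℚ ∣ U A ∣)
union-bound {n} {N} {q} 0≤q q≤1 P? C? U bad = begin
  1ℚ                                   ≡⟨ ∑-weight q n ⟨
  ∑ℚ.∑ (subsets n) (weight q)          ≤⟨ ∑ℚ.∑-mono (subsets n) each ⟩
  ∑ℚ.∑ (subsets n) (λ F → g F ℚ.+ h F) ≡⟨ ∑ℚ.∑-+ (subsets n) g h ⟩
  ∑ℚ.∑ (subsets n) g ℚ.+ ∑ℚ.∑ (subsets n) h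
    ≡⟨ cong₂ ℚ._+_ (sym (∑ℚ.∑-filter P? (subsets n) (weight q))) swap ⟩
  probability q P? ℚ.+ ∑ℚ.∑ (subsets N) (λ A → ∑ℚ.𝟙 (C? A) ℚ.* (1ℚ ℚ.- q) ^ℚ ∣ U A ∣) ∎
  where
  open ℚ.≤-Reasoning
  c : Subset N → Subset n → ℚ
  c A F = ∑ℚ.𝟙 (C? A) ℚ.* (avoid (U A) F ℚ.* weight q F)
  g h : Subset n → ℚ
  g F = ∑ℚ.𝟙 (P? F) ℚ.* weight q F
  h F = ∑ℚ.∑ (subsets N) (λ A → c A F)
  0≤w : ∀ F → 0ℚ ℚ.≤ weight q F
  0≤w = 0≤weight 0≤q q≤1
  0≤c : ∀ F A → 0ℚ ℚ.≤ c A F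
  0≤c F A = 0≤* (0≤𝟙 (C? A)) (0≤* (0≤avoid (U A) F) (0≤w F))
  each : ∀ F → weight q F ℚ.≤ g F ℚ.+ h F
  each F = go (P? F)
    where
    go : (d : Dec _) → weight q F ℚ.≤ ∑ℚ.𝟙 d ℚ.* weight q F ℚ.+ h F
    go (yes _) = ℚ.≤-trans (ℚ.≤-reflexive (sym (ℚ.*-identityˡ (weight q F)))) (≤-+ʳ (h F) (0≤∑ (subsets N) (0≤c F)))
    go (no ¬p) = let A , CA , dis = bad F ¬p in begin
      weight q F    ≡⟨ trans (ℚ.*-identityˡ _) (ℚ.*-identityˡ _) ⟨
      1ℚ ℚ.* (1ℚ ℚ.* weight q F)  ≡⟨ cong₂ (λ x y → x ℚ.* (y ℚ.* weight q F)) (∑ℚ.𝟙-yes (C? A) CA) (disjoint⇒avoid (U A) F dis) ⟨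
      c A F         ≤⟨ ∈⇒≤∑ℚ (0≤c F) (∈-subsets A) ⟩
      h F           ≤⟨ ≤-+ˡ _ (ℚ.≤-reflexive (sym (ℚ.*-zeroˡ (weight q F)))) ⟩
      0ℚ ℚ.* weight q F ℚ.+ h F ∎
  swap : ∑ℚ.∑ (subsets n) h ≡ ∑ℚ.∑ (subsets N) (λ A → ∑ℚ.𝟙 (C? A) ℚ.* (1ℚ ℚ.- q) ^ℚ ∣ U A ∣)
  swap = trans (∑ℚ.∑-swap (subsets n) (subsets N) (λ F A → c A F))
    (∑ℚ.∑-cong (subsets N) (λ A → trans (∑ℚ.∑-*ˡ (subsets n) (∑ℚ.𝟙 (C? A)) (λ F → avoid (U A) F ℚ.* weight q F))
      (cong (∑ℚ.𝟙 (C? A) ℚ.*_) (∑-avoid q (U A)))))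

ι : ℕ → ℚ
ι zero    = 0ℚ
ι (suc k) = 1ℚ ℚ.+ ι k

0≤ι : ∀ k → 0ℚ ℚ.≤ ι k
0≤ι zero    = ℚ.≤-refl
0≤ι (suc k) = 0≤+ 0≤1ℚ (0≤ι k)

ι-+ : ∀ a b → ι (a + b) ≡ ι a ℚ.+ ι b
ι-+ zero    b = sym (ℚ.+-identityˡ (ι b))
ι-+ (suc a) b = trans (cong (1ℚ ℚ.+_) (ι-+ a b)) (sym (ℚ.+-assoc 1ℚ (ι a) (ι b)))

ι-* : ∀ a b → ι (a * b) ≡ ι a ℚ.* ι b
ι-* zero    b = sym (ℚ.*-zeroˡ (ι b))
ι-* (suc a) b = trans (ι-+ b (a * b)) (trans (cong (ι b ℚ.+_) (ι-* a b))
  (solve 2 (λ x y → y :+ x :* y := (con 1ℚ :+ x) :* y) refl (ι a) (ι b)))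
  where open +-*-Solver

ι-mono : ∀ {a b} → a ≤ b → ι a ℚ.≤ ι b
ι-mono {b = b} z≤n = 0≤ι b
ι-mono (s≤s a≤b)   = ℚ.+-monoʳ-≤ 1ℚ (ι-mono a≤b)

ι-cancel-≤ : ∀ {a b} → ι a ℚ.≤ ι b → a ≤ b
ι-cancel-≤ {a} {b} le with a ≤? b
... | yes a≤b = a≤b
... | no  a≰b = ⊥-elim (ℚ.<-irrefl refl (ℚ.<-≤-trans b<1+b (ℚ.≤-trans (ι-mono (ℕ.≰⇒> a≰b)) le)))
  where
  b<1+b : ι b ℚ.< 1ℚ ℚ.+ ι b
  b<1+b = subst (ℚ._< 1ℚ ℚ.+ ι b) (ℚ.+-identityˡ (ι b)) (ℚ.+-monoˡ-< (ι b) (ℚ.positive⁻¹ 1ℚ))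

^ℚ-+ : ∀ x j k → x ^ℚ (j + k) ≡ x ^ℚ j ℚ.* x ^ℚ k
^ℚ-+ x zero    k = sym (ℚ.*-identityˡ _)
^ℚ-+ x (suc j) k = trans (cong (x ℚ.*_) (^ℚ-+ x j k)) (sym (ℚ.*-assoc x _ _))

^ℚ-* : ∀ x j k → x ^ℚ (j * k) ≡ (x ^ℚ k) ^ℚ j
^ℚ-* x zero    k = refl
^ℚ-* x (suc j) k = trans (^ℚ-+ x k (j * k)) (cong (x ^ℚ k ℚ.*_) (^ℚ-* x j k))

^ℚ-distrib : ∀ x y k → (x ℚ.* y) ^ℚ k ≡ x ^ℚ k ℚ.* y ^ℚ k
^ℚ-distrib x y zero    = refl
^ℚ-distrib x y (suc k) = trans (cong ((x ℚ.* y) ℚ.*_) (^ℚ-distrib x y k))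
  (solve 4 (λ x y a b → (x :* y) :* (a :* b) := (x :* a) :* (y :* b)) refl x y (x ^ℚ k) (y ^ℚ k))
  where open +-*-Solver

^ℚ-mono : ∀ {x y} k → 0ℚ ℚ.≤ x → x ℚ.≤ y → x ^ℚ k ℚ.≤ y ^ℚ k
^ℚ-mono zero    0≤x x≤y = ℚ.≤-refl
^ℚ-mono (suc k) 0≤x x≤y = *-mono 0≤x (0≤^ k (ℚ.≤-trans 0≤x x≤y)) x≤y (^ℚ-mono k 0≤x x≤y)

1^ℚ : ∀ k → 1ℚ ^ℚ k ≡ 1ℚ
1^ℚ zero    = refl
1^ℚ (suc k) = trans (ℚ.*-identityˡ _) (1^ℚ k)

^ℚ-anti : ∀ {x j k} → 0ℚ ℚ.≤ x → x ℚ.≤ 1ℚ → j ≤ k → x ^ℚ k ℚ.≤ x ^ℚ j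
^ℚ-anti {x} {j} {k} 0≤x x≤1 j≤k = begin
  x ^ℚ k                       ≡⟨ cong (x ^ℚ_) (ℕ.m+[n∸m]≡n j≤k) ⟨
  x ^ℚ (j + (k ∸ j))           ≡⟨ ^ℚ-+ x j (k ∸ j) ⟩
  x ^ℚ j ℚ.* x ^ℚ (k ∸ j)      ≤⟨ *-monoˡ (x ^ℚ j) (0≤^ j 0≤x) (subst (x ^ℚ (k ∸ j) ℚ.≤_) (1^ℚ (k ∸ j)) (^ℚ-mono (k ∸ j) 0≤x x≤1)) ⟩
  x ^ℚ j ℚ.* 1ℚ                ≡⟨ ℚ.*-identityʳ _ ⟩
  x ^ℚ j                       ∎
  where open ℚ.≤-Reasoning

0≤½ : 0ℚ ℚ.≤ ½
0≤½ = ℚ.nonNegative⁻¹ ½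

½≤1 : ½ ℚ.≤ 1ℚ
½≤1 = ℚ.≤-trans (≤-+ʳ ½ 0≤½) (ℚ.≤-reflexive refl)

ι2^*½^ : ∀ k → ι (2 ^ k) ℚ.* ½ ^ℚ k ≡ 1ℚ
ι2^*½^ zero    = refl
ι2^*½^ (suc k) = begin
  ι (2 * 2 ^ k) ℚ.* (½ ℚ.* ½ ^ℚ k)        ≡⟨ cong (ℚ._* (½ ℚ.* ½ ^ℚ k)) (ι-* 2 (2 ^ k)) ⟩
  (ι 2 ℚ.* ι (2 ^ k)) ℚ.* (½ ℚ.* ½ ^ℚ k)  ≡⟨ solve 4 (λ t x h y → (t :* x) :* (h :* y) := (t :* h) :* (x :* y)) refl (ι 2) (ι (2 ^ k)) ½ (½ ^ℚ k) ⟩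
  (ι 2 ℚ.* ½) ℚ.* (ι (2 ^ k) ℚ.* ½ ^ℚ k)  ≡⟨ cong₂ ℚ._*_ {x = ι 2 ℚ.* ½} {y = 1ℚ} refl (ι2^*½^ k) ⟩
  1ℚ ∎
  where
  open ≡-Reasoning
  open +-*-Solver

-- Division-free form of (1 - q)^k ≤ 1/(1 + kq). The induction rests on (1 - q)(1 + (k + 1)q) = 1 +
-- kq - (k + 1)q².
bernoulli : ∀ {q} k → 0ℚ ℚ.≤ q → q ℚ.≤ 1ℚ → (1ℚ ℚ.- q) ^ℚ k ℚ.* (1ℚ ℚ.+ ι k ℚ.* q) ℚ.≤ 1ℚ
bernoulli {q} zero    0≤q q≤1 = ℚ.≤-reflexive (trans (ℚ.*-identityˡ _) (trans (cong (1ℚ ℚ.+_) (ℚ.*-zeroˡ q)) (ℚ.+-identityʳ 1ℚ)))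
bernoulli {q} (suc k) 0≤q q≤1 = begin
  (x ℚ.* x ^ℚ k) ℚ.* (1ℚ ℚ.+ (1ℚ ℚ.+ ι k) ℚ.* q)
    ≤⟨ ≤-+ʳ _ (0≤* (0≤^ k 0≤x) (0≤* (0≤* 0≤q 0≤q) (0≤+ 0≤1ℚ (0≤ι k)))) ⟩
  (x ℚ.* x ^ℚ k) ℚ.* (1ℚ ℚ.+ (1ℚ ℚ.+ ι k) ℚ.* q) ℚ.+ x ^ℚ k ℚ.* ((q ℚ.* q) ℚ.* (1ℚ ℚ.+ ι k))
    ≡⟨ lem q (ι k) (x ^ℚ k) ⟩
  x ^ℚ k ℚ.* (1ℚ ℚ.+ ι k ℚ.* q)
    ≤⟨ bernoulli k 0≤q q≤1 ⟩
  1ℚ ∎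
  where
  open ℚ.≤-Reasoning
  open +-*-Solver
  x = 1ℚ ℚ.- q
  0≤x = ≤⇒0≤- q≤1
  lem : ∀ q κ y → ((1ℚ ℚ.- q) ℚ.* y) ℚ.* (1ℚ ℚ.+ (1ℚ ℚ.+ κ) ℚ.* q) ℚ.+ y ℚ.* ((q ℚ.* q) ℚ.* (1ℚ ℚ.+ κ)) ≡ y ℚ.* (1ℚ ℚ.+ κ ℚ.* q)
  lem = solve 3 (λ q κ y → ((con 1ℚ :- q) :* y) :* (con 1ℚ :+ (con 1ℚ :+ κ) :* q) :+ y :* ((q :* q) :* (con 1ℚ :+ κ)) := y :* (con 1ℚ :+ κ :* q)) refl

-- As aq ≥ 1, Bernoulli gives (1 - q)^a ≤ 1/(1 + aq) ≤ 1/2. Every block of `a` missing edges thus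
-- costs a factor 1/2, and from here on only powers of 1/2 have to be compared.
decay : ∀ {q a y e} → 0ℚ ℚ.≤ q → q ℚ.≤ 1ℚ → 1ℚ ℚ.≤ ι a ℚ.* q → a * y ≤ e → (1ℚ ℚ.- q) ^ℚ e ℚ.≤ ½ ^ℚ y
decay {q} {a} {y} {e} 0≤q q≤1 1≤aq ay≤e = begin
  x ^ℚ e             ≤⟨ ^ℚ-anti 0≤x x≤1 (ℕ.≤-trans (ℕ.≤-reflexive (ℕ.*-comm y a)) ay≤e) ⟩
  x ^ℚ (y * a)       ≡⟨ ^ℚ-* x y a ⟩
  (x ^ℚ a) ^ℚ y      ≤⟨ ^ℚ-mono y (0≤^ a 0≤x) half ⟩
  ½ ^ℚ y             ∎
  where
  open ℚ.≤-Reasoning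
  x = 1ℚ ℚ.- q
  0≤x = ≤⇒0≤- q≤1
  x≤1 : x ℚ.≤ 1ℚ
  x≤1 = ℚ.≤-trans (ℚ.+-monoʳ-≤ 1ℚ (ℚ.neg-antimono-≤ 0≤q)) (ℚ.≤-reflexive (ℚ.+-identityʳ 1ℚ))
  half : x ^ℚ a ℚ.≤ ½
  half = begin
    x ^ℚ a                                     ≡⟨ ℚ.*-identityʳ _ ⟨
    x ^ℚ a ℚ.* ((1ℚ ℚ.+ 1ℚ) ℚ.* ½)             ≡⟨ ℚ.*-assoc (x ^ℚ a) (1ℚ ℚ.+ 1ℚ) ½ ⟨
    x ^ℚ a ℚ.* (1ℚ ℚ.+ 1ℚ) ℚ.* ½               ≤⟨ *-monoʳ ½ 0≤½ (*-monoˡ (x ^ℚ a) (0≤^ a 0≤x) (ℚ.+-monoʳ-≤ 1ℚ 1≤aq)) ⟩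
    x ^ℚ a ℚ.* (1ℚ ℚ.+ ι a ℚ.* q) ℚ.* ½        ≤⟨ *-monoʳ ½ 0≤½ (bernoulli a 0≤q q≤1) ⟩
    1ℚ ℚ.* ½                                   ≡⟨ ℚ.*-identityˡ ½ ⟩
    ½                                          ∎

-- The induction proves the stronger (1 + w)^k ≤ 1 + 2kw; the product term is controlled by 2kw ≤ 1.
growth : ∀ {w} k → 0ℚ ℚ.≤ w → ι (2 * k) ℚ.* w ℚ.≤ 1ℚ → (1ℚ ℚ.+ w) ^ℚ k ℚ.≤ 1ℚ ℚ.+ 1ℚ
growth {w} k 0≤w small = ℚ.≤-trans (go k small) (ℚ.+-monoʳ-≤ 1ℚ small)
  where
  open ℚ.≤-Reasoning
  open +-*-Solver
  go : ∀ k → ι (2 * k) ℚ.* w ℚ.≤ 1ℚ → (1ℚ ℚ.+ w) ^ℚ k ℚ.≤ 1ℚ ℚ.+ ι (2 * k) ℚ.* w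
  go zero    _  = ≤-+ʳ _ (0≤* (ℚ.≤-refl {0ℚ}) 0≤w)
  go (suc k) le = begin
    (1ℚ ℚ.+ w) ℚ.* (1ℚ ℚ.+ w) ^ℚ k                 ≤⟨ *-monoˡ (1ℚ ℚ.+ w) (0≤+ 0≤1ℚ 0≤w) (go k κw≤1) ⟩
    (1ℚ ℚ.+ w) ℚ.* (1ℚ ℚ.+ κ ℚ.* w)                ≡⟨ solve 2 (λ w κ → (con 1ℚ :+ w) :* (con 1ℚ :+ κ :* w) := (con 1ℚ :+ w :+ κ :* w) :+ w :* (κ :* w)) refl w κ ⟩
    (1ℚ ℚ.+ w ℚ.+ κ ℚ.* w) ℚ.+ w ℚ.* (κ ℚ.* w)     ≤⟨ ℚ.+-monoʳ-≤ (1ℚ ℚ.+ w ℚ.+ κ ℚ.* w) (*-monoˡ w 0≤w κw≤1) ⟩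
    (1ℚ ℚ.+ w ℚ.+ κ ℚ.* w) ℚ.+ w ℚ.* 1ℚ            ≡⟨ solve 2 (λ w κ → (con 1ℚ :+ w :+ κ :* w) :+ w :* con 1ℚ := con 1ℚ :+ (con 1ℚ :+ (con 1ℚ :+ κ)) :* w) refl w κ ⟩
    1ℚ ℚ.+ ι (2 + 2 * k) ℚ.* w                     ≡⟨ cong (λ z → 1ℚ ℚ.+ ι z ℚ.* w) (eq k) ⟨
    1ℚ ℚ.+ ι (2 * suc k) ℚ.* w                     ∎
    where
    κ = ι (2 * k)
    eq : ∀ k → 2 * suc k ≡ 2 + 2 * k
    eq = solve-∀
    κw≤1 : κ ℚ.* w ℚ.≤ 1ℚ
    κw≤1 = ℚ.≤-trans (*-monoʳ w 0≤w (ι-mono (ℕ.*-monoʳ-≤ 2 (ℕ.n≤1+n k)))) le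

length-subsets : ∀ n → length (subsets n) ≡ 2 ^ n
length-subsets zero    = refl
length-subsets (suc n) = trans (List.length-++ (map (outside ∷_) (subsets n)))
  (trans (cong₂ _+_ (List.length-map _ (subsets n)) (List.length-map _ (subsets n)))
  (cong₂ _+_ (length-subsets n) (trans (length-subsets n) (sym (ℕ.+-identityʳ _)))))

∑ℚ-const : ∀ (xs : List A) c → ∑ℚ.∑ xs (λ _ → c) ≡ ι (length xs) ℚ.* c
∑ℚ-const []       c = sym (ℚ.*-zeroˡ c)
∑ℚ-const (_ ∷ xs) c = trans (cong (c ℚ.+_) (∑ℚ-const xs c))
  (solve 2 (λ c l → c :+ l :* c := (con 1ℚ :+ l) :* c) refl c (ι (length xs)))
  where open +-*-Solver

0≤½^ : ∀ k → 0ℚ ℚ.≤ ½ ^ℚ k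
0≤½^ k = 0≤^ k 0≤½

-- Charging vertex sets by size and by distance from the stars

module Charges (n N M b : ℕ) (star : Subset n → Subset N) where

  private
    m = suc M
    y = ½ ^ℚ suc b
    -- Of the 3n factors 1/2, about n make (1 + z)^N ≤ 2 by N ≤ 2^n; in the total, n + 1 pay for
    -- that 2 and for the 2^n sets `Z`, and at least n - 1 ≥ 0 more are left to ensure the tail
    -- 2^(-n).
    z = ½ ^ℚ (3 * n)

  -- The powers of `y` sum to (1 + y)^N over all sets. As N ≤ M/y, this is at most 4^(M+1), and the
  -- prefactor 8^-(M+1) leaves 2^-(M+1). Distance from the empty set stands for the size, so that
  -- `∑-^hamming` applies here too.
  first : Subset N → ℚ
  first A = (½ ^ℚ 3) ^ℚ m ℚ.* y ^ℚ hamming A (∅ {N})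

  -- With t members outside the star of Z, |A Δ star Z| = 2t - 1, hence ½^(6nt) = z · z^|A Δ star Z|,
  -- and the sum of these terms over A factorises.
  second : Subset N → Subset n → ℚ
  second A Z = z ℚ.* z ^ℚ hamming A (star Z)

  charge : Subset N → ℚ
  charge A = first A ℚ.+ ∑ℚ.∑ (subsets n) (second A)

  0≤first : ∀ A → 0ℚ ℚ.≤ first A
  0≤first A = 0≤* (0≤^ m (0≤½^ 3)) (0≤^ (hamming A (∅ {N})) (0≤½^ (suc b)))

  0≤second : ∀ A Z → 0ℚ ℚ.≤ second A Z
  0≤second A Z = 0≤* (0≤½^ (3 * n)) (0≤^ (hamming A (star Z)) (0≤½^ (3 * n)))

  0≤charge : ∀ A → 0ℚ ℚ.≤ charge A
  0≤charge A = 0≤+ (0≤first A) (0≤∑ (subsets n) (0≤second A))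

  first-≤-charge : ∀ A → ∣ A ∣ ≡ m → ½ ^ℚ (m * (3 + suc b)) ℚ.≤ charge A
  first-≤-charge A A≡m = begin
    ½ ^ℚ (m * (3 + suc b))                 ≡⟨ ^ℚ-* ½ m (3 + suc b) ⟩
    (½ ^ℚ (3 + suc b)) ^ℚ m                ≡⟨ cong (_^ℚ m) (^ℚ-+ ½ 3 (suc b)) ⟩
    (½ ^ℚ 3 ℚ.* y) ^ℚ m                    ≡⟨ ^ℚ-distrib (½ ^ℚ 3) y m ⟩
    (½ ^ℚ 3) ^ℚ m ℚ.* y ^ℚ m               ≡⟨ cong (λ k → (½ ^ℚ 3) ^ℚ m ℚ.* y ^ℚ k) (trans (hamming-∅ A) A≡m) ⟨
    first A                                ≤⟨ ≤-+ʳ (∑ℚ.∑ (subsets n) (second A)) (0≤∑ (subsets n) (0≤second A)) ⟩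
    charge A                               ∎
    where open ℚ.≤-Reasoning

  second-≤-charge : ∀ A Z t → suc (hamming A (star Z)) ≡ 2 * t → ½ ^ℚ (6 * n * t) ℚ.≤ charge A
  second-≤-charge A Z t eq = begin
    ½ ^ℚ (6 * n * t)                           ≡⟨ cong (½ ^ℚ_) (trans (lem n t) (cong (_* (3 * n)) (sym eq))) ⟩
    ½ ^ℚ (suc (hamming A (star Z)) * (3 * n))  ≡⟨ ^ℚ-* ½ (suc (hamming A (star Z))) (3 * n) ⟩
    second A Z                                 ≤⟨ ∈⇒≤∑ℚ {f = second A} (0≤second A) (∈-subsets Z) ⟩
    ∑ℚ.∑ (subsets n) (second A)                ≤⟨ ≤-+ˡ (first A) (0≤first A) ⟩
    charge A                                   ∎
    where
    open ℚ.≤-Reasoning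
    lem : ∀ n t → 6 * n * t ≡ 2 * t * (3 * n)
    lem = solve-∀

  module _ (N≤ : N ≤ 2 ^ suc b * M) (N≤2^n : N ≤ 2 ^ n) (n≤M : n ≤ M) (1≤n : 1 ≤ n) where

    Y : ℕ
    Y = 2 ^ b

    1+y≤4 : (1ℚ ℚ.+ y) ^ℚ N ℚ.≤ (ι 4) ^ℚ m
    1+y≤4 = begin
      (1ℚ ℚ.+ y) ^ℚ N              ≤⟨ 1≤^-mono (ℕ.≤-trans N≤ (ℕ.≤-trans (ℕ.*-monoʳ-≤ (2 * Y) (ℕ.n≤1+n M)) (ℕ.≤-reflexive (lem Y m)))) ⟩
      (1ℚ ℚ.+ y) ^ℚ (m * (Y + Y))  ≡⟨ ^ℚ-* (1ℚ ℚ.+ y) m (Y + Y) ⟩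
      ((1ℚ ℚ.+ y) ^ℚ (Y + Y)) ^ℚ m ≤⟨ ^ℚ-mono m (0≤^ (Y + Y) 0≤1+y) (ℚ.≤-trans (ℚ.≤-reflexive (^ℚ-+ (1ℚ ℚ.+ y) Y Y))
                                        (*-mono (0≤^ Y 0≤1+y) (0≤+ 0≤1ℚ 0≤1ℚ) two two)) ⟩
      (ι 4) ^ℚ m                   ∎
      where
      open ℚ.≤-Reasoning
      0≤1+y : 0ℚ ℚ.≤ 1ℚ ℚ.+ y
      0≤1+y = 0≤+ 0≤1ℚ (0≤½^ (suc b))
      two : (1ℚ ℚ.+ y) ^ℚ Y ℚ.≤ 1ℚ ℚ.+ 1ℚ
      two = growth Y (0≤½^ (suc b)) (ℚ.≤-reflexive (ι2^*½^ (suc b)))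
      lem : ∀ y m → 2 * y * m ≡ m * (y + y)
      lem = solve-∀
      1≤^ : ∀ k → 1ℚ ℚ.≤ (1ℚ ℚ.+ y) ^ℚ k
      1≤^ k = subst (ℚ._≤ (1ℚ ℚ.+ y) ^ℚ k) (1^ℚ k) (^ℚ-mono k 0≤1ℚ (≤-+ʳ y (0≤½^ (suc b))))
      1≤^-mono : ∀ {j k} → j ≤ k → (1ℚ ℚ.+ y) ^ℚ j ℚ.≤ (1ℚ ℚ.+ y) ^ℚ k
      1≤^-mono {j} {k} j≤k = begin
        (1ℚ ℚ.+ y) ^ℚ j                                ≡⟨ ℚ.*-identityʳ _ ⟨
        (1ℚ ℚ.+ y) ^ℚ j ℚ.* 1ℚ                         ≤⟨ *-monoˡ _ (0≤^ j 0≤1+y) (1≤^ (k ∸ j)) ⟩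
        (1ℚ ℚ.+ y) ^ℚ j ℚ.* (1ℚ ℚ.+ y) ^ℚ (k ∸ j)      ≡⟨ ^ℚ-+ (1ℚ ℚ.+ y) j (k ∸ j) ⟨
        (1ℚ ℚ.+ y) ^ℚ (j + (k ∸ j))                    ≡⟨ cong ((1ℚ ℚ.+ y) ^ℚ_) (ℕ.m+[n∸m]≡n j≤k) ⟩
        (1ℚ ℚ.+ y) ^ℚ k                                ∎

    first-≤ : (½ ^ℚ 3) ^ℚ m ℚ.* (1ℚ ℚ.+ y) ^ℚ N ℚ.≤ ½ ^ℚ n
    first-≤ = begin
      (½ ^ℚ 3) ^ℚ m ℚ.* (1ℚ ℚ.+ y) ^ℚ N   ≤⟨ *-monoˡ _ (0≤^ m (0≤½^ 3)) 1+y≤4 ⟩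
      (½ ^ℚ 3) ^ℚ m ℚ.* (ι 4) ^ℚ m        ≡⟨ ^ℚ-distrib (½ ^ℚ 3) (ι 4) m ⟨
      (½ ^ℚ 3 ℚ.* ι 4) ^ℚ m               ≡⟨ cong (_^ℚ m) {x = ½ ^ℚ 3 ℚ.* ι 4} {y = ½} refl ⟩
      ½ ^ℚ m                              ≤⟨ ^ℚ-anti 0≤½ ½≤1 (ℕ.≤-trans n≤M (ℕ.n≤1+n M)) ⟩
      ½ ^ℚ n                              ∎
      where open ℚ.≤-Reasoning

    z-small : ∀ {k} → k ≤ 2 * 2 ^ n → ι k ℚ.* z ℚ.≤ ½ ^ℚ n
    z-small {k} k≤ = begin
      ι k ℚ.* z                         ≤⟨ *-monoʳ z (0≤½^ (3 * n)) (ι-mono k≤) ⟩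
      ι (2 ^ suc n) ℚ.* ½ ^ℚ (3 * n)    ≤⟨ *-monoˡ (ι (2 ^ suc n)) (0≤ι (2 ^ suc n)) (^ℚ-anti 0≤½ ½≤1 expo) ⟩
      ι (2 ^ suc n) ℚ.* ½ ^ℚ (suc n + n) ≡⟨ cong (ι (2 ^ suc n) ℚ.*_) (^ℚ-+ ½ (suc n) n) ⟩
      ι (2 ^ suc n) ℚ.* (½ ^ℚ suc n ℚ.* ½ ^ℚ n) ≡⟨ ℚ.*-assoc (ι (2 ^ suc n)) (½ ^ℚ suc n) (½ ^ℚ n) ⟨
      ι (2 ^ suc n) ℚ.* ½ ^ℚ suc n ℚ.* ½ ^ℚ n   ≡⟨ cong (ℚ._* ½ ^ℚ n) (ι2^*½^ (suc n)) ⟩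
      1ℚ ℚ.* ½ ^ℚ n                     ≡⟨ ℚ.*-identityˡ _ ⟩
      ½ ^ℚ n                            ∎
      where
      open ℚ.≤-Reasoning
      lem₂ : ∀ n → n + n + n ≡ 3 * n
      lem₂ = solve-∀
      expo : suc n + n ≤ 3 * n
      expo = ℕ.≤-trans (ℕ.+-monoˡ-≤ n (ℕ.+-monoˡ-≤ n 1≤n)) (ℕ.≤-reflexive (lem₂ n))

    second-≤ : ∑ℚ.∑ (subsets n) (λ Z → z ℚ.* (1ℚ ℚ.+ z) ^ℚ N) ℚ.≤ ½ ^ℚ n
    second-≤ = begin
      ∑ℚ.∑ (subsets n) (λ Z → z ℚ.* (1ℚ ℚ.+ z) ^ℚ N)  ≡⟨ ∑ℚ-const (subsets n) _ ⟩
      ι (length (subsets n)) ℚ.* (z ℚ.* (1ℚ ℚ.+ z) ^ℚ N)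
        ≤⟨ *-monoˡ _ (0≤ι (length (subsets n))) (*-monoˡ z (0≤½^ (3 * n)) (growth N (0≤½^ (3 * n))
             (ℚ.≤-trans (z-small (ℕ.*-monoʳ-≤ 2 N≤2^n)) (^ℚ-anti {½} {0} {n} 0≤½ ½≤1 z≤n)))) ⟩
      ι (length (subsets n)) ℚ.* (z ℚ.* ι 2)   ≡⟨ cong (λ k → ι k ℚ.* (z ℚ.* ι 2)) (length-subsets n) ⟩
      ι (2 ^ n) ℚ.* (z ℚ.* ι 2)                ≡⟨ solve 3 (λ a z t → a :* (z :* t) := (t :* a) :* z) refl (ι (2 ^ n)) z (ι 2) ⟩
      (ι 2 ℚ.* ι (2 ^ n)) ℚ.* z                ≡⟨ cong (ℚ._* z) (ι-* 2 (2 ^ n)) ⟨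
      ι (2 * 2 ^ n) ℚ.* z                      ≤⟨ z-small ℕ.≤-refl ⟩
      ½ ^ℚ n                                   ∎
      where
      open ℚ.≤-Reasoning
      open +-*-Solver

    total-charge : ∑ℚ.∑ (subsets N) charge ℚ.≤ ½ ^ℚ n ℚ.+ ½ ^ℚ n
    total-charge = begin
      ∑ℚ.∑ (subsets N) charge
        ≡⟨ ∑ℚ.∑-+ (subsets N) first (λ A → ∑ℚ.∑ (subsets n) (second A)) ⟩
      ∑ℚ.∑ (subsets N) first ℚ.+
      ∑ℚ.∑ (subsets N) (λ A → ∑ℚ.∑ (subsets n) (second A))
        ≡⟨ cong₂ ℚ._+_
             (trans (∑ℚ.∑-*ˡ (subsets N) c (λ A → y ^ℚ hamming A (∅ {N}))) (cong (c ℚ.*_) (∑-^hamming y (∅ {N}))))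
             (trans (∑ℚ.∑-swap (subsets N) (subsets n) second)
                    (∑ℚ.∑-cong (subsets n) (λ Z → trans (∑ℚ.∑-*ˡ (subsets N) z (λ A → z ^ℚ hamming A (star Z)))
                                                         (cong (z ℚ.*_) (∑-^hamming z (star Z)))))) ⟩
      c ℚ.* (1ℚ ℚ.+ y) ^ℚ N ℚ.+ ∑ℚ.∑ (subsets n) (λ Z → z ℚ.* (1ℚ ℚ.+ z) ^ℚ N)
        ≤⟨ ℚ.+-mono-≤ first-≤ second-≤ ⟩
      ½ ^ℚ n ℚ.+ ½ ^ℚ n ∎
      where
      open ℚ.≤-Reasoning
      c = (½ ^ℚ 3) ^ℚ m

-- The failure probability for fixed n and rational q

extremal? : ∀ n r s → U.Decidable (λ F → α (spanningSubgraph G⟨ n , r ,< s ⟩ F) ≡ (n ∸ s) C (r ∸ s))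
extremal? n r s F = α (spanningSubgraph G⟨ n , r ,< s ⟩ F) ≟ ((n ∸ s) C (r ∸ s))

module Failure (n r s : ℕ) (s<r : s < r) (r<n : r < n) where

  open JohnsonSpanning n r s s<r r<n public

  Heavy : Subset N → Subset n → Set
  Heavy A Z = ∣ Z ∣ ≡ s × 9 * (r * r * M) ≤ 8 * n * degree Z A

  heavy? : ∀ A → U.Decidable (Heavy A)
  heavy? A Z = (∣ Z ∣ ≟ s) ×-dec (9 * (r * r * M) ≤? 8 * n * degree Z A)

  -- The last two hypotheses count edges in blocks of `a`, each worth one factor 1/2 by `decay`. The
  -- numbers of blocks, `6 * n * outliers Z A` and `suc M * (3 + suc b)`, are the exponents of the
  -- two charges.
  module _ {q a b} (0≤q : 0ℚ ℚ.≤ q) (q≤1 : q ℚ.≤ 1ℚ) (1≤aq : 1ℚ ℚ.≤ ι a ℚ.* q)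
           (N≤ : N ≤ 2 ^ suc b * M) (N≤2^n : N ≤ 2 ^ n) (n≤M : n ≤ M)
           (clustered : ∀ A Z → Heavy A Z → ∣ A ∣ ≡ suc M → a * (6 * n * outliers Z A) ≤ ∣ within J A ∣)
           (spread : ∀ A → (∀ Z → ¬ Heavy A Z) → ∣ A ∣ ≡ suc M → a * (suc M * (3 + suc b)) ≤ ∣ within J A ∣)
           where

    open Charges n N M b star

    charge-≥ : ∀ A → ∣ A ∣ ≡ suc M → (1ℚ ℚ.- q) ^ℚ ∣ within J A ∣ ℚ.≤ charge A
    charge-≥ A A≡m with Any.any? (heavy? A) (subsets n)
    ... | yes some = let Z , Z∈ , heavy = find some in
      ℚ.≤-trans (decay {q} {a} {6 * n * outliers Z A} 0≤q q≤1 1≤aq (clustered A Z heavy A≡m))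
                (second-≤-charge A Z (outliers Z A) (hamming-star Z A (proj₁ heavy) A≡m))
    ... | no none =
      ℚ.≤-trans (decay {q} {a} {suc M * (3 + suc b)} 0≤q q≤1 1≤aq (spread A (λ Z heavy → none (lose (∈-subsets Z) heavy)) A≡m))
                (first-≤-charge A A≡m)

    failure-bound : 1ℚ ℚ.≤ probability q (extremal? n r s) ℚ.+ (½ ^ℚ n ℚ.+ ½ ^ℚ n)
    failure-bound = ℚ.≤-trans
      (union-bound 0≤q q≤1 (extremal? n r s) (λ A → ∣ A ∣ ≟ suc M) (within J) large-independent)
      (ℚ.+-monoʳ-≤ (probability q (extremal? n r s)) (ℚ.≤-trans (∑ℚ.∑-mono (subsets N) each)
        (total-charge N≤ N≤2^n n≤M (ℕ.≤-trans (s≤s z≤n) r<n))))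
      where
      prob : Subset N → ℚ
      prob A = (1ℚ ℚ.- q) ^ℚ ∣ within J A ∣
      each : ∀ A → ∑ℚ.𝟙 (∣ A ∣ ≟ suc M) ℚ.* prob A ℚ.≤ charge A
      each A = go (∣ A ∣ ≟ suc M)
        where
        go : (d : Dec (∣ A ∣ ≡ suc M)) → ∑ℚ.𝟙 d ℚ.* prob A ℚ.≤ charge A
        go (yes A≡m) = ℚ.≤-trans (ℚ.≤-reflexive (ℚ.*-identityˡ (prob A))) (charge-≥ A A≡m)
        go (no _)    = ℚ.≤-trans (ℚ.≤-reflexive (ℚ.*-zeroˡ (prob A))) (0≤charge A)

-- Numerical estimates for large n

C-positive : ∀ {n k} → k ≤ n → 1 ≤ n C k
C-positive {n} z≤n = ℕ.≤-reflexive (sym (nC0 n))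
C-positive {suc n} {suc k} (s≤s k≤n) = ℕ.≤-trans (C-positive k≤n)
  (ℕ.≤-trans (ℕ.m≤m+n (n C k) (n C suc k)) (ℕ.≤-reflexive (nCk+nC[k+1]≡[n+1]C[k+1] n k)))

module Estimates (n r s L a : ℕ) (s<r : s < r) (r<n : r < n) (20≤s : 20 ≤ s) (20≤L : 20 ≤ L)
  (n<2^L : n ≤ 2 ^ suc L * r) (sparse : 2048 * (r * r) ≤ n) (small : 256 * suc s ≤ r)
  (a≤ : a * (7 * (s * (r * r) * L)) ≤ 2 * n) where

  open Failure n r s s<r r<n public

  private
    r≥1 : 1 ≤ r
    r≥1 = ℕ.≤-trans (s≤s z≤n) s<r
    n≥1 : 1 ≤ n
    n≥1 = ℕ.≤-trans (s≤s z≤n) r<n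
    rr≥1 : 1 ≤ r * r
    rr≥1 = ℕ.*-mono-≤ r≥1 r≥1
    s≥1 : 1 ≤ s
    s≥1 = ℕ.≤-trans (s≤s z≤n) 20≤s
    L≥1 : 1 ≤ L
    L≥1 = ℕ.≤-trans (s≤s z≤n) 20≤L
    k*rr≤n : ∀ k → k ≤ 2048 → k * (r * r) ≤ n
    k*rr≤n k k≤ = ℕ.≤-trans (ℕ.*-monoˡ-≤ (r * r) k≤) sparse
    rr≤n : r * r ≤ n
    rr≤n = subst (_≤ n) (ℕ.*-identityˡ (r * r)) (k*rr≤n 1 (ℕ.≤ᵇ⇒≤ 1 2048 _))
    2048≤n : 2048 ≤ n
    2048≤n = ℕ.≤-trans (ℕ.m≤m*n 2048 (r * r) {{ℕ.>-nonZero rr≥1}}) sparse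
    X = r * r * M

  N≤2^n : N ≤ 2 ^ n
  N≤2^n = ℕ.≤-trans (List.length-filter (λ x → ∣ x ∣ ≟ r) (subsets n)) (ℕ.≤-reflexive (length-subsets n))

  N≡ : N ≡ n C r
  N≡ = begin
    N                                       ≡⟨ trans (List.length-tabulate {n = N} id) refl ⟨
    length (allFin N)                       ≡⟨ ∑-one (allFin N) ⟨
    ∑ (allFin N) (λ _ → 1)                  ≡⟨ ∑-cong (allFin N) (λ i → sym (𝟙-yes (∅ ⊆? v i) (⊆-min (v i)))) ⟩
    ∑ (allFin N) (λ i → 𝟙 (∅ ⊆? v i))       ≡⟨ star-size ∅ (subst (_≤ r) (sym (∣⊥∣≡0 n)) z≤n) ⟩
    w ∣ ∅ {n} ∣                             ≡⟨ cong w (∣⊥∣≡0 n) ⟩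
    n C r                                   ∎
    where open ≡-Reasoning

  -- N/M ≤ (n/(r - s))^s by `C-drop-≤`. Since s ≤ r - s, replacing r by r - s costs a factor 2,
  -- which raises the exponent from L + 1 to L + 2.
  N≤ : N ≤ 2 ^ ((2 + L) * s) * M
  N≤ = ℕ.*-cancelˡ-≤ (ρ ^ s) {{ℕ.m^n≢0 ρ s {{ℕ.>-nonZero (ℕ.m<n⇒0<n∸m s<r)}}}} (begin
    ρ ^ s * N                          ≡⟨ cong (ρ ^ s *_) N≡ ⟩
    ρ ^ s * (n C r)                    ≤⟨ C-drop-≤ s s ℕ.≤-refl (ℕ.<⇒≤ s<r) (ℕ.<⇒≤ r<n) ⟩
    n ^ s * M                          ≤⟨ ℕ.*-monoˡ-≤ M (ℕ.^-monoˡ-≤ s n≤ρ) ⟩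
    (2 ^ (2 + L) * ρ) ^ s * M          ≡⟨ cong (_* M) (^-distribʳ-* s (2 ^ (2 + L)) ρ) ⟩
    (2 ^ (2 + L)) ^ s * ρ ^ s * M      ≡⟨ cong (λ z → z * ρ ^ s * M) (ℕ.^-*-assoc 2 (2 + L) s) ⟩
    2 ^ ((2 + L) * s) * ρ ^ s * M      ≡⟨ lem (2 ^ ((2 + L) * s)) (ρ ^ s) M ⟩
    ρ ^ s * (2 ^ ((2 + L) * s) * M)    ∎)
    where
    open ℕ.≤-Reasoning
    ρ = r ∸ s
    lem : ∀ a b c → a * b * c ≡ b * (a * c)
    lem = solve-∀
    lem₂ : ∀ p ρ → 2 * p * (ρ + ρ) ≡ 2 * (2 * p) * ρ
    lem₂ = solve-∀
    s≤ρ : s ≤ ρ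
    s≤ρ = ℕ.m+n≤o⇒m≤o∸n s (ℕ.≤-trans (ℕ.≤-trans (ℕ.≤-reflexive (cong (s +_) (sym (ℕ.+-identityʳ s))))
      (ℕ.≤-trans (ℕ.*-monoˡ-≤ s (ℕ.≤ᵇ⇒≤ 2 256 _)) (ℕ.*-monoʳ-≤ 256 (ℕ.n≤1+n s)))) small)
    n≤ρ : n ≤ 2 ^ (2 + L) * ρ
    n≤ρ = begin
      n                          ≤⟨ n<2^L ⟩
      2 ^ suc L * r              ≡⟨ cong (2 ^ suc L *_) (ℕ.m+[n∸m]≡n (ℕ.<⇒≤ s<r)) ⟨
      2 ^ suc L * (s + ρ)        ≤⟨ ℕ.*-monoʳ-≤ (2 ^ suc L) (ℕ.+-monoˡ-≤ ρ s≤ρ) ⟩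
      2 ^ suc L * (ρ + ρ)        ≡⟨ lem₂ (2 ^ L) ρ ⟩
      2 ^ (2 + L) * ρ            ∎

  -- A star of an s-set contains the stars of larger cores: ten more points give M ≥ (n/r)^10, and
  -- r² ≤ n makes this at least n^5. It shows M to exceed the cubic loss in `clustered`.
  n^5≤M : n ^ 5 ≤ M
  n^5≤M = ℕ.*-cancelˡ-≤ (n ^ 5) {{ℕ.m^n≢0 n 5 {{ℕ.>-nonZero n≥1}}}} (begin
    n ^ 5 * n ^ 5            ≡⟨ ℕ.^-distribˡ-+-* n 5 5 ⟨
    n ^ 10                   ≤⟨ ℕ.m≤m*n (n ^ 10) (w (s + 10)) {{ℕ.>-nonZero (C-positive (ℕ.∸-monoˡ-≤ (s + 10) (ℕ.<⇒≤ r<n)))}} ⟩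
    n ^ 10 * w (s + 10)      ≤⟨ C-shift-≤ s 10 s+10≤r (ℕ.<⇒≤ r<n) ⟩
    r ^ 10 * M               ≡⟨ cong (_* M) (sym (ℕ.^-*-assoc r 2 5)) ⟩
    (r ^ 2) ^ 5 * M          ≤⟨ ℕ.*-monoˡ-≤ M (ℕ.^-monoˡ-≤ 5 (subst (_≤ n) (cong (r *_) (sym (ℕ.*-identityʳ r))) rr≤n)) ⟩
    n ^ 5 * M                ∎)
    where
    open ℕ.≤-Reasoning
    s+10≤r : s + 10 ≤ r
    s+10≤r = begin
      s + 10        ≤⟨ ℕ.+-monoʳ-≤ s (ℕ.≤-trans (ℕ.≤ᵇ⇒≤ 10 20 _) 20≤s) ⟩
      s + s         ≡⟨ cong (s +_) (ℕ.+-identityʳ s) ⟨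
      2 * s         ≤⟨ ℕ.*-mono-≤ (ℕ.≤ᵇ⇒≤ 2 256 _) (ℕ.n≤1+n s) ⟩
      256 * suc s   ≤⟨ small ⟩
      r             ∎

  n≤M : n ≤ M
  n≤M = ℕ.≤-trans (subst (_≤ n ^ 5) (ℕ.*-identityʳ n) (ℕ.^-monoʳ-≤ n {{ℕ.>-nonZero n≥1}} {1} {5} (s≤s z≤n))) n^5≤M

  M≥1 : 1 ≤ M
  M≥1 = ℕ.≤-trans n≥1 n≤M

  private
    -- The lowest level needs s to be small compared with r, as 32 · 8(s + 1) ≤ r. On higher levels
    -- s + j + 1 ≤ r suffices: one factor 8r² is set aside, and each of the others, taken with 256,
    -- is below n by 2048r² ≤ n.
    term-bound : ∀ j → s + suc j ≤ r → 32 * (8 * (s + suc j) * r) ^ suc j ≤ n ^ j * (r * r)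
    term-bound zero _ = begin
      32 * (8 * (s + 1) * r) ^ 1  ≡⟨ lem s r ⟩
      256 * suc s * r             ≤⟨ ℕ.*-monoˡ-≤ r small ⟩
      r * r                       ≡⟨ ℕ.*-identityˡ (r * r) ⟨
      1 * (r * r)                 ∎
      where
      open ℕ.≤-Reasoning
      lem : ∀ s r → 32 * (8 * (s + 1) * r * 1) ≡ 256 * suc s * r
      lem = solve-∀
    term-bound (suc k) s+j≤r = begin
      32 * (8 * (s + suc (suc k)) * r) ^ suc (suc k)  ≤⟨ ℕ.*-monoʳ-≤ 32 (ℕ.^-monoˡ-≤ (suc (suc k)) base) ⟩
      32 * (y * y ^ suc k)                            ≡⟨ lem (r * r) (y ^ suc k) ⟩
      256 * y ^ suc k * (r * r)                       ≤⟨ ℕ.*-monoˡ-≤ (r * r) (ℕ.*-monoˡ-≤ (y ^ suc k) (ℕ.m≤m*n 256 (256 ^ k) {{ℕ.m^n≢0 256 k}})) ⟩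
      256 ^ suc k * y ^ suc k * (r * r)               ≡⟨ cong (_* (r * r)) (^-distribʳ-* (suc k) 256 y) ⟨
      (256 * y) ^ suc k * (r * r)                     ≤⟨ ℕ.*-monoˡ-≤ (r * r) (ℕ.^-monoˡ-≤ (suc k) (ℕ.≤-trans (ℕ.≤-reflexive (lem₂ (r * r))) sparse)) ⟩
      n ^ suc k * (r * r)                             ∎
      where
      open ℕ.≤-Reasoning
      y = 8 * (r * r)
      lem : ∀ x z → 32 * (8 * x * z) ≡ 256 * z * x
      lem = solve-∀
      lem₂ : ∀ x → 256 * (8 * x) ≡ 2048 * x
      lem₂ = solve-∀
      lem₃ : ∀ x r → 8 * x * r ≡ 8 * (x * r)
      lem₃ = solve-∀
      base : 8 * (s + suc (suc k)) * r ≤ y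
      base = ℕ.≤-trans (ℕ.≤-reflexive (lem₃ (s + suc (suc k)) r)) (ℕ.*-monoʳ-≤ 8 (ℕ.*-monoˡ-≤ r s+j≤r))

    -- The weight of a core of size s + j + 1 is at most (r/n)^(j+1) M by `C-shift-≤`. The factor
    -- 2^(j+1), which makes the levels sum geometrically, turns 4 into 8 in the base.
    level-bound : ∀ j → s + suc j ≤ r →
      2 ^ suc j * (8 * n * (4 * (4 * (s + suc j)) ^ suc j * w (s + suc j))) ≤ X
    level-bound j s+j≤r = ℕ.*-cancelˡ-≤ (n ^ j) {{ℕ.m^n≢0 n j {{ℕ.>-nonZero n≥1}}}} (begin
      n ^ j * (2 ^ suc j * (8 * n * (4 * (4 * q) ^ suc j * W)))   ≡⟨ lem (n ^ j) (2 ^ suc j) n ((4 * q) ^ suc j) W ⟩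
      32 * (2 ^ suc j * (4 * q) ^ suc j) * (n ^ suc j * W)        ≤⟨ ℕ.*-monoʳ-≤ (32 * (2 ^ suc j * (4 * q) ^ suc j)) (C-shift-≤ s (suc j) s+j≤r (ℕ.<⇒≤ r<n)) ⟩
      32 * (2 ^ suc j * (4 * q) ^ suc j) * (r ^ suc j * M)        ≡⟨ lem₂ (2 ^ suc j) ((4 * q) ^ suc j) (r ^ suc j) M ⟩
      32 * (2 ^ suc j * (4 * q) ^ suc j * r ^ suc j) * M          ≡⟨ cong (λ z → 32 * z * M) pows ⟩
      32 * (8 * q * r) ^ suc j * M                                ≤⟨ ℕ.*-monoˡ-≤ M (term-bound j s+j≤r) ⟩
      n ^ j * (r * r) * M                                         ≡⟨ ℕ.*-assoc (n ^ j) (r * r) M ⟩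
      n ^ j * X                                                   ∎)
      where
      open ℕ.≤-Reasoning
      q = s + suc j
      W = w q
      lem : ∀ N t n f W → N * (t * (8 * n * (4 * f * W))) ≡ 32 * (t * f) * (n * N * W)
      lem = solve-∀
      lem₂ : ∀ t f R M → 32 * (t * f) * (R * M) ≡ 32 * (t * f * R) * M
      lem₂ = solve-∀
      lem₃ : ∀ q → 2 * (4 * q) ≡ 8 * q
      lem₃ = solve-∀
      pows : 2 ^ suc j * (4 * q) ^ suc j * r ^ suc j ≡ (8 * q * r) ^ suc j
      pows = trans (cong (_* r ^ suc j) (trans (sym (^-distribʳ-* (suc j) 2 (4 * q))) (cong (_^ suc j) (lem₃ q))))
                   (sym (^-distribʳ-* (suc j) (8 * q) r))

    peel-sum : ∀ j → s + j ≤ r → 2 ^ j * (8 * n * peelBound w s j) + X ≤ 2 ^ j * X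
    peel-sum zero    _ = ℕ.≤-reflexive (lem n X)
      where
      lem : ∀ n X → 1 * (8 * n * 0) + X ≡ 1 * X
      lem = solve-∀
    peel-sum (suc j) s+j≤r = begin
      2 ^ suc j * (8 * n * (T + PB)) + X                         ≡⟨ lem (2 ^ j) n T PB X ⟩
      2 ^ suc j * (8 * n * T) + (2 * (2 ^ j * (8 * n * PB)) + X)  ≤⟨ ℕ.+-monoˡ-≤ _ (level-bound j s+j≤r) ⟩
      X + (2 * (2 ^ j * (8 * n * PB)) + X)                        ≡⟨ lem₂ X (2 ^ j * (8 * n * PB)) ⟩
      2 * (2 ^ j * (8 * n * PB) + X)                              ≤⟨ ℕ.*-monoʳ-≤ 2 (peel-sum j (ℕ.≤-trans (ℕ.+-monoʳ-≤ s (ℕ.n≤1+n j)) s+j≤r)) ⟩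
      2 * (2 ^ j * X)                                            ≡⟨ ℕ.*-assoc 2 (2 ^ j) X ⟨
      2 ^ suc j * X                                              ∎
      where
      open ℕ.≤-Reasoning
      T = 4 * (4 * (s + suc j)) ^ suc j * w (s + suc j)
      PB = peelBound w s j
      lem : ∀ p n T b X → 2 * p * (8 * n * (T + b)) + X ≡ 2 * p * (8 * n * T) + (2 * (p * (8 * n * b)) + X)
      lem = solve-∀
      lem₂ : ∀ X Y → X + (2 * Y + X) ≡ 2 * (Y + X)
      lem₂ = solve-∀

  light : 8 * n * peelWeight ≤ r * r * M
  light = ℕ.*-cancelˡ-≤ (2 ^ (r ∸ s)) {{ℕ.m^n≢0 2 (r ∸ s)}}
    (ℕ.≤-trans (ℕ.m≤m+n _ X) (peel-sum (r ∸ s) (ℕ.≤-reflexive (ℕ.m+[n∸m]≡n (ℕ.<⇒≤ s<r)))))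

  a≤2n : a ≤ 2 * n
  a≤2n = ℕ.≤-trans (ℕ.m≤m*n a (7 * (s * (r * r) * L)) {{ℕ.>-nonZero (ℕ.*-mono-≤ {1} {7} (s≤s z≤n) (ℕ.*-mono-≤ (ℕ.*-mono-≤ s≥1 rr≥1) L≥1))}}) a≤

  -- The crude a ≤ 2n is enough here: the required edges cost a factor 192n³ per outlier, while each
  -- outlier supplies neighbours in proportion to `M`.
  clustered : ∀ A Z → Heavy A Z → ∣ A ∣ ≡ suc M → a * (6 * n * outliers Z A) ≤ ∣ within J A ∣
  clustered A Z (Z≡s , heavy) A≡ = ℕ.*-cancelˡ-≤ (16 * n) {{ℕ.>-nonZero (ℕ.*-mono-≤ {1} {16} (s≤s z≤n) n≥1)}} (begin
    16 * n * (a * (6 * n * t))          ≤⟨ ℕ.*-monoʳ-≤ (16 * n) (ℕ.*-monoˡ-≤ (6 * n * t) a≤2n) ⟩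
    16 * n * (2 * n * (6 * n * t))      ≡⟨ lem n t ⟩
    t * (192 * (n ^ 3))                 ≤⟨ ℕ.*-monoʳ-≤ t big ⟩
    t * X                               ≤⟨ clustered-adjacencies Z A Z≡s heavy ⟩
    8 * n * adjacencies (elements A)    ≤⟨ ℕ.*-monoʳ-≤ (8 * n) (adjacencies-≤ J A) ⟩
    8 * n * (2 * e)                     ≡⟨ lem₂ n e ⟩
    16 * n * e                          ∎)
    where
    open ℕ.≤-Reasoning
    t = outliers Z A
    e = ∣ within J A ∣
    lem : ∀ n t → 16 * n * (2 * n * (6 * n * t)) ≡ t * (192 * (n * (n * (n * 1))))
    lem = solve-∀
    lem₂ : ∀ n e → 8 * n * (2 * e) ≡ 16 * n * e
    lem₂ = solve-∀
    big : 192 * n ^ 3 ≤ X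
    big = begin
      192 * n ^ 3       ≤⟨ ℕ.*-monoˡ-≤ (n ^ 3) (ℕ.≤-trans (ℕ.≤ᵇ⇒≤ 192 2048 _) (ℕ.≤-trans 2048≤n (ℕ.m≤m*n n n {{ℕ.>-nonZero n≥1}}))) ⟩
      n * n * n ^ 3     ≡⟨ ℕ.*-assoc n n (n ^ 3) ⟩
      n ^ 5             ≤⟨ n^5≤M ⟩
      M                 ≤⟨ ℕ.m≤n*m M (r * r) {{ℕ.>-nonZero rr≥1}} ⟩
      X                 ∎

  -- Turán gives at least (79/200)(M + 1)n/r² edges. Combined with
  -- `a * (7 * (s * (r * r) * L)) ≤ 2 * n` this is worth 553/400 blocks of `a` per unit of (M +
  -- 1)sL, where 553 = 79 · 7.
  spread : ∀ A → (∀ Z → ¬ Heavy A Z) → ∣ A ∣ ≡ suc M → a * (suc M * (3 + (2 + L) * s)) ≤ ∣ within J A ∣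
  spread A none A≡ = ℕ.*-cancelˡ-≤ 400 (begin
    400 * (a * (m * (3 + (2 + L) * s)))   ≡⟨ lem₅ a m (3 + (2 + L) * s) ⟩
    a * m * (400 * (3 + (2 + L) * s))     ≤⟨ ℕ.*-monoʳ-≤ (a * m) numeric ⟩
    a * m * (553 * (s * L))               ≤⟨ bound ⟩
    400 * e                               ∎)
    where
    open ℕ.≤-Reasoning
    m = suc M
    e = ∣ within J A ∣
    o = adjacencies (elements A)
    lem₅ : ∀ a m x → 400 * (a * (m * x)) ≡ a * m * (400 * x)
    lem₅ = solve-∀
    raw : m * m * (8 * n) ≤ o * (10 * X) + m * (10 * X)
    raw = subst (λ k → k * k * (8 * n) ≤ o * (10 * X) + k * (10 * X)) A≡
      (spread-adjacencies A (λ Z Z≡s → ℕ.<⇒≤ (ℕ.≰⇒> (λ heavy → none Z (Z≡s , heavy)))) light)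
    step₁ : m * (8 * n) ≤ o * (10 * (r * r)) + m * (10 * (r * r))
    step₁ = ℕ.*-cancelˡ-≤ M {{ℕ.>-nonZero M≥1}} (begin
      M * (m * (8 * n))                                ≤⟨ ℕ.*-monoˡ-≤ (m * (8 * n)) (ℕ.n≤1+n M) ⟩
      m * (m * (8 * n))                                ≡⟨ ℕ.*-assoc m m (8 * n) ⟨
      m * m * (8 * n)                                  ≤⟨ raw ⟩
      o * (10 * X) + m * (10 * X)                      ≡⟨ lem o m (r * r) M ⟩
      M * (o * (10 * (r * r)) + m * (10 * (r * r)))    ∎)
      where
      lem : ∀ o m x M → o * (10 * (x * M)) + m * (10 * (x * M)) ≡ M * (o * (10 * x) + m * (10 * x))
      lem = solve-∀
    -- Multiplying Turán's bound by 10 gives 80mn on the left; one mn pays for its linear term,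
    -- because 100r² ≤ n.
    step₂ : 79 * (m * n) ≤ 200 * (r * r) * e
    step₂ = ℕ.+-cancelʳ-≤ (m * n) _ _ (begin
      79 * (m * n) + m * n                                   ≡⟨ lem₁ m n ⟩
      10 * (m * (8 * n))                                     ≤⟨ ℕ.*-monoʳ-≤ 10 step₁ ⟩
      10 * (o * (10 * (r * r)) + m * (10 * (r * r)))         ≡⟨ lem₂ o m (r * r) ⟩
      100 * (r * r) * o + m * (100 * (r * r))                ≤⟨ ℕ.+-mono-≤ (ℕ.*-monoʳ-≤ (100 * (r * r)) (adjacencies-≤ J A)) (ℕ.*-monoʳ-≤ m (k*rr≤n 100 (ℕ.≤ᵇ⇒≤ 100 2048 _))) ⟩
      100 * (r * r) * (2 * e) + m * n                        ≡⟨ cong (_+ m * n) (lem₃ (r * r) e) ⟩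
      200 * (r * r) * e + m * n                              ∎)
      where
      lem₁ : ∀ m n → 79 * (m * n) + m * n ≡ 10 * (m * (8 * n))
      lem₁ = solve-∀
      lem₂ : ∀ o m x → 10 * (o * (10 * x) + m * (10 * x)) ≡ 100 * x * o + m * (100 * x)
      lem₂ = solve-∀
      lem₃ : ∀ x e → 100 * x * (2 * e) ≡ 200 * x * e
      lem₃ = solve-∀
    bound : a * m * (553 * (s * L)) ≤ 400 * e
    bound = ℕ.*-cancelˡ-≤ (r * r) {{ℕ.>-nonZero rr≥1}} (begin
      r * r * (a * m * (553 * (s * L)))          ≡⟨ lem₁ (r * r) a m s L ⟩
      79 * m * (a * (7 * (s * (r * r) * L)))     ≤⟨ ℕ.*-monoʳ-≤ (79 * m) a≤ ⟩
      79 * m * (2 * n)                           ≡⟨ lem₂ m n ⟩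
      2 * (79 * (m * n))                         ≤⟨ ℕ.*-monoʳ-≤ 2 step₂ ⟩
      2 * (200 * (r * r) * e)                    ≡⟨ lem₃ (r * r) e ⟩
      r * r * (400 * e)                          ∎)
      where
      lem₁ : ∀ x a m s L → x * (a * m * (553 * (s * L))) ≡ 79 * m * (a * (7 * (s * x * L)))
      lem₁ = solve-∀
      lem₂ : ∀ m n → 79 * m * (2 * n) ≡ 2 * (79 * (m * n))
      lem₂ = solve-∀
      lem₃ : ∀ x e → 2 * (200 * x * e) ≡ x * (400 * e)
      lem₃ = solve-∀
    -- The lower-order terms go into the leading one: 1200 ≤ 60s by s ≥ 20, and 860s ≤ 43sL by L ≥
    -- 20.
    numeric : 400 * (3 + (2 + L) * s) ≤ 553 * (s * L)
    numeric = begin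
      400 * (3 + (2 + L) * s)                    ≡⟨ lem₁ s L ⟩
      60 * 20 + (800 * s + 400 * (s * L))        ≤⟨ ℕ.+-monoˡ-≤ _ (ℕ.*-monoʳ-≤ 60 20≤s) ⟩
      60 * s + (800 * s + 400 * (s * L))         ≡⟨ lem₂ s L ⟩
      43 * (s * 20) + 400 * (s * L)              ≤⟨ ℕ.+-monoˡ-≤ (400 * (s * L)) (ℕ.*-monoʳ-≤ 43 (ℕ.*-monoʳ-≤ s 20≤L)) ⟩
      43 * (s * L) + 400 * (s * L)               ≡⟨ ℕ.*-distribʳ-+ (s * L) 43 400 ⟨
      443 * (s * L)                              ≤⟨ ℕ.*-monoˡ-≤ (s * L) (ℕ.≤ᵇ⇒≤ 443 553 _) ⟩
      553 * (s * L)                              ∎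
      where
      lem₁ : ∀ s L → 400 * (3 + (2 + L) * s) ≡ 60 * 20 + (800 * s + 400 * (s * L))
      lem₁ = solve-∀
      lem₂ : ∀ s L → 60 * s + (800 * s + 400 * (s * L)) ≡ 43 * (s * 20) + 400 * (s * L)
      lem₂ = solve-∀

  failure : ∀ {q} → 0ℚ ℚ.≤ q → q ℚ.≤ 1ℚ → 1ℚ ℚ.≤ ι a ℚ.* q →
            1ℚ ℚ.≤ probability q (extremal? n r s) ℚ.+ (½ ^ℚ n ℚ.+ ½ ^ℚ n)
  failure 0≤q q≤1 1≤aq = failure-bound {a = a} {b = b} 0≤q q≤1 1≤aq
    (subst (λ k → N ≤ 2 ^ k * M) (sym eq) N≤) N≤2^n n≤M clustered
    (λ A none A≡ → subst (λ k → a * (suc M * (3 + k)) ≤ ∣ within J A ∣) (sym eq) (spread A none A≡))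
    where
    b = ℕ.pred ((2 + L) * s)
    eq : suc b ≡ (2 + L) * s
    eq = ℕ.suc-pred ((2 + L) * s) {{ℕ.>-nonZero (ℕ.*-mono-≤ {1} {2 + L} (s≤s z≤n) s≥1)}}

-- Rational arithmetic and a lower bound for the logarithm

toℚᵘ-ι : ∀ k → ℚ.toℚᵘ (ι k) ℚᵘ.≃ ℚᵘ.mkℚᵘ (ℤ.+ k) 0
toℚᵘ-ι zero    = ℚᵘ.*≡* refl
toℚᵘ-ι (suc k) = begin-equality
  ℚ.toℚᵘ (1ℚ ℚ.+ ι k)                      ≃⟨ ℚ.toℚᵘ-homo-+ 1ℚ (ι k) ⟩
  ℚᵘ.1ℚᵘ ℚᵘ.+ ℚ.toℚᵘ (ι k)                 ≃⟨ ℚᵘ.+-congʳ ℚᵘ.1ℚᵘ (toℚᵘ-ι k) ⟩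
  ℚᵘ.1ℚᵘ ℚᵘ.+ ℚᵘ.mkℚᵘ (ℤ.+ k) 0            ≃⟨ ℚᵘ.*≡* (cong (ℤ._* ℤ.+ 1) (cong (ℤ._+_ (ℤ.+ 1)) (ℤ.*-identityʳ (ℤ.+ k)))) ⟩
  ℚᵘ.mkℚᵘ (ℤ.+ suc k) 0                    ∎
  where open ℚᵘ.≤-Reasoning

frac-ι : ∀ a b .{{_ : NonZero b}} → (ℤ.+ a / b) ℚ.* ι b ≡ ι a
frac-ι a (suc b) = ℚ.toℚᵘ-injective (begin-equality
  ℚ.toℚᵘ ((ℤ.+ a / suc b) ℚ.* ι (suc b))             ≃⟨ ℚ.toℚᵘ-homo-* (ℤ.+ a / suc b) (ι (suc b)) ⟩
  ℚ.toℚᵘ (ℤ.+ a / suc b) ℚᵘ.* ℚ.toℚᵘ (ι (suc b))     ≃⟨ ℚᵘ.*-cong (ℚ.toℚᵘ-fromℚᵘ (ℚᵘ.mkℚᵘ (ℤ.+ a) b)) (toℚᵘ-ι (suc b)) ⟩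
  ℚᵘ.mkℚᵘ (ℤ.+ a) b ℚᵘ.* ℚᵘ.mkℚᵘ (ℤ.+ suc b) 0       ≃⟨ ℚᵘ.*≡* eq ⟩
  ℚᵘ.mkℚᵘ (ℤ.+ a) 0                                  ≃⟨ toℚᵘ-ι a ⟨
  ℚ.toℚᵘ (ι a)                                       ∎)
  where
  open ℚᵘ.≤-Reasoning
  eq : (ℤ.+ a ℤ.* ℤ.+ suc b) ℤ.* ℤ.+ 1 ≡ ℤ.+ a ℤ.* (ℤ.+ (suc b * 1))
  eq = trans (ℤ.*-identityʳ (ℤ.+ a ℤ.* ℤ.+ suc b)) (cong (λ z → ℤ.+ a ℤ.* ℤ.+ z) (sym (ℕ.*-identityʳ (suc b))))

frac-1 : ∀ a → ℤ.+ a / 1 ≡ ι a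
frac-1 a = trans (sym (ℚ.*-identityʳ (ℤ.+ a / 1))) (frac-ι a 1)

1/_ : (b : ℕ) .{{_ : NonZero b}} → ℚ
1/ b = ℤ.+ 1 / b

0≤1/ : ∀ b .{{_ : NonZero b}} → 0ℚ ℚ.≤ 1/ b
0≤1/ b = ℚ.nonNegative⁻¹ (1/ b) {{ℚ.normalize-nonNeg 1 b}}

0<1/ : ∀ b .{{_ : NonZero b}} → 0ℚ ℚ.< 1/ b
0<1/ b = ℚ.positive⁻¹ (1/ b) {{ℚ.normalize-pos 1 b}}

1/-anti : ∀ {a b} .{{_ : NonZero a}} .{{_ : NonZero b}} → a ≤ b → 1/ b ℚ.≤ 1/ a
1/-anti {a} {b} a≤b = begin
  1/ b                       ≡⟨ ℚ.*-identityˡ (1/ b) ⟨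
  1ℚ ℚ.* 1/ b                ≡⟨ cong (ℚ._* 1/ b) (frac-ι 1 a) ⟨
  1/ a ℚ.* ι a ℚ.* 1/ b      ≤⟨ *-monoʳ (1/ b) (0≤1/ b) (*-monoˡ (1/ a) (0≤1/ a) (ι-mono a≤b)) ⟩
  1/ a ℚ.* ι b ℚ.* 1/ b      ≡⟨ solve 3 (λ x y z → x :* y :* z := x :* (z :* y)) refl (1/ a) (ι b) (1/ b) ⟩
  1/ a ℚ.* (1/ b ℚ.* ι b)    ≡⟨ cong (1/ a ℚ.*_) (frac-ι 1 b) ⟩
  1/ a ℚ.* 1ℚ                ≡⟨ ℚ.*-identityʳ (1/ a) ⟩
  1/ a                       ∎
  where
  open ℚ.≤-Reasoning
  open +-*-Solver

harmonic-block : ∀ k m M .{{_ : NonZero M}} → k + m ≤ M → harmonic m ℚ.+ ι k ℚ.* 1/ M ℚ.≤ harmonic (k + m)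
harmonic-block zero    m M le = ℚ.≤-reflexive (trans (cong (harmonic m ℚ.+_) (ℚ.*-zeroˡ (1/ M))) (ℚ.+-identityʳ (harmonic m)))
harmonic-block (suc k) m M le = begin
  harmonic m ℚ.+ (1ℚ ℚ.+ ι k) ℚ.* 1/ M      ≡⟨ solve 3 (λ h κ u → h :+ (con 1ℚ :+ κ) :* u := (h :+ κ :* u) :+ u) refl (harmonic m) (ι k) (1/ M) ⟩
  harmonic m ℚ.+ ι k ℚ.* 1/ M ℚ.+ 1/ M      ≤⟨ ℚ.+-mono-≤ (harmonic-block k m M (ℕ.≤-trans (ℕ.n≤1+n _) le)) (1/-anti le) ⟩
  harmonic (k + m) ℚ.+ 1/ suc (k + m)       ∎
  where
  open ℚ.≤-Reasoning
  open +-*-Solver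

harmonic-mono : ∀ {a b} → a ≤ b → harmonic a ℚ.≤ harmonic b
harmonic-mono {a} {b} a≤b = subst (λ z → harmonic a ℚ.≤ harmonic z) (ℕ.m∸n+n≡m a≤b) (go (b ∸ a))
  where
  go : ∀ k → harmonic a ℚ.≤ harmonic (k + a)
  go zero    = ℚ.≤-refl
  go (suc k) = ℚ.≤-trans (go k) (≤-+ʳ (1/ suc (k + a)) (0≤1/ (suc (k + a))))

-- The m terms added are each at least 1/(2m).
harmonic-double : ∀ m .{{_ : NonZero m}} → harmonic m ℚ.+ ½ ℚ.≤ harmonic (2 * m)
harmonic-double m = begin
  harmonic m ℚ.+ ½                    ≡⟨ cong (harmonic m ℚ.+_) half ⟨
  harmonic m ℚ.+ ι m ℚ.* 1/ (2 * m)   ≤⟨ harmonic-block m m (2 * m) (ℕ.≤-reflexive (cong (m +_) (sym (ℕ.+-identityʳ m)))) ⟩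
  harmonic (m + m)                    ≡⟨ cong (λ z → harmonic (m + z)) (ℕ.+-identityʳ m) ⟨
  harmonic (2 * m)                    ∎
  where
  open ℚ.≤-Reasoning
  open +-*-Solver
  instance
    2m≢0 : NonZero (2 * m)
    2m≢0 = ℕ.m*n≢0 2 m
  half : ι m ℚ.* 1/ (2 * m) ≡ ½
  half = begin-equality
    ι m ℚ.* 1/ (2 * m)                  ≡⟨ ℚ.*-identityˡ _ ⟨
    ½ ℚ.* ι 2 ℚ.* (ι m ℚ.* 1/ (2 * m))  ≡⟨ solve 4 (λ h t m u → h :* t :* (m :* u) := h :* (u :* (t :* m))) refl ½ (ι 2) (ι m) (1/ (2 * m)) ⟩
    ½ ℚ.* (1/ (2 * m) ℚ.* (ι 2 ℚ.* ι m)) ≡⟨ cong (λ z → ½ ℚ.* (1/ (2 * m) ℚ.* z)) (ι-* 2 m) ⟨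
    ½ ℚ.* (1/ (2 * m) ℚ.* ι (2 * m))    ≡⟨ cong (½ ℚ.*_) (frac-ι 1 (2 * m)) ⟩
    ½ ℚ.* 1ℚ                            ≡⟨ ℚ.*-identityʳ ½ ⟩
    ½                                   ∎

harmonic-2^ : ∀ L m .{{_ : NonZero m}} → harmonic m ℚ.+ ι L ℚ.* ½ ℚ.≤ harmonic (2 ^ L * m)
harmonic-2^ zero    m = ℚ.≤-reflexive (trans (cong (harmonic m ℚ.+_) (ℚ.*-zeroˡ ½)) (trans (ℚ.+-identityʳ (harmonic m)) (cong harmonic (sym (ℕ.+-identityʳ m)))))
harmonic-2^ (suc L) m = begin
  harmonic m ℚ.+ (1ℚ ℚ.+ ι L) ℚ.* ½    ≡⟨ solve 3 (λ h κ u → h :+ (con 1ℚ :+ κ) :* u := (h :+ κ :* u) :+ u) refl (harmonic m) (ι L) ½ ⟩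
  harmonic m ℚ.+ ι L ℚ.* ½ ℚ.+ ½       ≤⟨ ℚ.+-monoˡ-≤ ½ (harmonic-2^ L m) ⟩
  harmonic (2 ^ L * m) ℚ.+ ½           ≤⟨ harmonic-double (2 ^ L * m) {{ℕ.m*n≢0 (2 ^ L) m {{ℕ.m^n≢0 2 L}}}} ⟩
  harmonic (2 * (2 ^ L * m))           ≡⟨ cong harmonic (ℕ.*-assoc 2 (2 ^ L) m) ⟨
  harmonic (2 ^ suc L * m)             ∎
  where
  open ℚ.≤-Reasoning
  open +-*-Solver

-- Each of the `L` doublings from r to n gains 1/2. The bound holds for every single Riemann sum
-- with k ≥ 1, so it can be used at a fixed approximation without passing to the limit.
lnSum-≥ : ∀ n r L k .{{_ : NonZero r}} .{{_ : NonZero k}} → 2 ^ L * r ≤ n → ι L ℚ.* ½ ℚ.≤ lnSum n r k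
lnSum-≥ n r L k 2^Lr≤n = begin
  ι L ℚ.* ½                                              ≡⟨ solve 2 (λ x y → y := x :+ y :- x) refl (harmonic (r * k)) (ι L ℚ.* ½) ⟩
  harmonic (r * k) ℚ.+ ι L ℚ.* ½ ℚ.- harmonic (r * k)    ≤⟨ ℚ.+-monoˡ-≤ (ℚ.- harmonic (r * k)) (ℚ.≤-trans (harmonic-2^ L (r * k) {{ℕ.m*n≢0 r k}}) (harmonic-mono le)) ⟩
  harmonic (n * k) ℚ.- harmonic (r * k)                  ∎
  where
  open ℚ.≤-Reasoning
  open +-*-Solver
  le : 2 ^ L * (r * k) ≤ n * k
  le = ℕ.≤-trans (ℕ.≤-reflexive (sym (ℕ.*-assoc (2 ^ L) r k))) (ℕ.*-monoˡ-≤ k 2^Lr≤n)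

-- Lipschitz dependence on the parameter

-- The bound `B` is carried along because the constant of a product depends on it. The domain |x| ≤
-- 2 leaves room for approximations of p outside [0, 1].
Lipschitz : (ℚ → ℚ) → Set
Lipschitz f = ∃ λ B → ∃ λ K → ∀ x y → ℚ.∣ x ∣ ℚ.≤ ι 2 → ℚ.∣ y ∣ ℚ.≤ ι 2 →
  ℚ.∣ f x ∣ ℚ.≤ ι B × ℚ.∣ f x ℚ.- f y ∣ ℚ.≤ ι K ℚ.* ℚ.∣ x ℚ.- y ∣

Lipschitz-const : ∀ {c} B → ℚ.∣ c ∣ ℚ.≤ ι B → Lipschitz (λ _ → c)
Lipschitz-const {c} B c≤B = B , 0 , λ x y _ _ → c≤B , ℚ.≤-reflexive (trans (cong ℚ.∣_∣ (ℚ.+-inverseʳ c)) (sym (ℚ.*-zeroˡ ℚ.∣ x ℚ.- y ∣)))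

Lipschitz-id : Lipschitz id
Lipschitz-id = 2 , 1 , λ x y x≤2 _ → x≤2 , ℚ.≤-reflexive (sym (ℚ.*-identityˡ ℚ.∣ x ℚ.- y ∣))

Lipschitz-1- : Lipschitz (λ x → 1ℚ ℚ.- x)
Lipschitz-1- = 3 , 1 , λ x y x≤2 _ →
  ℚ.≤-trans (ℚ.∣p+q∣≤∣p∣+∣q∣ 1ℚ (ℚ.- x)) (ℚ.+-monoʳ-≤ 1ℚ (ℚ.≤-trans (ℚ.≤-reflexive (ℚ.∣-p∣≡∣p∣ x)) x≤2)) ,
  ℚ.≤-reflexive (trans (cong ℚ.∣_∣ (solve 2 (λ x y → (con 1ℚ :- x) :- (con 1ℚ :- y) := :- (x :- y)) refl x y))
    (trans (ℚ.∣-p∣≡∣p∣ (x ℚ.- y)) (sym (ℚ.*-identityˡ ℚ.∣ x ℚ.- y ∣))))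
  where open +-*-Solver

Lipschitz-+ : ∀ {f g} → Lipschitz f → Lipschitz g → Lipschitz (λ x → f x ℚ.+ g x)
Lipschitz-+ {f} {g} (B , K , hf) (D , E , hg) = B + D , K + E , λ x y x≤ y≤ →
  let fB , fK = hf x y x≤ y≤
      gD , gE = hg x y x≤ y≤
  in (begin
    ℚ.∣ f x ℚ.+ g x ∣          ≤⟨ ℚ.∣p+q∣≤∣p∣+∣q∣ (f x) (g x) ⟩
    ℚ.∣ f x ∣ ℚ.+ ℚ.∣ g x ∣    ≤⟨ ℚ.+-mono-≤ fB gD ⟩
    ι B ℚ.+ ι D                ≡⟨ ι-+ B D ⟨
    ι (B + D)                  ∎) ,
  (begin
    ℚ.∣ (f x ℚ.+ g x) ℚ.- (f y ℚ.+ g y) ∣       ≡⟨ cong ℚ.∣_∣ (solve 4 (λ a b c d → (a :+ b) :- (c :+ d) := (a :- c) :+ (b :- d)) refl (f x) (g x) (f y) (g y)) ⟩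
    ℚ.∣ (f x ℚ.- f y) ℚ.+ (g x ℚ.- g y) ∣       ≤⟨ ℚ.∣p+q∣≤∣p∣+∣q∣ (f x ℚ.- f y) (g x ℚ.- g y) ⟩
    ℚ.∣ f x ℚ.- f y ∣ ℚ.+ ℚ.∣ g x ℚ.- g y ∣     ≤⟨ ℚ.+-mono-≤ fK gE ⟩
    ι K ℚ.* ℚ.∣ x ℚ.- y ∣ ℚ.+ ι E ℚ.* ℚ.∣ x ℚ.- y ∣  ≡⟨ ℚ.*-distribʳ-+ ℚ.∣ x ℚ.- y ∣ (ι K) (ι E) ⟨
    (ι K ℚ.+ ι E) ℚ.* ℚ.∣ x ℚ.- y ∣             ≡⟨ cong (ℚ._* ℚ.∣ x ℚ.- y ∣) (ι-+ K E) ⟨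
    ι (K + E) ℚ.* ℚ.∣ x ℚ.- y ∣                 ∎)
  where
  open ℚ.≤-Reasoning
  open +-*-Solver

Lipschitz-* : ∀ {f g} → Lipschitz f → Lipschitz g → Lipschitz (λ x → f x ℚ.* g x)
Lipschitz-* {f} {g} (B , K , hf) (D , E , hg) = B * D , B * E + D * K , λ x y x≤ y≤ →
  let fB , fK = hf x y x≤ y≤
      gD , gE = hg x y x≤ y≤
      gD′ , _ = hg y x y≤ x≤
  in (begin
    ℚ.∣ f x ℚ.* g x ∣          ≡⟨ ℚ.∣p*q∣≡∣p∣*∣q∣ (f x) (g x) ⟩
    ℚ.∣ f x ∣ ℚ.* ℚ.∣ g x ∣    ≤⟨ *-mono (ℚ.0≤∣p∣ (f x)) (0≤ι D) fB gD ⟩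
    ι B ℚ.* ι D                ≡⟨ ι-* B D ⟨
    ι (B * D)                  ∎) ,
  (begin
    ℚ.∣ f x ℚ.* g x ℚ.- f y ℚ.* g y ∣       ≡⟨ cong ℚ.∣_∣ (solve 4 (λ a b c d → a :* b :- c :* d := a :* (b :- d) :+ d :* (a :- c)) refl (f x) (g x) (f y) (g y)) ⟩
    ℚ.∣ f x ℚ.* (g x ℚ.- g y) ℚ.+ g y ℚ.* (f x ℚ.- f y) ∣       ≤⟨ ℚ.∣p+q∣≤∣p∣+∣q∣ (f x ℚ.* (g x ℚ.- g y)) (g y ℚ.* (f x ℚ.- f y)) ⟩
    ℚ.∣ f x ℚ.* (g x ℚ.- g y) ∣ ℚ.+ ℚ.∣ g y ℚ.* (f x ℚ.- f y) ∣
      ≡⟨ cong₂ ℚ._+_ (ℚ.∣p*q∣≡∣p∣*∣q∣ (f x) (g x ℚ.- g y)) (ℚ.∣p*q∣≡∣p∣*∣q∣ (g y) (f x ℚ.- f y)) ⟩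
    ℚ.∣ f x ∣ ℚ.* ℚ.∣ g x ℚ.- g y ∣ ℚ.+ ℚ.∣ g y ∣ ℚ.* ℚ.∣ f x ℚ.- f y ∣
      ≤⟨ ℚ.+-mono-≤ (*-mono (ℚ.0≤∣p∣ (f x)) (0≤* (0≤ι E) (ℚ.0≤∣p∣ (x ℚ.- y))) fB gE)
                    (*-mono (ℚ.0≤∣p∣ (g y)) (0≤* (0≤ι K) (ℚ.0≤∣p∣ (x ℚ.- y))) gD′ fK) ⟩
    ι B ℚ.* (ι E ℚ.* ℚ.∣ x ℚ.- y ∣) ℚ.+ ι D ℚ.* (ι K ℚ.* ℚ.∣ x ℚ.- y ∣)
      ≡⟨ solve 5 (λ b e d c z → b :* (e :* z) :+ d :* (c :* z) := (b :* e :+ d :* c) :* z) refl (ι B) (ι E) (ι D) (ι K) ℚ.∣ x ℚ.- y ∣ ⟩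
    (ι B ℚ.* ι E ℚ.+ ι D ℚ.* ι K) ℚ.* ℚ.∣ x ℚ.- y ∣
      ≡⟨ cong (ℚ._* ℚ.∣ x ℚ.- y ∣) (trans (ι-+ (B * E) (D * K)) (cong₂ ℚ._+_ (ι-* B E) (ι-* D K))) ⟨
    ι (B * E + D * K) ℚ.* ℚ.∣ x ℚ.- y ∣                 ∎)
  where
  open ℚ.≤-Reasoning
  open +-*-Solver

Lipschitz-^ : ∀ {f} k → Lipschitz f → Lipschitz (λ x → f x ^ℚ k)
Lipschitz-^ zero    hf = Lipschitz-const {1ℚ} 1 ℚ.≤-refl
Lipschitz-^ {f} (suc k) hf = Lipschitz-* {f} {λ x → f x ^ℚ k} hf (Lipschitz-^ k hf)

Lipschitz-∑ : ∀ (xs : List A) {f : ℚ → A → ℚ} → (∀ a → Lipschitz (λ q → f q a)) → Lipschitz (λ q → ∑ℚ.∑ xs (f q))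
Lipschitz-∑ []       hf = Lipschitz-const {0ℚ} 0 ℚ.≤-refl
Lipschitz-∑ (x ∷ xs) {f} hf = Lipschitz-+ {λ q → f q x} {λ q → ∑ℚ.∑ xs (f q)} (hf x) (Lipschitz-∑ xs hf)

Lipschitz-probability : {P : U.Pred (Subset n) 0ℓ} (P? : U.Decidable P) → Lipschitz (λ q → probability q P?)
Lipschitz-probability {n} P? = Lipschitz-∑ (filter P? (subsets n)) {weight} λ F →
  Lipschitz-* {λ q → q ^ℚ ∣ F ∣} {λ q → (1ℚ ℚ.- q) ^ℚ ∣ ∁ F ∣}
    (Lipschitz-^ ∣ F ∣ Lipschitz-id) (Lipschitz-^ ∣ ∁ F ∣ Lipschitz-1-)

-- Rational approximations of the parameter and of the probability

seq-sum : ∀ (xs : List A) (f : A → ℝ) k → seq (sumℝ (map f xs)) k ≡ ∑ℚ.∑ xs (λ x → seq (f x) k)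
seq-sum []       f k = refl
seq-sum (x ∷ xs) f k = cong (seq (f x) k ℚ.+_) (seq-sum xs f k)

seq-^ : ∀ x j k → seq (x ^ℝ j) k ≡ seq x k ^ℚ j
seq-^ x zero    k = refl
seq-^ x (suc j) k = cong (seq x k ℚ.*_) (seq-^ x j k)

seq-Pr : ∀ {N} (G : Graph N) p {P : U.Pred (Graph N) 0ℓ} (P? : U.Decidable P) k →
         seq (Pr G p P?) k ≡ probability (seq p k) (λ F → P? (spanningSubgraph G F))
seq-Pr G p P? k = trans
  (seq-sum (filter (λ F → P? (spanningSubgraph G F)) (subsets (length (edges G)))) _ k)
  (∑ℚ.∑-cong (filter (λ F → P? (spanningSubgraph G F)) (subsets (length (edges G))))
    (λ F → cong₂ ℚ._*_ (seq-^ p ∣ F ∣ k) (seq-^ (1ℝ -ℝ p) ∣ ∁ F ∣ k)))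

-- The rational approximations of a real number in [0, 1] may leave the interval.
clamp : ℚ → ℚ
clamp x with ℚ.≤-total x 0ℚ | ℚ.≤-total 1ℚ x
... | inj₁ _ | _      = 0ℚ
... | inj₂ _ | inj₁ _ = 1ℚ
... | inj₂ _ | inj₂ _ = x

0≤clamp : ∀ x → 0ℚ ℚ.≤ clamp x
0≤clamp x with ℚ.≤-total x 0ℚ | ℚ.≤-total 1ℚ x
... | inj₁ _   | _      = ℚ.≤-refl
... | inj₂ _   | inj₁ _ = 0≤1ℚ
... | inj₂ 0≤x | inj₂ _ = 0≤x

clamp≤1 : ∀ x → clamp x ℚ.≤ 1ℚ
clamp≤1 x with ℚ.≤-total x 0ℚ | ℚ.≤-total 1ℚ x
... | inj₁ _ | _        = 0≤1ℚ
... | inj₂ _ | inj₁ _   = ℚ.≤-refl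
... | inj₂ _ | inj₂ x≤1 = x≤1

-‿≤ : ∀ {x y z} → x ℚ.≤ y ℚ.+ z → x ℚ.- y ℚ.≤ z
-‿≤ {x} {y} {z} x≤y+z = ℚ.≤-trans (ℚ.+-monoˡ-≤ (ℚ.- y) x≤y+z)
  (ℚ.≤-reflexive (solve 2 (λ y z → y :+ z :- y := z) refl y z))
  where open +-*-Solver

clamp-close : ∀ {x t} → 0ℚ ℚ.≤ t → 0ℚ ℚ.≤ x ℚ.+ t → x ℚ.≤ 1ℚ ℚ.+ t → ℚ.∣ x ℚ.- clamp x ∣ ℚ.≤ t
clamp-close {x} {t} 0≤t lo hi with ℚ.≤-total x 0ℚ | ℚ.≤-total 1ℚ x
... | inj₂ _   | inj₂ _ = ℚ.≤-trans (ℚ.≤-reflexive (cong ℚ.∣_∣ (ℚ.+-inverseʳ x))) 0≤t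
... | inj₂ _   | inj₁ 1≤x = ℚ.≤-trans (ℚ.≤-reflexive (ℚ.0≤p⇒∣p∣≡p (≤⇒0≤- 1≤x))) (-‿≤ {x} {1ℚ} {t} hi)
... | inj₁ x≤0 | _ = begin
  ℚ.∣ x ℚ.- 0ℚ ∣      ≡⟨ ℚ.∣-p∣≡∣p∣ (x ℚ.- 0ℚ) ⟨
  ℚ.∣ ℚ.- (x ℚ.- 0ℚ) ∣ ≡⟨ cong ℚ.∣_∣ (solve 1 (λ x → :- (x :- con 0ℚ) := con 0ℚ :- x) refl x) ⟩
  ℚ.∣ 0ℚ ℚ.- x ∣      ≡⟨ ℚ.0≤p⇒∣p∣≡p (≤⇒0≤- x≤0) ⟩
  0ℚ ℚ.- x            ≤⟨ -‿≤ {0ℚ} {x} {t} lo ⟩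
  t                   ∎
  where
  open ℚ.≤-Reasoning
  open +-*-Solver

-- Clamping lowers `x` only when `x` exceeds 1, and then by at most `t`; this is the second `t`.
clamp-≥ : ∀ {x y t} → 0ℚ ℚ.≤ t → y ℚ.≤ x ℚ.+ t → x ℚ.≤ 1ℚ ℚ.+ t → y ℚ.≤ clamp x ℚ.+ (t ℚ.+ t)
clamp-≥ {x} {y} {t} 0≤t y≤ hi with ℚ.≤-total x 0ℚ | ℚ.≤-total 1ℚ x
... | inj₁ x≤0 | _      = ℚ.≤-trans y≤ (ℚ.+-mono-≤ x≤0 (≤-+ʳ t 0≤t))
... | inj₂ _   | inj₁ _ = ℚ.≤-trans y≤ (ℚ.≤-trans (ℚ.+-monoˡ-≤ t hi) (ℚ.≤-reflexive (ℚ.+-assoc 1ℚ t t)))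
... | inj₂ _   | inj₂ _ = ℚ.≤-trans y≤ (ℚ.+-monoʳ-≤ x (≤-+ʳ t 0≤t))

∣∣≤ : ∀ {p e} → p ℚ.≤ e → ℚ.- p ℚ.≤ e → ℚ.∣ p ∣ ℚ.≤ e
∣∣≤ {p} p≤e -p≤e with ℚ.∣p∣≡p∨∣p∣≡-p p
... | inj₁ eq = ℚ.≤-trans (ℚ.≤-reflexive eq) p≤e
... | inj₂ eq = ℚ.≤-trans (ℚ.≤-reflexive eq) -p≤e

∣∣≤2 : ∀ {x} → 0ℚ ℚ.≤ x ℚ.+ 1ℚ → x ℚ.≤ 1ℚ ℚ.+ 1ℚ → ℚ.∣ x ∣ ℚ.≤ ι 2
∣∣≤2 {x} lo hi = ∣∣≤ hi (ℚ.≤-trans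
  (ℚ.≤-trans (ℚ.≤-reflexive (sym (ℚ.+-identityˡ (ℚ.- x)))) (-‿≤ {0ℚ} {x} {1ℚ} lo)) (≤-+ʳ 1ℚ 0≤1ℚ))

infixr 2 _∧_
_∧_ : ∀ {P Q : ℕ → Set} → Eventually P → Eventually Q → ∀ᶠ[ k ] (P k × Q k)
(K , h) ∧ (L , g) = K ℕ.⊔ L , λ k le → h k (ℕ.m⊔n≤o⇒m≤o K L le) , g k (ℕ.m⊔n≤o⇒n≤o K L le)

-- With a = ⌊n/D⌋ + 1 the excess of aD over n is at most D, and D ≤ n bounds it by n.
ceiling : ∀ D n → 1 ≤ D → D ≤ n → ∃ λ a → n ≤ a * D × a * D ≤ 2 * n
ceiling D n 1≤D D≤n = suc (n ℕ./ D) ,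
  ℕ.≤-trans (ℕ.≤-reflexive (ℕ.m≡m%n+[m/n]*n n D)) (ℕ.+-monoˡ-≤ (n ℕ./ D * D) (ℕ.<⇒≤ (ℕ.m%n<n n D))) ,
  ℕ.≤-trans (ℕ.+-mono-≤ D≤n (ℕ.m/n*n≤m n D)) (ℕ.≤-reflexive (cong (n +_) (sym (ℕ.+-identityʳ n))))
  where instance
    D≢0 : NonZero D
    D≢0 = ℕ.>-nonZero 1≤D

ι-cancelˡ : ∀ n {x y} .{{_ : NonZero n}} → ι n ℚ.* x ℚ.≤ ι n ℚ.* y → x ℚ.≤ y
ι-cancelˡ n {x} {y} le = begin
  x                          ≡⟨ shrink x ⟨
  1/ n ℚ.* (ι n ℚ.* x)       ≤⟨ *-monoˡ (1/ n) (0≤1/ n) le ⟩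
  1/ n ℚ.* (ι n ℚ.* y)       ≡⟨ shrink y ⟩
  y                          ∎
  where
  open ℚ.≤-Reasoning
  shrink : ∀ x → 1/ n ℚ.* (ι n ℚ.* x) ≡ x
  shrink x = trans (sym (ℚ.*-assoc (1/ n) (ι n) x)) (trans (cong (ℚ._* x) (frac-ι 1 n)) (ℚ.*-identityˡ x))

module Limit (n r s L : ℕ) (s<r : s < r) (r<n : r < n) (20≤s : 20 ≤ s) (20≤L : 20 ≤ L)
  (2^L≤n : 2 ^ L * r ≤ n) (n<2^L : n ≤ 2 ^ suc L * r) (sparse : 2048 * (r * r) ≤ n) (small : 256 * suc s ≤ r)
  .{{_ : NonZero n}} .{{_ : NonZero r}} (p : ℝ) (0≤p : 0ℝ ≤ℝ p) (p≤1 : p ≤ℝ 1ℝ)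
  (ln≤p : fromℚ (ℤ.+ (16 * s * r ^ 2) / n) *ℝ ln[ n / r ] ≤ℝ p)
  where

  private
    -- The hypothesis on p and ln (n/r) ≥ L/2 would give 8 in place of 7. The eighth copy of s r² L
    -- is at least 1 and absorbs the approximation error.
    D : ℕ
    D = 7 * (s * (r * r) * L)

    D≥1 : 1 ≤ D
    D≥1 = ℕ.*-mono-≤ {1} {7} (s≤s z≤n) (ℕ.*-mono-≤ (ℕ.*-mono-≤ (ℕ.≤-trans (s≤s z≤n) 20≤s)
      (ℕ.*-mono-≤ (ℕ.≤-trans (s≤s z≤n) s<r) (ℕ.≤-trans (s≤s z≤n) s<r))) (ℕ.≤-trans (s≤s z≤n) 20≤L))

    c : ℚ
    c = ℤ.+ (16 * s * r ^ 2) / n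

    -- Clamping an approximation loses 2t = 1/n, which becomes exactly 1 after multiplication by n.
    t : ℚ
    t = ½ ℚ.* 1/ n

    0≤t : 0ℚ ℚ.≤ t
    0≤t = 0≤* 0≤½ (0≤1/ n)

    0<t : 0ℚ ℚ.< t
    0<t = subst (ℚ._< t) (ℚ.*-zeroʳ ½) (ℚ.*-monoʳ-<-pos ½ (0<1/ n))

    clamp-lower : ∀ k x .{{_ : NonZero k}} → c ℚ.* lnSum n r k ℚ.≤ x ℚ.+ t → x ℚ.≤ 1ℚ ℚ.+ t →
                  ι D ℚ.≤ ι n ℚ.* clamp x
    clamp-lower k x cl hi = ℚ.≤-trans (≤-cancel (ι-mono D+1≤)) (begin
      ι (8 * (s * (r * r) * L)) ℚ.- 1ℚ
        ≡⟨ cong (ℚ._- 1ℚ) main ⟩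
      ι n ℚ.* (c ℚ.* (ι L ℚ.* ½)) ℚ.- 1ℚ
        ≤⟨ ℚ.+-monoˡ-≤ (ℚ.- 1ℚ) (*-monoˡ (ι n) (0≤ι n) (*-monoˡ c 0≤c (lnSum-≥ n r L k 2^L≤n))) ⟩
      ι n ℚ.* (c ℚ.* lnSum n r k) ℚ.- 1ℚ
        ≤⟨ ℚ.+-monoˡ-≤ (ℚ.- 1ℚ) (*-monoˡ (ι n) (0≤ι n) (clamp-≥ 0≤t cl hi)) ⟩
      ι n ℚ.* (clamp x ℚ.+ (t ℚ.+ t)) ℚ.- 1ℚ
        ≡⟨ final ⟩
      ι n ℚ.* clamp x ∎)
      where
      open ℚ.≤-Reasoning
      open +-*-Solver
      S = s * (r * r) * L
      D+1≤ : suc D ≤ 8 * S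
      D+1≤ = ℕ.+-monoˡ-≤ D (ℕ.*-mono-≤ (ℕ.*-mono-≤ (ℕ.≤-trans (s≤s z≤n) 20≤s)
        (ℕ.*-mono-≤ (ℕ.≤-trans (s≤s z≤n) s<r) (ℕ.≤-trans (s≤s z≤n) s<r))) (ℕ.≤-trans (s≤s z≤n) 20≤L))
      ≤-cancel : ∀ {x y} → 1ℚ ℚ.+ x ℚ.≤ y → x ℚ.≤ y ℚ.- 1ℚ
      ≤-cancel {x} {y} h = ℚ.≤-trans (ℚ.≤-reflexive (solve 1 (λ x → x := con 1ℚ :+ x :- con 1ℚ) refl x)) (ℚ.+-monoˡ-≤ (ℚ.- 1ℚ) h)
      0≤c : 0ℚ ℚ.≤ c
      0≤c = ℚ.nonNegative⁻¹ c {{ℚ.normalize-nonNeg (16 * s * r ^ 2) n}}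
      lem : ∀ s r L → 2 * (8 * (s * (r * r) * L)) ≡ 16 * s * (r * (r * 1)) * L
      lem = solve-∀
      main : ι (8 * S) ≡ ι n ℚ.* (c ℚ.* (ι L ℚ.* ½))
      main = begin-equality
        ι (8 * S)                                ≡⟨ solve 1 (λ x → x := (con (ι 2) :* x) :* con ½) refl (ι (8 * S)) ⟩
        (ι 2 ℚ.* ι (8 * S)) ℚ.* ½                ≡⟨ cong (ℚ._* ½) (ι-* 2 (8 * S)) ⟨
        ι (2 * (8 * S)) ℚ.* ½                    ≡⟨ cong (λ z → ι z ℚ.* ½) (lem s r L) ⟩
        ι (16 * s * r ^ 2 * L) ℚ.* ½             ≡⟨ cong (ℚ._* ½) (ι-* (16 * s * r ^ 2) L) ⟩
        ι (16 * s * r ^ 2) ℚ.* ι L ℚ.* ½         ≡⟨ cong (λ z → z ℚ.* ι L ℚ.* ½) (frac-ι (16 * s * r ^ 2) n) ⟨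
        c ℚ.* ι n ℚ.* ι L ℚ.* ½                  ≡⟨ solve 4 (λ c n l h → c :* n :* l :* h := n :* (c :* (l :* h))) refl c (ι n) (ι L) ½ ⟩
        ι n ℚ.* (c ℚ.* (ι L ℚ.* ½))              ∎
      final : ι n ℚ.* (clamp x ℚ.+ (t ℚ.+ t)) ℚ.- 1ℚ ≡ ι n ℚ.* clamp x
      final = begin-equality
        ι n ℚ.* (clamp x ℚ.+ (t ℚ.+ t)) ℚ.- 1ℚ
          ≡⟨ solve 3 (λ n q u → n :* (q :+ (con ½ :* u :+ con ½ :* u)) :- con 1ℚ := n :* q :+ (u :* n :- con 1ℚ)) refl (ι n) (clamp x) (1/ n) ⟩
        ι n ℚ.* clamp x ℚ.+ (1/ n ℚ.* ι n ℚ.- 1ℚ)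
          ≡⟨ cong (λ z → ι n ℚ.* clamp x ℚ.+ (z ℚ.- 1ℚ)) (frac-ι 1 n) ⟩
        ι n ℚ.* clamp x ℚ.+ (1ℚ ℚ.- 1ℚ)
          ≡⟨ ℚ.+-identityʳ (ι n ℚ.* clamp x) ⟩
        ι n ℚ.* clamp x ∎

    M : ℕ
    M = (n ∸ s) C (r ∸ s)

    high-probability : ∀ q → 0ℚ ℚ.≤ q → q ℚ.≤ 1ℚ → ι D ℚ.≤ ι n ℚ.* q →
                       1ℚ ℚ.≤ probability q (extremal? n r s) ℚ.+ (½ ^ℚ n ℚ.+ ½ ^ℚ n)
    high-probability q 0≤q q≤1 D≤nq =
      let a , n≤aD , aD≤2n = ceiling D n D≥1 D≤n
      in Estimates.failure n r s L a s<r r<n 20≤s 20≤L n<2^L sparse small aD≤2n 0≤q q≤1 (1≤aq a n≤aD)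
      where
      open ℚ.≤-Reasoning
      -- The size of `D` is controlled by p being a probability: D ≤ nq ≤ n.
      D≤n : D ≤ n
      D≤n = ι-cancel-≤ (ℚ.≤-trans D≤nq (ℚ.≤-trans (*-monoˡ (ι n) (0≤ι n) q≤1) (ℚ.≤-reflexive (ℚ.*-identityʳ (ι n)))))
      1≤aq : ∀ a → n ≤ a * D → 1ℚ ℚ.≤ ι a ℚ.* q
      1≤aq a n≤aD = ι-cancelˡ n (begin
        ι n ℚ.* 1ℚ             ≡⟨ ℚ.*-identityʳ (ι n) ⟩
        ι n                    ≤⟨ ι-mono n≤aD ⟩
        ι (a * D)              ≡⟨ ι-* a D ⟩
        ι a ℚ.* ι D            ≤⟨ *-monoˡ (ι a) (0≤ι a) D≤nq ⟩
        ι a ℚ.* (ι n ℚ.* q)    ≡⟨ solve 3 (λ a n q → a :* (n :* q) := n :* (a :* q)) refl (ι a) (ι n) q ⟩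
        ι n ℚ.* (ι a ℚ.* q)    ∎)
        where open +-*-Solver

  -- With n fixed, the probability is a polynomial in the parameter, hence Lipschitz. Each late
  -- approximation of p is compared with its clamped value, where the failure bound applies; `ε`
  -- covers the failure and `ε′` the comparison.
  close : ∀ ε → ½ ^ℚ n ℚ.+ ½ ^ℚ n ℚ.≤ ε →
          ∣ Pr G⟨ n , r ,< s ⟩ p (λ H → α H ≟ M) -ℝ 1ℝ ∣ℝ ≤ℝ fromℚ ε
  close ε tail≤ε ε′ 0<ε′ = proj₁ evs , λ k le → bound k (proj₂ evs k le)
    where
    open ℚ.≤-Reasoning
    open +-*-Solver
    lip = Lipschitz-probability (extremal? n r s)
    K = proj₁ (proj₂ lip)
    u : ℚ
    u = 1/ suc K ℚ.* ε′
    0<u : 0ℚ ℚ.< u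
    0<u = subst (ℚ._< u) (ℚ.*-zeroʳ (1/ suc K)) (ℚ.*-monoʳ-<-pos (1/ suc K) {{ℚ.normalize-pos 1 (suc K)}} 0<ε′)
    0≤u = ℚ.<⇒≤ 0<u
    0<1 = ℚ.positive⁻¹ 1ℚ
    -- The condition 1 ≤ k excludes the empty Riemann sum, for which the logarithm would be
    -- approximated by 0.
    evs = 0≤p u 0<u ∧ p≤1 u 0<u ∧ 0≤p 1ℚ 0<1 ∧ p≤1 1ℚ 0<1 ∧ p≤1 t 0<t ∧ ln≤p t 0<t ∧ (1 , λ k 1≤k → 1≤k)
    bound : ∀ k → (0ℚ ℚ.≤ seq p k ℚ.+ u) × (seq p k ℚ.≤ 1ℚ ℚ.+ u) × (0ℚ ℚ.≤ seq p k ℚ.+ 1ℚ) × (seq p k ℚ.≤ 1ℚ ℚ.+ 1ℚ) ×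
            (seq p k ℚ.≤ 1ℚ ℚ.+ t) × (c ℚ.* lnSum n r k ℚ.≤ seq p k ℚ.+ t) × 1 ≤ k →
            ℚ.∣ seq (Pr G⟨ n , r ,< s ⟩ p (λ H → α H ≟ M)) k ℚ.- 1ℚ ∣ ℚ.≤ ε ℚ.+ ε′
    bound k (lo , hi , lo₁ , hi₁ , hiₜ , cl , 1≤k) = begin
      ℚ.∣ seq (Pr G⟨ n , r ,< s ⟩ p (λ H → α H ≟ M)) k ℚ.- 1ℚ ∣
        ≡⟨ cong (λ z → ℚ.∣ z ℚ.- 1ℚ ∣) (seq-Pr G⟨ n , r ,< s ⟩ p (λ H → α H ≟ M) k) ⟩
      ℚ.∣ φ x ℚ.- 1ℚ ∣                          ≡⟨ cong ℚ.∣_∣ (solve 3 (λ a b o → a :- o := (b :- o) :+ (a :- b)) refl (φ x) (φ q) 1ℚ) ⟩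
      ℚ.∣ (φ q ℚ.- 1ℚ) ℚ.+ (φ x ℚ.- φ q) ∣      ≤⟨ ℚ.∣p+q∣≤∣p∣+∣q∣ (φ q ℚ.- 1ℚ) (φ x ℚ.- φ q) ⟩
      ℚ.∣ φ q ℚ.- 1ℚ ∣ ℚ.+ ℚ.∣ φ x ℚ.- φ q ∣    ≤⟨ ℚ.+-mono-≤ main perturb ⟩
      ε ℚ.+ ε′                                  ∎
      where
      x = seq p k
      q = clamp x
      φ : ℚ → ℚ
      φ y = probability y (extremal? n r s)
      1≤φ : 1ℚ ℚ.≤ φ q ℚ.+ (½ ^ℚ n ℚ.+ ½ ^ℚ n)
      1≤φ = high-probability q (0≤clamp x) (clamp≤1 x) (clamp-lower k x {{ℕ.>-nonZero 1≤k}} cl hiₜ)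
      φ≤1 : φ q ℚ.≤ 1ℚ
      φ≤1 = probability-≤1 (0≤clamp x) (clamp≤1 x) (extremal? n r s)
      main : ℚ.∣ φ q ℚ.- 1ℚ ∣ ℚ.≤ ε
      main = ∣∣≤ {φ q ℚ.- 1ℚ}
        (ℚ.≤-trans (-‿≤ {φ q} {1ℚ} {0ℚ} (ℚ.≤-trans φ≤1 (ℚ.≤-reflexive refl))) (ℚ.≤-trans (0≤+ (0≤½^ n) (0≤½^ n)) tail≤ε))
        (ℚ.≤-trans (ℚ.≤-reflexive (solve 2 (λ a o → :- (a :- o) := o :- a) refl (φ q) 1ℚ)) (ℚ.≤-trans (-‿≤ {1ℚ} {φ q} {½ ^ℚ n ℚ.+ ½ ^ℚ n} 1≤φ) tail≤ε))
      ∣q∣≤2 : ℚ.∣ q ∣ ℚ.≤ ι 2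
      ∣q∣≤2 = ∣∣≤2 (0≤+ (0≤clamp x) 0≤1ℚ) (ℚ.≤-trans (clamp≤1 x) (≤-+ʳ 1ℚ 0≤1ℚ))
      perturb : ℚ.∣ φ x ℚ.- φ q ∣ ℚ.≤ ε′
      perturb = begin
        ℚ.∣ φ x ℚ.- φ q ∣               ≤⟨ proj₂ (proj₂ (proj₂ lip) x q (∣∣≤2 lo₁ hi₁) ∣q∣≤2) ⟩
        ι K ℚ.* ℚ.∣ x ℚ.- q ∣           ≤⟨ *-mono (0≤ι K) 0≤u (ι-mono (ℕ.n≤1+n K)) (clamp-close 0≤u lo hi) ⟩
        ι (suc K) ℚ.* (1/ suc K ℚ.* ε′) ≡⟨ solve 3 (λ a b c → a :* (b :* c) := (b :* a) :* c) refl (ι (suc K)) (1/ suc K) ε′ ⟩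
        1/ suc K ℚ.* ι (suc K) ℚ.* ε′   ≡⟨ cong (ℚ._* ε′) (frac-ι 1 (suc K)) ⟩
        1ℚ ℚ.* ε′                       ≡⟨ ℚ.*-identityˡ ε′ ⟩
        ε′                              ∎

-- Growth hypotheses and the limit

=o⇒* : ∀ {f g} → f =o g → ∀ K .{{_ : NonZero K}} → ∀ᶠ[ n ] (K * f n ≤ g n)
=o⇒* {f} {g} f=og K = proj₁ h , λ n le → ι-cancel-≤ (begin
  ι (K * f n)                      ≡⟨ ι-* K (f n) ⟩
  ι K ℚ.* ι (f n)                  ≡⟨ cong (ι K ℚ.*_) (frac-1 (f n)) ⟨
  ι K ℚ.* (ℤ.+ f n / 1)            ≤⟨ *-monoˡ (ι K) (0≤ι K) (proj₂ h n le) ⟩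
  ι K ℚ.* (1/ K ℚ.* (ℤ.+ g n / 1)) ≡⟨ solve 3 (λ k u g → k :* (u :* g) := (u :* k) :* g) refl (ι K) (1/ K) (ℤ.+ g n / 1) ⟩
  1/ K ℚ.* ι K ℚ.* (ℤ.+ g n / 1)   ≡⟨ cong₂ ℚ._*_ (frac-ι 1 K) (frac-1 (g n)) ⟩
  1ℚ ℚ.* ι (g n)                   ≡⟨ ℚ.*-identityˡ (ι (g n)) ⟩
  ι (g n)                          ∎)
  where
  open ℚ.≤-Reasoning
  open +-*-Solver
  h = f=og (1/ K) (0<1/ K)

n<2^n : ∀ n → n < 2 ^ n
n<2^n zero    = s≤s z≤n
n<2^n (suc n) = ℕ.≤-trans (ℕ.+-mono-≤ (ℕ.≤-trans (s≤s z≤n) (n<2^n n)) (n<2^n n))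
  (ℕ.≤-reflexive (cong (2 ^ n +_) (sym (ℕ.+-identityʳ (2 ^ n)))))

-- An upward search from `L₀`. The value n suffices as fuel, because n < 2^n and r ≥ 1.
dyadic-bracket : ∀ L₀ n r → 1 ≤ r → 2 ^ L₀ * r ≤ n → ∃ λ L → L₀ ≤ L × 2 ^ L * r ≤ n × n ≤ 2 ^ suc L * r
dyadic-bracket L₀ n r 1≤r = go n L₀ (ℕ.≤-trans (ℕ.<⇒≤ (n<2^n n)) (ℕ.≤-trans
    (ℕ.^-monoʳ-≤ 2 (ℕ.≤-trans (ℕ.m≤m+n n L₀) (ℕ.n≤1+n _))) (ℕ.m≤m*n (2 ^ suc (n + L₀)) r {{ℕ.>-nonZero 1≤r}})))
  where
  go : ∀ fuel L → n ≤ 2 ^ suc (fuel + L) * r → 2 ^ L * r ≤ n → ∃ λ L′ → L ≤ L′ × 2 ^ L′ * r ≤ n × n ≤ 2 ^ suc L′ * r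
  go zero       L hi lo = L , ℕ.≤-refl , lo , hi
  go (suc fuel) L hi lo with n ≤? 2 ^ suc L * r
  ... | yes n≤ = L , ℕ.≤-refl , lo , n≤
  ... | no  n≰ = let L′ , L<L′ , lo′ , hi′ = go fuel (suc L) (subst (λ k → n ≤ 2 ^ suc k * r) (sym (ℕ.+-suc fuel L)) hi) (ℕ.<⇒≤ (ℕ.≰⇒> n≰))
                 in L′ , ℕ.<⇒≤ L<L′ , lo′ , hi′

archimedean : ∀ ε → 0ℚ ℚ.< ε → ∃ λ d → 1ℚ ℚ.≤ ι (suc d) ℚ.* ε
archimedean ε@(mkℚ ℤ.+[1+ k ] d _) _ = d , (begin
  1ℚ                                        ≤⟨ ι-mono (s≤s (z≤n {k})) ⟩
  ι (suc k)                                 ≡⟨ frac-ι (suc k) (suc d) ⟨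
  (ℤ.+ suc k / suc d) ℚ.* ι (suc d)         ≡⟨ cong (ℚ._* ι (suc d)) (ℚ.↥p/↧p≡p ε) ⟩
  ε ℚ.* ι (suc d)                           ≡⟨ ℚ.*-comm ε (ι (suc d)) ⟩
  ι (suc d) ℚ.* ε                           ∎)
  where open ℚ.≤-Reasoning
archimedean (mkℚ (ℤ.+ 0) _ _) (ℚ.*<* (ℤ.+<+ ()))
archimedean (mkℚ ℤ.-[1+ _ ] _ _) (ℚ.*<* ())

tail-small : ∀ ε → 0ℚ ℚ.< ε → ∀ᶠ[ n ] (½ ^ℚ n ℚ.+ ½ ^ℚ n ℚ.≤ ε)
tail-small ε 0<ε = suc d , λ { (suc n) (s≤s d≤n) → small n d≤n }
  where
  open ℚ.≤-Reasoning
  open +-*-Solver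
  d = proj₁ (archimedean ε 0<ε)
  small : ∀ n → d ≤ n → ½ ^ℚ suc n ℚ.+ ½ ^ℚ suc n ℚ.≤ ε
  small n d≤n = begin
    ½ ℚ.* h ℚ.+ ½ ℚ.* h                 ≡⟨ solve 1 (λ h → con ½ :* h :+ con ½ :* h := h :* con 1ℚ) refl h ⟩
    h ℚ.* 1ℚ                            ≤⟨ *-monoˡ h (0≤½^ n) (proj₂ (archimedean ε 0<ε)) ⟩
    h ℚ.* (ι (suc d) ℚ.* ε)             ≤⟨ *-monoˡ h (0≤½^ n) (*-monoʳ ε (ℚ.<⇒≤ 0<ε) (ι-mono (ℕ.≤-trans (s≤s d≤n) (n<2^n n)))) ⟩
    h ℚ.* (ι (2 ^ n) ℚ.* ε)             ≡⟨ solve 3 (λ h a e → h :* (a :* e) := (a :* h) :* e) refl h (ι (2 ^ n)) ε ⟩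
    ι (2 ^ n) ℚ.* h ℚ.* ε               ≡⟨ cong (ℚ._* ε) (ι2^*½^ n) ⟩
    1ℚ ℚ.* ε                            ≡⟨ ℚ.*-identityˡ ε ⟩
    ε                                   ∎
    where h = ½ ^ℚ n

open import Data.Integer using (+_)

theorem1 : (r s : ℕ → ℕ) (p : ℕ → ℝ) →
    (∀ᶠ[ n ] (1 ≤ s n × s n < r n × r n < n)) →
    r ⟶∞ →
    s ⟶∞ →
    s =o r →
    (λ n → r n ^ 2) =o (λ n → n) →
    (∀ᶠ[ n ] (0ℝ ≤ℝ p n × p n ≤ℝ 1ℝ)) →
    (∀ᶠ[ n ] (.{{_ : NonZero n}} .{{_ : NonZero (r n)}} →
    fromℚ (+ (16 * s n * r n ^ 2) / n) *ℝ ln[ n / r n ] ≤ℝ p n)) →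
    (λ n → Pr G⟨ n , r n ,< s n ⟩ (p n) (λ H → α H ≟ ((n ∸ s n) C (r n ∸ s n)))) ⟶ 1ℝ
theorem1 r s p sizes r→∞ s→∞ s=or r²=on p∈[0,1] (N₀ , ln≤p) ε 0<ε =
  -- r ≥ 2^20 together with r² ≤ n gives n/r ≥ 2^20, hence L ≥ 20. The factor 512 allows for the
  -- step from s to s + 1 in 256(s + 1) ≤ r.
  let N₁ , eventually = sizes ∧ r→∞ (2 ^ 20) ∧ s→∞ 20 ∧ =o⇒* {s} {r} s=or 512
                          ∧ =o⇒* {λ n → r n ^ 2} {λ n → n} r²=on 2048 ∧ p∈[0,1] ∧ tail-small ε 0<ε
  in N₀ ℕ.⊔ N₁ , λ n le →
       at n (ln≤p n (ℕ.m⊔n≤o⇒m≤o N₀ N₁ le)) (eventually n (ℕ.m⊔n≤o⇒n≤o N₀ N₁ le))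
  where
  at : ∀ n → (.{{_ : NonZero n}} .{{_ : NonZero (r n)}} → fromℚ (+ (16 * s n * r n ^ 2) / n) *ℝ ln[ n / r n ] ≤ℝ p n) →
       (1 ≤ s n × s n < r n × r n < n) × 2 ^ 20 ≤ r n × 20 ≤ s n × 512 * s n ≤ r n × 2048 * r n ^ 2 ≤ n ×
       (0ℝ ≤ℝ p n × p n ≤ℝ 1ℝ) × (½ ^ℚ n ℚ.+ ½ ^ℚ n ℚ.≤ ε) →
       ∣ Pr G⟨ n , r n ,< s n ⟩ (p n) (λ H → α H ≟ ((n ∸ s n) C (r n ∸ s n))) -ℝ 1ℝ ∣ℝ ≤ℝ fromℚ ε
  at n ln≤pₙ ((1≤s , s<r , r<n) , 2^20≤r , 20≤s , 512s≤r , 2048r²≤n , (0≤p , p≤1) , tail≤ε) =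
    let L , 20≤L , lo , hi = dyadic-bracket 20 n (r n) 1≤r (ℕ.≤-trans (ℕ.*-monoˡ-≤ (r n) 2^20≤r) r*r≤n)
    in Limit.close n (r n) (s n) L s<r r<n 20≤s 20≤L lo hi sparse small (p n) 0≤p p≤1 ln≤pₙ ε tail≤ε
    where
    1≤r : 1 ≤ r n
    1≤r = ℕ.≤-trans (s≤s z≤n) s<r
    instance
      n≢0 : NonZero n
      n≢0 = ℕ.>-nonZero (ℕ.≤-trans (s≤s z≤n) r<n)
      r≢0 : NonZero (r n)
      r≢0 = ℕ.>-nonZero 1≤r
    sparse : 2048 * (r n * r n) ≤ n
    sparse = subst (λ z → 2048 * (r n * z) ≤ n) (ℕ.*-identityʳ (r n)) 2048r²≤n
    r*r≤n : r n * r n ≤ n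
    r*r≤n = ℕ.≤-trans (ℕ.m≤n*m (r n * r n) 2048) sparse
    small : 256 * suc (s n) ≤ r n
    small = begin
      256 * suc (s n)        ≡⟨ ℕ.*-suc 256 (s n) ⟩
      256 + 256 * s n        ≤⟨ ℕ.+-monoˡ-≤ (256 * s n) (ℕ.m≤m*n 256 (s n) {{ℕ.>-nonZero 1≤s}}) ⟩
      256 * s n + 256 * s n  ≡⟨ ℕ.*-distribʳ-+ (s n) 256 256 ⟨
      512 * s n              ≤⟨ 512s≤r ⟩
      r n                    ∎
      where open ℕ.≤-Reasoning
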